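{- Let $n\geq 2$. Then the polynomial $D_n(x)=\sum_{k\ge 1}D(n,k)x^k$ has degree $\lfloor n/2\rfloor$ and has real roots only. All these roots are simple and non-positive. Furthermore, for $n\ge 3$ the roots of $D_n(x)$ and $D_{n-1}(x)$ are interlacing in the following sense. If $D_n(x)$ and $D_{n-1}(x)$ are both of degree $d$, and their roots are, respectively, $0=x_0>x_1>\cdots>x_{d-1}$ and $0=y_0>y_1>\cdots>y_{d-1}$, then $$0>x_1>y_1>x_2>y_2>\cdots>x_{d-1}>y_{d-1},$$ while if $D_n(x)$ is of degree $d+1$ and $D_{n-1}(x)$ is of degree $d$, and their roots are, respectively, $0=x_0>x_1>\cdots>x_d$ and $0=y_0>y_1>\cdots>y_{d-1}$, then $$0>x_1>y_1>x_2>y_2>\cdots>x_{d-1}>y_{d-1}>x_d.$$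
   Context: For positive integers $n,k$, $D(n,k)$ denotes the number of partitions of the set $[n]=\{1,2,\dots,n\}$ into exactly $k$ blocks, each block consisting of more than one element. When $d=1$, the first chain of inequalities is empty and the second one reads $0>x_1$. -}

module Defs where

open import Algebra.Bundles.Raw using (RawRing)
open import Data.Fin.Base using (Fin)
import Data.Fin.Properties as Fin
open import Data.Fin.Subset using (Subset; inside; outside; _∈_; _∩_; Nonempty; Empty; ∣_∣)
open import Data.Fin.Subset.Properties using (nonempty?; _∈?_)
open import Data.Integer.Base using (+_)
open import Data.List.Base using (List; []; _∷_; _++_; map; length; filter; upTo)
open import Data.List.Relation.Unary.All as All using (All)
open import Data.List.Relation.Unary.AllPairs as AllPairs using (AllPairs)
open import Data.List.Relation.Unary.Any as Any using (Any)
open import Data.List.Relation.Unary.Linked using (Linked)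
open import Data.Nat.Base as ℕ using (ℕ; zero; suc)
import Data.Nat.Properties as ℕ
open import Data.Product.Base using (Σ-syntax; ∃-syntax; _×_; _,_)
open import Data.Rational.Base as ℚ using (ℚ; 0ℚ; 1ℚ; ½)
import Data.Rational.Properties as ℚ
open import Data.Rational.Solver using (module +-*-Solver)
open import Data.Sum.Base using (_⊎_)
open import Data.Vec.Base as Vec using ()
open import Level using (0ℓ)
open import Relation.Binary.PropositionalEquality using (_≡_; _≢_; refl; sym; trans; cong; subst)
open import Relation.Nullary using (¬_; Dec)
open import Relation.Nullary.Decidable using (_×-dec_; ¬?)

subsets : ∀ n → List (Subset n)
subsets zero    = Vec.[] ∷ []
subsets (suc n) = map (outside Vec.∷_) (subsets n) ++ map (inside Vec.∷_) (subsets n)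

sublists : ∀ {A : Set} → List A → List (List A)
sublists []       = [] ∷ []
sublists (x ∷ xs) = sublists xs ++ map (x ∷_) (sublists xs)

-- `subsets n` has no repetitions, so each set of subsets of Fin n occurs
-- exactly once among its sublists.
families : ∀ n → List (List (Subset n))
families n = sublists (subsets n)

IsPartition : ∀ {n} → List (Subset n) → Set
IsPartition {n} P =
    All Nonempty P
  × AllPairs (λ A B → Empty (A ∩ B)) P
  × (∀ (i : Fin n) → Any (i ∈_) P)

isPartition? : ∀ {n} (P : List (Subset n)) → Dec (IsPartition P)
isPartition? P =
        All.all? nonempty? P
  ×-dec AllPairs.allPairs? (λ A B → ¬? (nonempty? (A ∩ B))) P
  ×-dec Fin.all? (λ i → Any.any? (i ∈?_) P)

IsCounted : ∀ {n} → ℕ → List (Subset n) → Set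
IsCounted k P = IsPartition P × length P ≡ k × All (λ B → 1 ℕ.< ∣ B ∣) P

isCounted? : ∀ {n} k (P : List (Subset n)) → Dec (IsCounted k P)
isCounted? k P =
  isPartition? P ×-dec length P ℕ.≟ k ×-dec All.all? (λ B → 1 ℕ.<? ∣ B ∣) P

D : ℕ → ℕ → ℕ
D n k = length (filter (isCounted? k) (families n))

-- The sum defining the polynomial starts at k = 1.
DCoeff : ℕ → ℕ → ℕ
DCoeff n zero    = 0
DCoeff n (suc k) = D n (suc k)

HasDegree : (ℕ → ℕ) → ℕ → Set
HasDegree a d = a d ≢ 0 × (∀ k → d ℕ.< k → a k ≡ 0)

IsCauchy : (ℕ → ℚ) → Set
IsCauchy x = ∀ ε → 0ℚ ℚ.< ε →
  ∃[ N ] (∀ m n → N ℕ.≤ m → N ℕ.≤ n → ℚ.∣ x m ℚ.- x n ∣ ℚ.< ε)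

record ℝ : Set where
  constructor mkℝ
  field
    seq    : ℕ → ℚ
    cauchy : IsCauchy seq

open ℝ public

infix 4 _≈_ _<_ _>_ _≤_ _#_

_≈_ : ℝ → ℝ → Set
x ≈ y = ∀ ε → 0ℚ ℚ.< ε →
  ∃[ N ] (∀ n → N ℕ.≤ n → ℚ.∣ seq x n ℚ.- seq y n ∣ ℚ.< ε)

_<_ : ℝ → ℝ → Set
x < y = Σ[ ε ∈ ℚ ] (0ℚ ℚ.< ε ×
  ∃[ N ] (∀ n → N ℕ.≤ n → seq x n ℚ.+ ε ℚ.< seq y n))

_>_ : ℝ → ℝ → Set
x > y = y < x

_≤_ : ℝ → ℝ → Set
x ≤ y = ¬ (y < x)

_#_ : ℝ → ℝ → Set
x # y = x < y ⊎ y < x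

private
  open +-*-Solver using (solve; _:=_; _:+_; _:*_; :-_; _:-_)

  diff-+ : ∀ p q r s → (p ℚ.+ q) ℚ.- (r ℚ.+ s) ≡ (p ℚ.- r) ℚ.+ (q ℚ.- s)
  diff-+ = solve 4 (λ a b c d → (a :+ b) :- (c :+ d) := (a :- c) :+ (b :- d)) refl

  diff-* : ∀ p q r s → p ℚ.* q ℚ.- r ℚ.* s ≡ p ℚ.* (q ℚ.- s) ℚ.+ s ℚ.* (p ℚ.- r)
  diff-* = solve 4 (λ a b c d → a :* b :- c :* d := a :* (b :- d) :+ d :* (a :- c)) refl

  diff-neg : ∀ p q → ℚ.- (p ℚ.- q) ≡ (ℚ.- p) ℚ.- (ℚ.- q)
  diff-neg = solve 2 (λ a b → :- (a :- b) := (:- a) :- (:- b)) refl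

  diff-cancel : ∀ p q → p ≡ (p ℚ.- q) ℚ.+ q
  diff-cancel = solve 2 (λ a b → a := (a :- b) :+ b) refl

∣p-p∣<ε : ∀ p {ε} → 0ℚ ℚ.< ε → ℚ.∣ p ℚ.- p ∣ ℚ.< ε
∣p-p∣<ε p {ε} ε>0 = subst (λ r → ℚ.∣ r ∣ ℚ.< ε) (sym (ℚ.+-inverseʳ p)) ε>0

½>0 : ∀ {ε} → 0ℚ ℚ.< ε → 0ℚ ℚ.< ½ ℚ.* ε
½>0 {ε} ε>0 = subst (ℚ._< ½ ℚ.* ε) (ℚ.*-zeroʳ ½) (ℚ.*-monoʳ-<-pos ½ ε>0)

½+½ : ∀ ε → ½ ℚ.* ε ℚ.+ ½ ℚ.* ε ≡ ε
½+½ ε = trans (sym (ℚ.*-distribʳ-+ ε ½ ½)) (ℚ.*-identityˡ ε)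

+-cauchy : ∀ {x y} → IsCauchy x → IsCauchy y → IsCauchy (λ n → x n ℚ.+ y n)
+-cauchy {x} {y} cx cy ε ε>0 with cx (½ ℚ.* ε) (½>0 ε>0) | cy (½ ℚ.* ε) (½>0 ε>0)
... | M , px | N , py = M ℕ.⊔ N , λ m n hm hn → begin-strict
  ℚ.∣ (x m ℚ.+ y m) ℚ.- (x n ℚ.+ y n) ∣
    ≡⟨ cong ℚ.∣_∣ (diff-+ (x m) (y m) (x n) (y n)) ⟩
  ℚ.∣ (x m ℚ.- x n) ℚ.+ (y m ℚ.- y n) ∣
    ≤⟨ ℚ.∣p+q∣≤∣p∣+∣q∣ (x m ℚ.- x n) (y m ℚ.- y n) ⟩
  ℚ.∣ x m ℚ.- x n ∣ ℚ.+ ℚ.∣ y m ℚ.- y n ∣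
    <⟨ ℚ.+-mono-< (px m n (ℕ.m⊔n≤o⇒m≤o M N hm) (ℕ.m⊔n≤o⇒m≤o M N hn))
                  (py m n (ℕ.m⊔n≤o⇒n≤o M N hm) (ℕ.m⊔n≤o⇒n≤o M N hn)) ⟩
  ½ ℚ.* ε ℚ.+ ½ ℚ.* ε
    ≡⟨ ½+½ ε ⟩
  ε ∎
  where open ℚ.≤-Reasoning

-‿cauchy : ∀ {x} → IsCauchy x → IsCauchy (λ n → ℚ.- x n)
-‿cauchy {x} cx ε ε>0 with cx ε ε>0
... | N , p = N , λ m n hm hn → subst (ℚ._< ε)
  (trans (sym (ℚ.∣-p∣≡∣p∣ (x m ℚ.- x n)))
         (cong ℚ.∣_∣ (diff-neg (x m) (x n))))
  (p m n hm hn)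

eventuallyBounded : ∀ {x} → IsCauchy x →
  Σ[ B ∈ ℚ ] (0ℚ ℚ.< B × ∃[ N ] (∀ n → N ℕ.≤ n → ℚ.∣ x n ∣ ℚ.≤ B))
eventuallyBounded {x} cx with cx 1ℚ (ℚ.positive⁻¹ 1ℚ)
... | N , p = 1ℚ ℚ.+ ℚ.∣ x N ∣
            , ℚ.+-mono-<-≤ (ℚ.positive⁻¹ 1ℚ) (ℚ.0≤∣p∣ (x N))
            , N , λ n hn → begin
  ℚ.∣ x n ∣
    ≡⟨ cong ℚ.∣_∣ (diff-cancel (x n) (x N)) ⟩
  ℚ.∣ (x n ℚ.- x N) ℚ.+ x N ∣
    ≤⟨ ℚ.∣p+q∣≤∣p∣+∣q∣ (x n ℚ.- x N) (x N) ⟩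
  ℚ.∣ x n ℚ.- x N ∣ ℚ.+ ℚ.∣ x N ∣
    ≤⟨ ℚ.+-monoˡ-≤ ℚ.∣ x N ∣ (ℚ.<⇒≤ (p n N hn ℕ.≤-refl)) ⟩
  1ℚ ℚ.+ ℚ.∣ x N ∣ ∎
  where open ℚ.≤-Reasoning

divide : ∀ {B ε} → 0ℚ ℚ.< B → 0ℚ ℚ.< ε → Σ[ δ ∈ ℚ ] (0ℚ ℚ.< δ × B ℚ.* δ ≡ ε)
divide {B} {ε} B>0 ε>0 = 1/B ℚ.* ε , δ>0 , eq
  where
  instance
    B-pos : ℚ.Positive B
    B-pos = ℚ.positive B>0
    B-nonZero : ℚ.NonZero B
    B-nonZero = ℚ.pos⇒nonZero B
  1/B : ℚ
  1/B = ℚ.1/ B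
  instance
    1/B-pos : ℚ.Positive 1/B
    1/B-pos = ℚ.1/pos⇒pos B
  δ>0 : 0ℚ ℚ.< 1/B ℚ.* ε
  δ>0 = subst (ℚ._< 1/B ℚ.* ε) (ℚ.*-zeroʳ 1/B) (ℚ.*-monoʳ-<-pos 1/B ε>0)
  eq : B ℚ.* (1/B ℚ.* ε) ≡ ε
  eq = trans (sym (ℚ.*-assoc B 1/B ε))
       (trans (cong (ℚ._* ε) (ℚ.*-inverseʳ B)) (ℚ.*-identityˡ ε))

∣*∣-bound : ∀ {p q B δ} → 0ℚ ℚ.< B → ℚ.∣ p ∣ ℚ.≤ B → ℚ.∣ q ∣ ℚ.< δ →
            ℚ.∣ p ℚ.* q ∣ ℚ.< B ℚ.* δ
∣*∣-bound {p} {q} {B} {δ} B>0 hp hq = begin-strict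
  ℚ.∣ p ℚ.* q ∣            ≡⟨ ℚ.∣p*q∣≡∣p∣*∣q∣ p q ⟩
  ℚ.∣ p ∣ ℚ.* ℚ.∣ q ∣      ≤⟨ ℚ.*-monoʳ-≤-nonNeg ℚ.∣ q ∣ {{ℚ.nonNegative (ℚ.0≤∣p∣ q)}} hp ⟩
  B ℚ.* ℚ.∣ q ∣            <⟨ ℚ.*-monoʳ-<-pos B {{ℚ.positive B>0}} hq ⟩
  B ℚ.* δ                  ∎
  where open ℚ.≤-Reasoning

∣diff-*∣-bound : ∀ p q r s {A B δ} → 0ℚ ℚ.< A → 0ℚ ℚ.< B →
  ℚ.∣ p ∣ ℚ.≤ A → ℚ.∣ s ∣ ℚ.≤ B → ℚ.∣ q ℚ.- s ∣ ℚ.< δ → ℚ.∣ p ℚ.- r ∣ ℚ.< δ →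
  ℚ.∣ p ℚ.* q ℚ.- r ℚ.* s ∣ ℚ.< (A ℚ.+ B) ℚ.* δ
∣diff-*∣-bound p q r s {A} {B} {δ} A>0 B>0 hp hs hqs hpr = begin-strict
  ℚ.∣ p ℚ.* q ℚ.- r ℚ.* s ∣
    ≡⟨ cong ℚ.∣_∣ (diff-* p q r s) ⟩
  ℚ.∣ p ℚ.* (q ℚ.- s) ℚ.+ s ℚ.* (p ℚ.- r) ∣
    ≤⟨ ℚ.∣p+q∣≤∣p∣+∣q∣ (p ℚ.* (q ℚ.- s)) (s ℚ.* (p ℚ.- r)) ⟩
  ℚ.∣ p ℚ.* (q ℚ.- s) ∣ ℚ.+ ℚ.∣ s ℚ.* (p ℚ.- r) ∣
    <⟨ ℚ.+-mono-< (∣*∣-bound {p} {q ℚ.- s} {A} {δ} A>0 hp hqs)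
                  (∣*∣-bound {s} {p ℚ.- r} {B} {δ} B>0 hs hpr) ⟩
  A ℚ.* δ ℚ.+ B ℚ.* δ
    ≡⟨ sym (ℚ.*-distribʳ-+ δ A B) ⟩
  (A ℚ.+ B) ℚ.* δ ∎
  where open ℚ.≤-Reasoning

*-cauchy : ∀ {x y} → IsCauchy x → IsCauchy y → IsCauchy (λ n → x n ℚ.* y n)
*-cauchy {x} {y} cx cy ε ε>0 =
  let A , A>0 , K , hx = eventuallyBounded {x} cx
      B , B>0 , L , hy = eventuallyBounded {y} cy
      δ , δ>0 , eq     = divide {A ℚ.+ B} {ε} (ℚ.+-mono-< {0ℚ} {A} {0ℚ} {B} A>0 B>0) ε>0
      M , px = cx δ δ>0
      N , py = cy δ δ>0
      hKL : ∀ {o} → (K ℕ.⊔ L) ℕ.⊔ (M ℕ.⊔ N) ℕ.≤ o → K ℕ.⊔ L ℕ.≤ o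
      hKL = ℕ.m⊔n≤o⇒m≤o (K ℕ.⊔ L) (M ℕ.⊔ N)
      hMN : ∀ {o} → (K ℕ.⊔ L) ℕ.⊔ (M ℕ.⊔ N) ℕ.≤ o → M ℕ.⊔ N ℕ.≤ o
      hMN = ℕ.m⊔n≤o⇒n≤o (K ℕ.⊔ L) (M ℕ.⊔ N)
  in (K ℕ.⊔ L) ℕ.⊔ (M ℕ.⊔ N) , λ m n hm hn →
     subst (ℚ.∣ x m ℚ.* y m ℚ.- x n ℚ.* y n ∣ ℚ.<_) eq
       (∣diff-*∣-bound (x m) (y m) (x n) (y n) {A} {B} {δ} A>0 B>0
         (hx m (ℕ.m⊔n≤o⇒m≤o K L (hKL hm)))
         (hy n (ℕ.m⊔n≤o⇒n≤o K L (hKL hn)))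
         (py m n (ℕ.m⊔n≤o⇒n≤o M N (hMN hm)) (ℕ.m⊔n≤o⇒n≤o M N (hMN hn)))
         (px m n (ℕ.m⊔n≤o⇒m≤o M N (hMN hm)) (ℕ.m⊔n≤o⇒m≤o M N (hMN hn))))

fromℚ : ℚ → ℝ
fromℚ p = mkℝ (λ _ → p) (λ ε ε>0 → 0 , λ m n _ _ → ∣p-p∣<ε p ε>0)

fromℕ : ℕ → ℝ
fromℕ n = fromℚ (+ n ℚ./ 1)

0ℝ 1ℝ : ℝ
0ℝ = fromℚ 0ℚ
1ℝ = fromℚ 1ℚ

infixl 6 _+_ _-_
infixl 7 _*_
infix  8 -_

_+_ _*_ : ℝ → ℝ → ℝ
x + y = mkℝ (λ n → seq x n ℚ.+ seq y n) (+-cauchy {seq x} {seq y} (cauchy x) (cauchy y))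
x * y = mkℝ (λ n → seq x n ℚ.* seq y n) (*-cauchy {seq x} {seq y} (cauchy x) (cauchy y))

-_ : ℝ → ℝ
- x = mkℝ (λ n → ℚ.- seq x n) (-‿cauchy {seq x} (cauchy x))

_-_ : ℝ → ℝ → ℝ
x - y = x + (- y)

record ℂ : Set where
  constructor _+i_
  field
    re im : ℝ

open ℂ public

infix 4 _≈ᶜ_ _#ᶜ_

_≈ᶜ_ _#ᶜ_ : ℂ → ℂ → Set
z ≈ᶜ w = re z ≈ re w × im z ≈ im w
z #ᶜ w = re z # re w ⊎ im z # im w

ofReal : ℝ → ℂ
ofReal x = x +i 0ℝ

0ℂ : ℂ
0ℂ = ofReal 0ℝ

ℂ-rawRing : RawRing 0ℓ 0ℓ
ℂ-rawRing = record
  { Carrier = ℂ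
  ; _≈_     = _≈ᶜ_
  ; _+_     = λ z w → (re z + re w) +i (im z + im w)
  ; _*_     = λ z w → (re z * re w - im z * im w) +i (re z * im w + im z * re w)
  ; -_      = λ z → (- re z) +i (- im z)
  ; 0#      = 0ℂ
  ; 1#      = ofReal 1ℝ
  }

module Polynomial (R : RawRing 0ℓ 0ℓ) where
  private module R = RawRing R
  open R using (Carrier; 0#; 1#)

  -- Coefficient lists, constant coefficient first.
  Poly : Set
  Poly = List Carrier

  eval : Poly → Carrier → Carrier
  eval []      z = 0#
  eval (a ∷ p) z = a R.+ z R.* eval p z

  coeff : Poly → ℕ → Carrier
  coeff []      _       = 0#
  coeff (a ∷ p) zero    = a
  coeff (a ∷ p) (suc k) = coeff p k

  -- Lists differing by trailing zeros denote the same polynomial.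
  infix 4 _≈ₚ_
  _≈ₚ_ : Poly → Poly → Set
  p ≈ₚ q = ∀ k → coeff p k R.≈ coeff q k

  infixl 6 _+ₚ_
  _+ₚ_ : Poly → Poly → Poly
  []      +ₚ q       = q
  (a ∷ p) +ₚ []      = a ∷ p
  (a ∷ p) +ₚ (b ∷ q) = (a R.+ b) ∷ (p +ₚ q)

  infixl 7 _*ₚ_
  _*ₚ_ : Poly → Poly → Poly
  []      *ₚ q = []
  (a ∷ p) *ₚ q = map (a R.*_) q +ₚ (0# ∷ (p *ₚ q))

  X-_ : Carrier → Poly
  X- z = (R.- z) ∷ 1# ∷ []

  IsRoot : Poly → Carrier → Set
  IsRoot p z = eval p z R.≈ 0#

open Polynomial ℂ-rawRing public

-- Multiplicity exactly one, with q(z) ≠ 0 read as apartness.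
IsSimpleRoot : Poly → ℂ → Set
IsSimpleRoot p z = Σ[ q ∈ Poly ] (p ≈ₚ (X- z) *ₚ q × eval q z #ᶜ 0ℂ)

-- D(n,k) = 0 for k > n, since blocks are nonempty and disjoint, so cutting
-- the sum over k ≥ 1 off at k = n loses no term.
DPoly : ℕ → Poly
DPoly n = map (λ k → ofReal (fromℕ (DCoeff n k))) (upTo (suc n))

-- The complex roots of p are the real numbers rs, listed as r₀ > r₁ > ⋯.
AreRootsOf : List ℝ → Poly → Set
AreRootsOf rs p =
    Linked _>_ rs
  × All (λ r → IsRoot p (ofReal r)) rs
  × (∀ z → IsRoot p z → Any (λ r → z ≈ᶜ ofReal r) rs)

-- x₁, y₁, x₂, y₂, …
interleave : ∀ {A : Set} → List A → List A → List A
interleave []       ys = ys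
interleave (x ∷ xs) ys = x ∷ interleave ys xs

{-# OPTIONS --safe #-}
module Submission where

-- Removing the block of one element from a partition of [n+1] expresses
-- D(n+1,k) as a binomial sum of the D(j,k-1) with j < n; in terms of the
-- generating functions (eˣ - 1 - x)ᵏ / k! of the D(·,k), that sum equals
-- k D(n,k) + n D(n-1,k-1).  Writing Dₙ(x) = x Eₙ(x), the resulting recurrence
-- reads Eₙ₊₁ = Eₙ + x Eₙ′ + n x Eₙ₋₁.  If the negative roots of Eₙ and Eₙ₋₁
-- interlace, then at the roots r of Eₙ both Eₙ′(r) and Eₙ₋₁(r) alternate in
-- sign in the same way, hence so does Eₙ₊₁(r) = r (Eₙ′(r) + n Eₙ₋₁(r)).
-- Together with Eₙ₊₁(0) > 0 and, when the degree grows, the sign at -∞, the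
-- intermediate value theorem yields as many roots of Eₙ₊₁ as its degree,
-- interlacing those of Eₙ.
--
-- Constructively, the root is found by bisection between rational points, where
-- signs are decidable, and a complex root z of a polynomial with real roots
-- r₀ > r₁ > ⋯ can be located because re z < rᵢ or re z > rᵢ₊₁ for each i.

open import Algebra.Bundles using (CommutativeRing; RawRing)
open import Algebra.Structures using (IsCommutativeRing)
open import Level using (0ℓ)
import Defs

-- Equality and order on ℝ are undecidable, so no step may ask whether a real value vanishes.
-- Counting roots is therefore replaced by explicit factorisation: as many separated roots as the
-- degree write the polynomial as a constant times linear factors, and the signs of values and
-- derivatives are read off from the factors. Cancellability of a factor (`Regular`) stands in for
-- division. This lets one factorisation argument serve ℝ, where the leading constant must be
-- positive, and ℂ, where it need only be cancellable. The root 0 is split off first because Dₙ₊₁(0)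
-- = 0 carries no sign, whereas the quotient is positive there. All coefficients are natural
-- numbers, so the terms of the Cauchy sequence of a value are values of one fixed rational
-- polynomial; this is what reduces sign questions to ℚ. Finally, the interlacing claim speaks of
-- arbitrary lists of roots, which have to be identified with the constructed ones.

-- A ring solver with integer constants for any commutative ring.

module IntegerSolver (R : CommutativeRing 0ℓ 0ℓ) where
  open CommutativeRing R
  open import Algebra.Properties.Ring ring
  open import Algebra.Properties.AbelianGroup +-abelianGroup using (⁻¹-∙-comm)
  open import Algebra.Properties.Semiring.Mult.TCOptimised semiring
  open import Algebra.Solver.Ring.AlmostCommutativeRing using (_-Raw-AlmostCommutative⟶_; fromCommutativeRing)
  open import Data.Integer.Base as ℤ using (ℤ; +_; -[1+_]; _⊖_)
  import Data.Integer.Properties as ℤ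
  open import Data.Maybe.Base using (Maybe)
  open import Data.Nat.Base as ℕ using (zero; suc)
  open import Relation.Binary.Consequences using (dec⇒weaklyDec)
  import Relation.Binary.PropositionalEquality as ≡
  open ≡ using (_≡_)
  open import Relation.Binary.Reasoning.Setoid setoid

  -- Constants are integers because the solver has to compare them, and equality in ℝ and ℂ cannot
  -- be decided.
  ⟦_⟧ℤ : ℤ → Carrier
  ⟦ + n      ⟧ℤ = n × 1#
  ⟦ -[1+ n ] ⟧ℤ = - (suc n × 1#)

  private
    -‿homo : ∀ i → ⟦ ℤ.- i ⟧ℤ ≈ - ⟦ i ⟧ℤ
    -‿homo (+ zero)  = sym -0#≈0#
    -‿homo (+ suc n) = refl
    -‿homo -[1+ n ]  = sym (-‿involutive _)

    1+×1 : ∀ n → suc n × 1# ≈ 1# + n × 1#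
    1+×1 n = ×-homo-+ 1# 1 n

    cancel-1 : ∀ x y → (1# + x) - (1# + y) ≈ x - y
    cancel-1 x y = begin
      (1# + x) + - (1# + y)     ≈⟨ +-cong (+-comm 1# x) (sym (⁻¹-∙-comm 1# y)) ⟩
      (x + 1#) + (- 1# + - y)   ≈⟨ +-assoc x 1# _ ⟩
      x + (1# + (- 1# + - y))   ≈⟨ +-congˡ (sym (+-assoc 1# (- 1#) (- y))) ⟩
      x + ((1# + - 1#) + - y)   ≈⟨ +-congˡ (+-congʳ (-‿inverseʳ 1#)) ⟩
      x + (0# + - y)            ≈⟨ +-congˡ (+-identityˡ (- y)) ⟩
      x - y                     ∎

    ⊖-homo : ∀ m n → ⟦ m ⊖ n ⟧ℤ ≈ m × 1# - n × 1#
    ⊖-homo m       zero    = sym (trans (+-congˡ -0#≈0#) (+-identityʳ _))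
    ⊖-homo zero    (suc n) = sym (+-identityˡ _)
    ⊖-homo (suc m) (suc n) = begin
      ⟦ suc m ⊖ suc n ⟧ℤ               ≡⟨ ≡.cong ⟦_⟧ℤ (ℤ.[1+m]⊖[1+n]≡m⊖n m n) ⟩
      ⟦ m ⊖ n ⟧ℤ                       ≈⟨ ⊖-homo m n ⟩
      m × 1# - n × 1#                  ≈⟨ sym (cancel-1 (m × 1#) (n × 1#)) ⟩
      (1# + m × 1#) - (1# + n × 1#)    ≈⟨ sym (+-cong (1+×1 m) (-‿cong (1+×1 n))) ⟩
      suc m × 1# - suc n × 1#          ∎

    +-homo : ∀ i j → ⟦ i ℤ.+ j ⟧ℤ ≈ ⟦ i ⟧ℤ + ⟦ j ⟧ℤ
    +-homo (+ m)    (+ n)    = ×-homo-+ 1# m n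
    +-homo (+ m)    -[1+ n ] = ⊖-homo m (suc n)
    +-homo -[1+ m ] (+ n)    = trans (⊖-homo n (suc m)) (+-comm _ _)
    +-homo -[1+ m ] -[1+ n ] = begin
      - (suc (suc (m ℕ.+ n)) × 1#)           ≡⟨ ≡.cong (λ k → - (suc k × 1#)) (≡.sym (ℕ.+-suc m n)) ⟩
      - ((suc m ℕ.+ suc n) × 1#)             ≈⟨ -‿cong (×-homo-+ 1# (suc m) (suc n)) ⟩
      - (suc m × 1# + suc n × 1#)            ≈⟨ sym (⁻¹-∙-comm _ _) ⟩
      - (suc m × 1#) + - (suc n × 1#)        ∎
      where import Data.Nat.Properties as ℕ

    *-homo : ∀ i j → ⟦ i ℤ.* j ⟧ℤ ≈ ⟦ i ⟧ℤ * ⟦ j ⟧ℤ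
    *-homo (+ m) (+ n) = trans (reflexive (≡.cong ⟦_⟧ℤ (ℤ.+◃n≡+n (m ℕ.* n)))) (×1-homo-* m n)
    *-homo (+ m) -[1+ n ] = begin
      ⟦ + m ℤ.* -[1+ n ] ⟧ℤ       ≡⟨ ≡.cong ⟦_⟧ℤ (ℤ.-◃n≡-n (m ℕ.* suc n)) ⟩
      ⟦ ℤ.- (+ (m ℕ.* suc n)) ⟧ℤ  ≈⟨ -‿homo (+ (m ℕ.* suc n)) ⟩
      - ((m ℕ.* suc n) × 1#)      ≈⟨ -‿cong (×1-homo-* m (suc n)) ⟩
      - (m × 1# * suc n × 1#)     ≈⟨ -‿distribʳ-* _ _ ⟩
      m × 1# * - (suc n × 1#)     ∎
    *-homo -[1+ m ] (+ n) = begin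
      ⟦ -[1+ m ] ℤ.* + n ⟧ℤ       ≡⟨ ≡.cong ⟦_⟧ℤ (ℤ.-◃n≡-n (suc m ℕ.* n)) ⟩
      ⟦ ℤ.- (+ (suc m ℕ.* n)) ⟧ℤ  ≈⟨ -‿homo (+ (suc m ℕ.* n)) ⟩
      - ((suc m ℕ.* n) × 1#)      ≈⟨ -‿cong (×1-homo-* (suc m) n) ⟩
      - (suc m × 1# * n × 1#)     ≈⟨ -‿distribˡ-* _ _ ⟩
      - (suc m × 1#) * n × 1#     ∎
    *-homo -[1+ m ] -[1+ n ] = begin
      ⟦ + (suc m ℕ.* suc n) ⟧ℤ             ≈⟨ ×1-homo-* (suc m) (suc n) ⟩
      suc m × 1# * suc n × 1#              ≈⟨ sym (-‿involutive _) ⟩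
      - (- (suc m × 1# * suc n × 1#))      ≈⟨ -‿cong (-‿distribˡ-* _ _) ⟩
      - (- (suc m × 1#) * suc n × 1#)      ≈⟨ -‿distribʳ-* _ _ ⟩
      - (suc m × 1#) * - (suc n × 1#)      ∎

    morphism : ℤ.+-*-rawRing -Raw-AlmostCommutative⟶ fromCommutativeRing R
    morphism = record
      { ⟦_⟧ = ⟦_⟧ℤ ; +-homo = +-homo ; *-homo = *-homo ; -‿homo = -‿homo ; 0-homo = refl ; 1-homo = refl }

    weaklyDec : ∀ i j → Maybe (⟦ i ⟧ℤ ≈ ⟦ j ⟧ℤ)
    weaklyDec i j = Data.Maybe.Base.map (λ eq → reflexive (≡.cong ⟦_⟧ℤ eq)) (dec⇒weaklyDec ℤ._≟_ i j)

  open import Algebra.Solver.Ring ℤ.+-*-rawRing (fromCommutativeRing R) morphism weaklyDec public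
    using (solve; _:=_; _:+_; _:*_; :-_; _:-_; con)

-- Factoring polynomials with known roots over a commutative ring.

module Factorisation (R : CommutativeRing 0ℓ 0ℓ) where
  open CommutativeRing R hiding (zero)
  open IntegerSolver R using (solve; _:=_; _:+_; _:*_; :-_; _:-_; con)
  open import Data.Integer.Base using (+_)
  open import Data.List.Base using (List; []; _∷_; length; map; applyUpTo)
  open import Data.List.Relation.Unary.All as All using (All; []; _∷_)
  open import Data.List.Relation.Unary.AllPairs using (AllPairs; []; _∷_)
  open import Data.List.Relation.Unary.Any using (Any; here; there)
  open import Data.Nat.Base as ℕ using (ℕ; zero; suc)
  open import Data.Nat.Properties using (suc-injective)
  open import Data.Product.Base using (_,_)
  open import Function.Base using (_∘_)
  open import Relation.Binary.PropositionalEquality as ≡ using (_≡_)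
  open import Relation.Binary.Reasoning.Setoid setoid
  open Defs.Polynomial rawRing

  -- The formal derivative, by the product rule on `a + x p(x)`.
  deval : Poly → Carrier → Carrier
  deval []      x = 0#
  deval (a ∷ p) x = eval p x + x * deval p x

  -- The quotient of a ∷ p by X - r, for any a (synthetic division).
  horner : Poly → Carrier → Poly
  horner []      r = []
  horner (b ∷ p) r = eval (b ∷ p) r ∷ horner p r

  eval-cong : ∀ p {x y} → x ≈ y → eval p x ≈ eval p y
  eval-cong []      eq = refl
  eval-cong (a ∷ p) eq = +-congˡ (*-cong eq (eval-cong p eq))

  deval-cong : ∀ p {x y} → x ≈ y → deval p x ≈ deval p y
  deval-cong []      eq = refl
  deval-cong (a ∷ p) eq = +-cong (eval-cong p eq) (*-cong eq (deval-cong p eq))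

  eval-horner : ∀ a p r x → eval (a ∷ p) x ≈ eval (a ∷ p) r + (x - r) * eval (horner p r) x
  eval-horner a []      r x =
    solve 3 (λ a r x → a :+ x :* con (+ 0) := (a :+ r :* con (+ 0)) :+ (x :- r) :* con (+ 0)) refl a r x
  eval-horner a (b ∷ p) r x = begin
    a + x * eval (b ∷ p) x
      ≈⟨ +-congˡ (*-congˡ (eval-horner b p r x)) ⟩
    a + x * (P + (x - r) * Q)
      ≈⟨ solve 5 (λ a x r P Q → a :+ x :* (P :+ (x :- r) :* Q)
           := (a :+ r :* P) :+ (x :- r) :* (P :+ x :* Q)) refl a x r P Q ⟩
    (a + r * P) + (x - r) * (P + x * Q) ∎
    where
    P = eval (b ∷ p) r
    Q = eval (horner p r) x

  deval-horner : ∀ a p r x →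
    deval (a ∷ p) x ≈ eval (horner p r) x + (x - r) * deval (horner p r) x
  deval-horner a []      r x =
    solve 2 (λ r x → con (+ 0) :+ x :* con (+ 0) := con (+ 0) :+ (x :- r) :* con (+ 0)) refl r x
  deval-horner a (b ∷ p) r x = begin
    eval (b ∷ p) x + x * deval (b ∷ p) x
      ≈⟨ +-cong (eval-horner b p r x) (*-congˡ (deval-horner b p r x)) ⟩
    (P + (x - r) * Q) + x * (Q + (x - r) * Q′)
      ≈⟨ solve 5 (λ x r P Q Q′ → (P :+ (x :- r) :* Q) :+ x :* (Q :+ (x :- r) :* Q′)
           := (P :+ x :* Q) :+ (x :- r) :* (Q :+ x :* Q′)) refl x r P Q Q′ ⟩
    (P + x * Q) + (x - r) * (Q + x * Q′) ∎
    where
    P  = eval (b ∷ p) r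
    Q  = eval (horner p r) x
    Q′ = deval (horner p r) x

  -- Differentiating p(x) = p(r) + (x - r) q(x) at r gives q(r) = p′(r). Simplicity of a root
  -- thereby becomes a statement about the derivative.
  eval-horner-self : ∀ a p r → eval (horner p r) r ≈ deval (a ∷ p) r
  eval-horner-self a p r = sym (trans (deval-horner a p r r)
    (solve 3 (λ q r q′ → q :+ (r :- r) :* q′ := q) refl (eval (horner p r) r) r (deval (horner p r) r)))

  coeff-+ₚ : ∀ p q k → coeff (p +ₚ q) k ≈ coeff p k + coeff q k
  coeff-+ₚ []      q       k       = sym (+-identityˡ _)
  coeff-+ₚ (a ∷ p) []      k       = sym (+-identityʳ _)
  coeff-+ₚ (a ∷ p) (b ∷ q) zero    = refl
  coeff-+ₚ (a ∷ p) (b ∷ q) (suc k) = coeff-+ₚ p q k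

  coeff-map-* : ∀ c p k → coeff (map (c *_) p) k ≈ c * coeff p k
  coeff-map-* c []      k       = sym (zeroʳ c)
  coeff-map-* c (a ∷ p) zero    = refl
  coeff-map-* c (a ∷ p) (suc k) = coeff-map-* c p k

  coeff-X-*ₚ-zero : ∀ r q → coeff ((X- r) *ₚ q) 0 ≈ - r * coeff q 0
  coeff-X-*ₚ-zero r q = trans (coeff-+ₚ (map (- r *_) q) _ 0)
    (trans (+-identityʳ _) (coeff-map-* (- r) q 0))

  coeff-X-*ₚ-suc : ∀ r q k → coeff ((X- r) *ₚ q) (suc k) ≈ - r * coeff q (suc k) + coeff q k
  coeff-X-*ₚ-suc r q k = trans (coeff-+ₚ (map (- r *_) q) _ (suc k))
    (+-cong (coeff-map-* (- r) q (suc k))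
      (trans (coeff-+ₚ (map (1# *_) q) (0# ∷ []) k)
      (trans (+-cong (trans (coeff-map-* 1# q k) (*-identityˡ _)) (coeff-0 k)) (+-identityʳ _))))
    where
    coeff-0 : ∀ k → coeff (0# ∷ []) k ≈ 0#
    coeff-0 zero    = refl
    coeff-0 (suc k) = refl

  coeff-horner-zero : ∀ p r → coeff (horner p r) 0 ≈ eval p r
  coeff-horner-zero []      r = refl
  coeff-horner-zero (b ∷ p) r = refl

  coeff-horner : ∀ p r k → coeff (horner p r) k ≈ coeff p k + r * coeff (horner p r) (suc k)
  coeff-horner []      r k       = sym (trans (+-identityˡ _) (zeroʳ r))
  coeff-horner (b ∷ p) r zero    = +-congˡ (*-congˡ (sym (coeff-horner-zero p r)))
  coeff-horner (b ∷ p) r (suc k) = coeff-horner p r k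

  root⇒divisible : ∀ a p r → eval (a ∷ p) r ≈ 0# → a ∷ p ≈ₚ (X- r) *ₚ horner p r
  root⇒divisible a p r root zero = begin
    a                             ≈⟨ solve 3 (λ a r e → a := (a :+ r :* e) :+ (:- r) :* e) refl a r (eval p r) ⟩
    (a + r * eval p r) + - r * eval p r
                                  ≈⟨ +-congʳ root ⟩
    0# + - r * eval p r           ≈⟨ +-identityˡ _ ⟩
    - r * eval p r                ≈⟨ *-congˡ (sym (coeff-horner-zero p r)) ⟩
    - r * coeff (horner p r) 0    ≈⟨ sym (coeff-X-*ₚ-zero r (horner p r)) ⟩
    coeff ((X- r) *ₚ horner p r) 0 ∎
  root⇒divisible a p r root (suc k) = begin
    coeff p k
      ≈⟨ solve 3 (λ a r e → a := (:- r) :* e :+ (a :+ r :* e)) refl (coeff p k) r (coeff (horner p r) (suc k)) ⟩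
    - r * coeff (horner p r) (suc k) + (coeff p k + r * coeff (horner p r) (suc k))
      ≈⟨ +-congˡ (sym (coeff-horner p r k)) ⟩
    - r * coeff (horner p r) (suc k) + coeff (horner p r) k
      ≈⟨ sym (coeff-X-*ₚ-suc r (horner p r) k) ⟩
    coeff ((X- r) *ₚ horner p r) (suc k) ∎

  length-horner : ∀ p r → length (horner p r) ≡ length p
  length-horner []      r = ≡.refl
  length-horner (b ∷ p) r = ≡.cong suc (length-horner p r)

  -- Takes the place of nonzero or invertible: it is closed under products, as linear factors
  -- require, and asks for no inverse.
  Regular : Carrier → Set
  Regular c = ∀ v → c * v ≈ 0# → v ≈ 0#

  Regular-resp : ∀ {c d} → c ≈ d → Regular c → Regular d
  Regular-resp eq reg v h = reg v (trans (*-congʳ eq) h)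

  Regular-* : ∀ {c d} → Regular c → Regular d → Regular (c * d)
  Regular-* {c} {d} rc rd v h = rd v (rc (d * v) (trans (sym (*-assoc c d v)) h))

  -- `Good` constrains the leading coefficient: it becomes `Pos` over ℝ, where signs are wanted, and
  -- `Regular` over ℂ, where cancellation is enough.
  module _ (Good : Carrier → Set) (Good-resp : ∀ {x y} → x ≈ y → Good x → Good y) where

    data Lead : Poly → Set where
      last : ∀ {c} → Good c → Lead (c ∷ [])
      skip : ∀ {a b p} → Lead (b ∷ p) → Lead (a ∷ b ∷ p)

    -- The factorisation c (x - r₁)(x - r₂)⋯, stored one linear factor at a time. The derivative
    -- identity is stored as well, since over a general ring it does not follow from agreement of
    -- values.
    data Split : Poly → List Carrier → Set where
      const : ∀ {c} → Good c → Split (c ∷ []) []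
      step  : ∀ {p q r rs} →
        (∀ x → eval p x ≈ (x - r) * eval q x) →
        (∀ x → deval p x ≈ eval q x + (x - r) * deval q x) →
        Split q rs → Split p (r ∷ rs)

    Lead-horner : ∀ b p r → Lead (b ∷ p) → Lead (horner (b ∷ p) r)
    Lead-horner b []      r (last g) = last (Good-resp (sym (trans (+-congˡ (zeroʳ r)) (+-identityʳ b))) g)
    Lead-horner b (c ∷ p) r (skip l) = skip (Lead-horner c p r l)

    Lead-applyUpTo : ∀ (f : ℕ → Carrier) m → Good (f m) → Lead (applyUpTo f (suc m))
    Lead-applyUpTo f zero    g = last g
    Lead-applyUpTo f (suc m) g = skip (Lead-applyUpTo (f ∘ suc) m g)

    -- A further root s of p is a root of the quotient because `s - r` can be cancelled. The length
    -- condition makes the roots run out exactly at the constant, and synthetic division by a monic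
    -- factor keeps the leading coefficient.
    split : ∀ p rs → length p ≡ suc (length rs) → Lead p → All (λ r → eval p r ≈ 0#) rs →
            AllPairs (λ r s → Regular (s - r)) rs → Split p rs
    split (c ∷ [])    []       len (last g) roots       regs        = const g
    split (a ∷ b ∷ p) (r ∷ rs) len (skip l) (root ∷ roots) (reg ∷ regs) =
      step factor (deval-horner a (b ∷ p) r)
        (split (horner (b ∷ p) r) rs (≡.trans (length-horner (b ∷ p) r) (suc-injective len))
          (Lead-horner b p r l) (All.zipWith (λ (reg , rt) → reg _ (trans (sym (factor _)) rt)) (reg , roots)) regs)
      where
      factor : ∀ x → eval (a ∷ b ∷ p) x ≈ (x - r) * eval (horner (b ∷ p) r) x
      factor x = trans (eval-horner a (b ∷ p) r x) (trans (+-congʳ root) (+-identityˡ _))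

    split-roots : ∀ {p rs} → Split p rs → All (λ r → eval p r ≈ 0#) rs
    split-roots (const g) = []
    split-roots (step {r = r} factor _ s) =
      trans (factor r) (trans (*-congʳ (-‿inverseʳ r)) (zeroˡ _))
      ∷ All.map (λ {x} rt → trans (factor x) (trans (*-congˡ rt) (zeroʳ _))) (split-roots s)

  split-regular : ∀ {p rs x} → Split Regular Regular-resp p rs → All (λ r → Regular (x - r)) rs → Regular (eval p x)
  split-regular {x = x} (const {c} g) [] = Regular-resp (sym (trans (+-congˡ (zeroʳ x)) (+-identityʳ c))) g
  split-regular (step factor _ s) (reg ∷ regs) = Regular-resp (sym (factor _)) (Regular-* reg (split-regular s regs))

  -- Each stage decides whether x avoids the head of the list or all of its tail.
  data Separated (x : Carrier) : List Carrier → Set where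
    off-head : ∀ {r rs} → Regular (x - r) → Separated x rs → Separated x (r ∷ rs)
    off-tail : ∀ {r rs} → All (λ s → Regular (x - s)) rs → Separated x (r ∷ rs)

  -- In the `off-tail` case the cofactor is a product of cancellable values, so `x - r` itself must
  -- vanish.
  split-complete : ∀ {p rs x} → Split Regular Regular-resp p rs → Separated x rs →
    eval p x ≈ 0# → Any (x ≈_) rs
  split-complete (step factor _ s) (off-head reg sep) root =
    there (split-complete s sep (reg _ (trans (sym (factor _)) root)))
  split-complete {x = x} (step {q = q} {r = r} factor _ s) (off-tail regs) root =
    here (begin
      x             ≈⟨ solve 2 (λ x r → x := (x :- r) :+ r) refl x r ⟩
      (x - r) + r   ≈⟨ +-congʳ (split-regular s regs (x - r) (trans (*-comm (eval q x) (x - r)) (trans (sym (factor x)) root))) ⟩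
      0# + r        ≈⟨ +-identityˡ r ⟩
      r             ∎)

  eval-applyUpTo-cong : ∀ {f g : ℕ → Carrier} → (∀ k → f k ≈ g k) → ∀ N x →
    eval (applyUpTo f N) x ≈ eval (applyUpTo g N) x
  eval-applyUpTo-cong eq zero    x = refl
  eval-applyUpTo-cong eq (suc N) x = +-cong (eq 0) (*-congˡ (eval-applyUpTo-cong (eq ∘ suc) N x))

  eval-applyUpTo-+ : ∀ (f g : ℕ → Carrier) N x →
    eval (applyUpTo (λ k → f k + g k) N) x ≈ eval (applyUpTo f N) x + eval (applyUpTo g N) x
  eval-applyUpTo-+ f g zero    x = sym (+-identityˡ 0#)
  eval-applyUpTo-+ f g (suc N) x = trans (+-congˡ (*-congˡ (eval-applyUpTo-+ (f ∘ suc) (g ∘ suc) N x)))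
    (solve 5 (λ a b x u v → (a :+ b) :+ x :* (u :+ v) := (a :+ x :* u) :+ (b :+ x :* v)) refl
      (f 0) (g 0) x (eval (applyUpTo (f ∘ suc) N) x) (eval (applyUpTo (g ∘ suc) N) x))

  eval-applyUpTo-* : ∀ c (f : ℕ → Carrier) N x →
    eval (applyUpTo (λ k → c * f k) N) x ≈ c * eval (applyUpTo f N) x
  eval-applyUpTo-* c f zero    x = sym (zeroʳ c)
  eval-applyUpTo-* c f (suc N) x = trans (+-congˡ (*-congˡ (eval-applyUpTo-* c (f ∘ suc) N x)))
    (solve 4 (λ c a x u → c :* a :+ x :* (c :* u) := c :* (a :+ x :* u)) refl
      c (f 0) x (eval (applyUpTo (f ∘ suc) N) x))

  eval-applyUpTo-0 : ∀ {f : ℕ → Carrier} → (∀ k → f k ≈ 0#) → ∀ N x → eval (applyUpTo f N) x ≈ 0#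
  eval-applyUpTo-0 f≈0 zero    x = refl
  eval-applyUpTo-0 f≈0 (suc N) x = trans (+-cong (f≈0 0) (trans (*-congˡ (eval-applyUpTo-0 (f≈0 ∘ suc) N x)) (zeroʳ x)))
    (+-identityˡ 0#)

  deval-applyUpTo-0 : ∀ {f : ℕ → Carrier} → (∀ k → f k ≈ 0#) → ∀ N x → deval (applyUpTo f N) x ≈ 0#
  deval-applyUpTo-0 f≈0 zero    x = refl
  deval-applyUpTo-0 f≈0 (suc N) x = trans (+-cong (eval-applyUpTo-0 (f≈0 ∘ suc) N x)
    (trans (*-congˡ (deval-applyUpTo-0 (f≈0 ∘ suc) N x)) (zeroʳ x))) (+-identityˡ 0#)

  eval-pad : ∀ {f : ℕ → Carrier} {m N} → m ℕ.≤ N → (∀ k → m ℕ.≤ k → f k ≈ 0#) → ∀ x →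
    eval (applyUpTo f N) x ≈ eval (applyUpTo f m) x
  eval-pad {N = N} ℕ.z≤n f≈0 x = eval-applyUpTo-0 (λ k → f≈0 k ℕ.z≤n) N x
  eval-pad (ℕ.s≤s p) f≈0 x = +-congˡ (*-congˡ (eval-pad p (λ k q → f≈0 (suc k) (ℕ.s≤s q)) x))

  deval-pad : ∀ {f : ℕ → Carrier} {m N} → m ℕ.≤ N → (∀ k → m ℕ.≤ k → f k ≈ 0#) → ∀ x →
    deval (applyUpTo f N) x ≈ deval (applyUpTo f m) x
  deval-pad {N = N} ℕ.z≤n f≈0 x = deval-applyUpTo-0 (λ k → f≈0 k ℕ.z≤n) N x
  deval-pad (ℕ.s≤s p) f≈0 x = +-cong (eval-pad p (λ k q → f≈0 (suc k) (ℕ.s≤s q)) x)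
    (*-congˡ (deval-pad p (λ k q → f≈0 (suc k) (ℕ.s≤s q)) x))

  -- Weights growing by 1 act as the operator w(0) + x d/dx. `w` is left general because the
  -- induction replaces it by `w ∘ suc`.
  eval-weighted : ∀ (w : ℕ → Carrier) → (∀ k → w (suc k) ≈ 1# + w k) → ∀ (f : ℕ → Carrier) N x →
    eval (applyUpTo (λ k → w k * f k) N) x ≈ w 0 * eval (applyUpTo f N) x + x * deval (applyUpTo f N) x
  eval-weighted w w-suc f zero    x = solve 2 (λ w x → con (+ 0) := w :* con (+ 0) :+ x :* con (+ 0)) refl (w 0) x
  eval-weighted w w-suc f (suc N) x = begin
    w 0 * f 0 + x * eval (applyUpTo (λ k → w (suc k) * f (suc k)) N) x
      ≈⟨ +-congˡ (*-congˡ (eval-weighted (w ∘ suc) (w-suc ∘ suc) (f ∘ suc) N x)) ⟩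
    w 0 * f 0 + x * (w 1 * u + x * v)
      ≈⟨ +-congˡ (*-congˡ (+-congʳ (*-congʳ (w-suc 0)))) ⟩
    w 0 * f 0 + x * ((1# + w 0) * u + x * v)
      ≈⟨ solve 5 (λ w a x u v → w :* a :+ x :* ((con (+ 1) :+ w) :* u :+ x :* v)
           := w :* (a :+ x :* u) :+ x :* (u :+ x :* v)) refl (w 0) (f 0) x u v ⟩
    w 0 * (f 0 + x * u) + x * (u + x * v) ∎
    where
    u = eval (applyUpTo (f ∘ suc) N) x
    v = deval (applyUpTo (f ∘ suc) N) x

-- Transfer of polynomial operations between two presentations of a ring.

module Transfer (R′ : RawRing 0ℓ 0ℓ)
  (_≈_ : RawRing.Carrier R′ → RawRing.Carrier R′ → Set)
  (_+_ _*_ : RawRing.Carrier R′ → RawRing.Carrier R′ → RawRing.Carrier R′)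
  (-_ : RawRing.Carrier R′ → RawRing.Carrier R′)
  (isCommutativeRing : IsCommutativeRing _≈_ _+_ _*_ -_ (RawRing.0# R′) (RawRing.1# R′))
  (+′≈+ : ∀ x y → RawRing._+_ R′ x y ≈ (x + y))
  (*′≈* : ∀ x y → RawRing._*_ R′ x y ≈ (x * y))
  (-′≈- : ∀ x → RawRing.-_ R′ x ≈ (- x)) where

  open import Data.List.Base using ([]; _∷_; map)
  open import Data.List.Relation.Binary.Pointwise.Base using (Pointwise; []; _∷_)
  open import Data.Nat.Base using (zero; suc)
  open IsCommutativeRing isCommutativeRing using (refl; sym; trans; +-cong; +-congˡ; *-congˡ; *-congʳ)

  private
    R : CommutativeRing 0ℓ 0ℓ
    R = record { isCommutativeRing = isCommutativeRing }
    module P = Defs.Polynomial (CommutativeRing.rawRing R)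
    module P′ = Defs.Polynomial R′

  eval-transfer : ∀ p x → P′.eval p x ≈ P.eval p x
  eval-transfer []      x = refl
  eval-transfer (a ∷ p) x = trans (+′≈+ a _) (+-congˡ (trans (*′≈* x _) (*-congˡ (eval-transfer p x))))

  coeff-transfer : ∀ {p q} → Pointwise _≈_ p q → ∀ k → P′.coeff p k ≈ P.coeff q k
  coeff-transfer []       k       = refl
  coeff-transfer (e ∷ es) zero    = e
  coeff-transfer (e ∷ es) (suc k) = coeff-transfer es k

  ≋-refl : ∀ p → Pointwise _≈_ p p
  ≋-refl []      = []
  ≋-refl (a ∷ p) = refl ∷ ≋-refl p

  +ₚ-transfer : ∀ {p p′ q q′} → Pointwise _≈_ p p′ → Pointwise _≈_ q q′ → Pointwise _≈_ (p P′.+ₚ q) (p′ P.+ₚ q′)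
  +ₚ-transfer []       fs       = fs
  +ₚ-transfer (e ∷ es) []       = e ∷ es
  +ₚ-transfer (e ∷ es) (f ∷ fs) = trans (+′≈+ _ _) (+-cong e f) ∷ +ₚ-transfer es fs

  map-transfer : ∀ {a b} → a ≈ b → ∀ q → Pointwise _≈_ (map (RawRing._*_ R′ a) q) (map (b *_) q)
  map-transfer e []      = []
  map-transfer e (c ∷ q) = trans (*′≈* _ c) (*-congʳ e) ∷ map-transfer e q

  *ₚ-transfer : ∀ {p p′} → Pointwise _≈_ p p′ → ∀ q → Pointwise _≈_ (p P′.*ₚ q) (p′ P.*ₚ q)
  *ₚ-transfer []       q = []
  *ₚ-transfer (e ∷ es) q = +ₚ-transfer (map-transfer e q) (refl ∷ *ₚ-transfer es q)

  -- Brings divisibility from the ring in which the proofs compute back to the raw operations of the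
  -- theorem.
  divisible-transfer : ∀ p z q → p P.≈ₚ (P.X- z) P.*ₚ q → ∀ k → P′.coeff p k ≈ P′.coeff ((P′.X- z) P′.*ₚ q) k
  divisible-transfer p z q h k = trans (coeff-transfer (≋-refl p) k)
    (trans (h k) (sym (coeff-transfer (*ₚ-transfer (-′≈- z ∷ refl ∷ []) q) k)))

-- Differences rewritten as sums of terms of known sign.

module DifferenceIdentities (R : CommutativeRing 0ℓ 0ℓ) where
  open CommutativeRing R renaming (refl to ≈-refl)
  open import Data.Integer.Base using (+_)
  open IntegerSolver R using (solve; _:=_; _:+_; _:*_; :-_; _:-_; con)

  diff-+ : ∀ a b → (b - a) + a ≈ b
  diff-+ = solve 2 (λ a b → (b :- a) :+ a := b) ≈-refl

  diff-swap : ∀ p q → p - q ≈ - (q - p)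
  diff-swap = solve 2 (λ p q → p :- q := :- (q :- p)) ≈-refl

  telescope : ∀ x y z → x - z ≈ (x - y) + (y - z)
  telescope = solve 3 (λ x y z → x :- z := (x :- y) :+ (y :- z)) ≈-refl

  +-interchange : ∀ x y u v → (x + u) - (y + v) ≈ (x - y) + (u - v)
  +-interchange = solve 4 (λ x y u v → (x :+ u) :- (y :+ v) := (x :- y) :+ (u :- v)) ≈-refl

  neg-diff : ∀ x y → y - x ≈ (- x) - (- y)
  neg-diff = solve 2 (λ x y → y :- x := (:- x) :- (:- y)) ≈-refl

  shift-bound : ∀ x y h → (x - (h + h)) + (h - (x - y)) ≈ y - h
  shift-bound = solve 3 (λ x y h → (x :- (h :+ h)) :+ (h :- (x :- y)) := y :- h) ≈-refl

  split-bound : ∀ x y h → ((x + y) - (h + h)) + (h - x) ≈ y - h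
  split-bound = solve 3 (λ x y h → ((x :+ y) :- (h :+ h)) :+ (h :- x) := y :- h) ≈-refl

  *-minus-0 : ∀ x v → x * v - 0# ≈ x * (v - 0#)
  *-minus-0 = solve 2 (λ x v → x :* v :- con (+ 0) := x :* (v :- con (+ 0))) ≈-refl

  arch-bound : ∀ b n x → (n - (b + 1#)) + (b - (- x)) ≈ (x + n) - 1#
  arch-bound = solve 3 (λ b n x → (n :- (b :+ con (+ 1))) :+ (b :- (:- x)) := (x :+ n) :- con (+ 1)) ≈-refl

  mid-lo : ∀ l w → w ≈ (l + w) - l
  mid-lo = solve 2 (λ l w → w := (l :+ w) :- l) ≈-refl

  hi-mid : ∀ l h w → (h - l) - w ≈ h - (l + w)
  hi-mid = solve 3 (λ l h w → (h :- l) :- w := h :- (l :+ w)) ≈-refl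

  cancelʳ : ∀ a w → (a + w) - w ≈ a
  cancelʳ = solve 2 (λ a w → (a :+ w) :- w := a) ≈-refl

  width-step : ∀ n w → n * w ≈ (1# + n) * (w + w) - (1# + (1# + n)) * w
  width-step = solve 2 (λ n w → n :* w := (con (+ 1) :+ n) :* (w :+ w) :- (con (+ 1) :+ (con (+ 1) :+ n)) :* w) ≈-refl

  slack : ∀ ε n → ε ≈ ε * (1# + n) - ε * n
  slack = solve 2 (λ ε n → ε := ε :* (con (+ 1) :+ n) :- ε :* n) ≈-refl

  nested-diff : ∀ lN hN lm hm ln → ((hm - lm) + (hN - hm)) + (ln - lN) ≈ (hN - lN) - (lm - ln)
  nested-diff = solve 5 (λ lN hN lm hm ln → ((hm :- lm) :+ (hN :- hm)) :+ (ln :- lN) := (hN :- lN) :- (lm :- ln)) ≈-refl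

  nested-width : ∀ lN hN lm hm → (hN - hm) + (lm - lN) ≈ (hN - lN) - (hm - lm)
  nested-width = solve 4 (λ lN hN lm hm → (hN :- hm) :+ (lm :- lN) := (hN :- lN) :- (hm :- lm)) ≈-refl

  neg-bound : ∀ p q → (p - 0#) ≈ (p - q) - (- q)
  neg-bound = solve 2 (λ p q → p :- con (+ 0) := (p :- q) :- (:- q)) ≈-refl

  pos-bound : ∀ p q → (p - 0#) + ((0# - q) + (0# - q)) ≈ (p - q) - q
  pos-bound = solve 2 (λ p q → (p :- con (+ 0)) :+ ((con (+ 0) :- q) :+ (con (+ 0) :- q)) := (p :- q) :- q) ≈-refl

  poly-diff : ∀ a u v P Q → u * (P - Q) + Q * (u - v) ≈ (a + u * P) - (a + v * Q)
  poly-diff = solve 5 (λ a u v P Q → u :* (P :- Q) :+ Q :* (u :- v) := (a :+ u :* P) :- (a :+ v :* Q)) ≈-refl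

  factor-out : ∀ B L M d → B * (L * d) + M * d ≈ (B * L + M) * d
  factor-out = solve 4 (λ B L M d → B :* (L :* d) :+ M :* d := (B :* L :+ M) :* d) ≈-refl

  margin : ∀ L η → (L + L) * η ≈ ((L + L) + ((1# + 1#) + (1# + 1#))) * η - ((η + η) + (η + η))
  margin = solve 2 (λ L η → (L :+ L) :* η := ((L :+ L) :+ ((con (+ 1) :+ con (+ 1)) :+ (con (+ 1) :+ con (+ 1)))) :* η :- ((η :+ η) :+ (η :+ η))) ≈-refl

  margin′ : ∀ L η → (η + η) + (η + η) ≈ ((L + L) + ((1# + 1#) + (1# + 1#))) * η - L * (η + η)
  margin′ = solve 2 (λ L η → (η :+ η) :+ (η :+ η) := ((L :+ L) :+ ((con (+ 1) :+ con (+ 1)) :+ (con (+ 1) :+ con (+ 1)))) :* η :- L :* (η :+ η)) ≈-refl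

  ends-apart : ∀ x y ε η → ((y - x) - ε) + (ε - ((η + η) + (η + η))) ≈ (y - (η + η)) - (x + (η + η))
  ends-apart = solve 4 (λ x y ε η → ((y :- x) :- ε) :+ (ε :- ((η :+ η) :+ (η :+ η))) := (y :- (η :+ η)) :- (x :+ (η :+ η))) ≈-refl

  left-sign : ∀ gx ga ε l → (((- gx) - ε) + (ε - l)) + (l - (ga - gx)) ≈ 0# - ga
  left-sign = solve 4 (λ gx ga ε l → (((:- gx) :- ε) :+ (ε :- l)) :+ (l :- (ga :- gx)) := con (+ 0) :- ga) ≈-refl

  right-sign : ∀ gy gb ε l → ((gy - ε) + (ε - l)) + (l - (gy - gb)) ≈ gb - 0#
  right-sign = solve 4 (λ gy gb ε l → ((gy :- ε) :+ (ε :- l)) :+ (l :- (gy :- gb)) := gb :- con (+ 0)) ≈-refl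

  sub-sub : ∀ y d → y - (y - d) ≈ d
  sub-sub = solve 2 (λ y d → y :- (y :- d) := d) ≈-refl

  add-sub : ∀ x d → (x + d) - x ≈ d
  add-sub = solve 2 (λ x d → (x :+ d) :- x := d) ≈-refl

  lower-gap : ∀ l xm xn η → (l - (xm + (η + η))) + (η - (xn - xm)) ≈ (l - xn) - η
  lower-gap = solve 4 (λ l xm xn η → (l :- (xm :+ (η :+ η))) :+ (η :- (xn :- xm)) := (l :- xn) :- η) ≈-refl

  upper-gap : ∀ l ym yn η → ((ym - (η + η)) - l) + (η - (ym - yn)) ≈ (yn - l) - η
  upper-gap = solve 4 (λ l ym yn η → ((ym :- (η :+ η)) :- l) :+ (η :- (ym :- yn)) := (yn :- l) :- η) ≈-refl

  minus-0 : ∀ p → p ≈ p - 0#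
  minus-0 = solve 1 (λ p → p := p :- con (+ 0)) ≈-refl

-- Counting partitions without singleton blocks.

module Counting where

  open import Defs using (subsets; sublists; IsCounted; isCounted?; D; DCoeff; HasDegree)
  open import Data.Bool.Base using (if_then_else_; true; false; T)
  open import Data.Fin.Base using (Fin; zero; suc)
  open import Data.Fin.Subset using (Subset; inside; outside; _∈_; _∩_; Nonempty; Empty; ∣_∣; ⊤; _⊆_)
  import Data.Fin.Subset.Properties as Sub
  open import Data.List.Base using (List; []; _∷_; _++_; map; length; filter)
  import Data.List.Properties as List
  open import Data.List.Relation.Unary.All as All using (All; []; _∷_)
  open import Data.List.Relation.Unary.AllPairs using (AllPairs; []; _∷_)
  open import Data.List.Relation.Unary.Any using (Any; here; there)
  open import Data.Maybe.Base as Maybe using (Maybe; just; nothing; maybe′; _>>=_)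
  open import Data.Nat.Base
  open import Data.Nat.Properties
  open import Data.Nat.Solver using (module +-*-Solver)
  open import Data.Product.Base using (_×_; _,_; proj₁; proj₂)
  open import Data.Sum.Base as Sum using (_⊎_; inj₁; inj₂)
  open import Data.Vec.Base as Vec using (here; there)
  open import Function.Base using (_∘_)
  open import Relation.Binary.PropositionalEquality
  open import Relation.Nullary using (¬_; yes; no; does; contradiction)
  open import Relation.Unary using (Pred; Decidable)

  -- stirling k n will be D n k; note the order of the arguments.
  stirling : ℕ → ℕ → ℕ
  stirling zero    zero    = 1
  stirling zero    (suc n) = 0
  stirling (suc k) zero    = 0
  stirling (suc k) (suc n) = suc k * stirling (suc k) n + n * stirling k (pred n)

  -- On exponential generating functions, binom⋆ is multiplication by eˣ,
  -- binom⁺ multiplication by eˣ - 1, and xmul multiplication by x.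
  binom⋆ : (ℕ → ℕ) → ℕ → ℕ
  binom⋆ f zero    = f 0
  binom⋆ f (suc u) = binom⋆ f u + binom⋆ (f ∘ suc) u

  binom⁺ : (ℕ → ℕ) → ℕ → ℕ
  binom⁺ f zero    = 0
  binom⁺ f (suc u) = binom⋆ f u + binom⁺ (f ∘ suc) u

  xmul : (ℕ → ℕ) → ℕ → ℕ
  xmul f u = u * f (pred u)

  binom⋆-cong : ∀ {f g} → (∀ u → f u ≡ g u) → ∀ u → binom⋆ f u ≡ binom⋆ g u
  binom⋆-cong h zero    = h 0
  binom⋆-cong h (suc u) = cong₂ _+_ (binom⋆-cong h u) (binom⋆-cong (h ∘ suc) u)

  binom⋆-linear : ∀ c f g u →
    binom⋆ (λ v → c * f v + g v) u ≡ c * binom⋆ f u + binom⋆ g u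
  binom⋆-linear c f g zero    = refl
  binom⋆-linear c f g (suc u)
    rewrite binom⋆-linear c f g u | binom⋆-linear c (f ∘ suc) (g ∘ suc) u =
    solve 5 (λ c a b x y → (c :* a :+ b) :+ (c :* x :+ y) := c :* (a :+ x) :+ (b :+ y))
      refl c (binom⋆ f u) (binom⋆ g u) (binom⋆ (f ∘ suc) u) (binom⋆ (g ∘ suc) u)
    where open +-*-Solver

  binom⋆-const0 : ∀ u → binom⋆ (λ _ → 0) u ≡ 0
  binom⋆-const0 zero    = refl
  binom⋆-const0 (suc u) rewrite binom⋆-const0 u = refl

  -- The product rule (x f)′ = f + x f′, since shifting a sequence differentiates its generating
  -- function. The factor 1 fits `binom⋆-linear`.
  xmul-suc : ∀ f u → xmul f (suc u) ≡ 1 * f u + xmul (f ∘ suc) u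
  xmul-suc f zero    = sym (+-identityʳ _)
  xmul-suc f (suc u) = cong (_+ suc u * f (suc u)) (sym (+-identityʳ (f (suc u))))

  -- Multiplications by eˣ and by x commute; the induction compares derivatives.
  binom⋆-xmul : ∀ f u → binom⋆ (xmul f) u ≡ xmul (binom⋆ f) u
  binom⋆-xmul f zero    = refl
  binom⋆-xmul f (suc u) = begin
    binom⋆ (xmul f) u + binom⋆ (xmul f ∘ suc) u
      ≡⟨ cong₂ _+_ (binom⋆-xmul f u)
           (trans (binom⋆-cong (xmul-suc f) u) (binom⋆-linear 1 f (xmul (f ∘ suc)) u)) ⟩
    xmul (binom⋆ f) u + (1 * binom⋆ f u + binom⋆ (xmul (f ∘ suc)) u)
      ≡⟨ cong (λ w → xmul (binom⋆ f) u + (1 * binom⋆ f u + w)) (binom⋆-xmul (f ∘ suc) u) ⟩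
    xmul (binom⋆ f) u + (1 * binom⋆ f u + xmul (binom⋆ (f ∘ suc)) u)
      ≡⟨ final u ⟩
    xmul (binom⋆ f) (suc u) ∎
    where
    open ≡-Reasoning
    open +-*-Solver
    final : ∀ u → xmul (binom⋆ f) u + (1 * binom⋆ f u + xmul (binom⋆ (f ∘ suc)) u)
                ≡ xmul (binom⋆ f) (suc u)
    final zero    = +-identityʳ _
    final (suc u) = solve 3 (λ w a b →
        (con 1 :+ w) :* a :+ (con 1 :* (a :+ b) :+ (con 1 :+ w) :* b)
        := (a :+ b) :+ (con 1 :+ w) :* (a :+ b))
      refl u (binom⋆ f u) (binom⋆ (f ∘ suc) u)

  binom⋆≡id+binom⁺ : ∀ f u → binom⋆ f u ≡ f u + binom⁺ f u
  binom⋆≡id+binom⁺ f zero    = sym (+-identityʳ _)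
  binom⋆≡id+binom⁺ f (suc u) rewrite binom⋆≡id+binom⁺ (f ∘ suc) u =
    solve 3 (λ a b c → a :+ (b :+ c) := b :+ (a :+ c)) refl (binom⋆ f u) (f (suc u)) (binom⁺ (f ∘ suc) u)
    where open +-*-Solver

  -- For the generating function d_k = (eˣ - 1 - x)ᵏ / k! this is d_k + d_{k+1}′ = eˣ d_k.
  binom⋆-stirling : ∀ k u → binom⋆ (stirling k) u ≡ stirling k u + stirling (suc k) (suc u)
  binom⋆-stirling k       zero    = sym (trans (cong (stirling k 0 +_)
    (trans (+-identityʳ _) (*-zeroʳ (suc k)))) (+-identityʳ _))
  binom⋆-stirling zero    (suc u)
    rewrite binom⋆-stirling zero u | binom⋆-const0 u = lemma u
    where
    lemma : ∀ u → stirling 0 u + stirling 1 (suc u) + 0 ≡ stirling 1 (suc (suc u))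
    lemma zero    = refl
    lemma (suc u) rewrite *-zeroʳ u = solve 1 (λ a → con 0 :+ a :+ con 0 := (a :+ con 0) :+ con 0) refl (stirling 1 (suc (suc u)))
      where open +-*-Solver
  binom⋆-stirling (suc k) (suc u) = begin
    binom⋆ (stirling (suc k)) u + binom⋆ (stirling (suc k) ∘ suc) u
      -- By definition `stirling (suc k) ∘ suc` is `suc k` times `stirling (suc k)` plus
      -- `xmul (stirling k)`, that is d′ₖ₊₁ = (k + 1) dₖ₊₁ + x dₖ, so linearity applies at once.
      ≡⟨ cong (binom⋆ (stirling (suc k)) u +_) (binom⋆-linear (suc k) (stirling (suc k)) (xmul (stirling k)) u) ⟩
    binom⋆ (stirling (suc k)) u + (suc k * binom⋆ (stirling (suc k)) u + binom⋆ (xmul (stirling k)) u)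
      ≡⟨ cong (λ w → binom⋆ (stirling (suc k)) u + (suc k * binom⋆ (stirling (suc k)) u + w)) (binom⋆-xmul (stirling k) u) ⟩
    binom⋆ (stirling (suc k)) u + (suc k * binom⋆ (stirling (suc k)) u + u * binom⋆ (stirling k) (pred u))
      ≡⟨ cong₂ (λ v w → v + (suc k * v + w)) (binom⋆-stirling (suc k) u) (middle u) ⟩
    (a + b) + (suc k * (a + b) + (u * c + u * a))
      ≡⟨ solve 5 (λ k u a b c → (a :+ b) :+ ((con 1 :+ k) :* (a :+ b) :+ (u :* c :+ u :* a))
           := ((con 1 :+ k) :* a :+ u :* c) :+ ((b :+ (con 1 :+ k) :* b) :+ (a :+ u :* a)))
         refl k u a b c ⟩
    stirling (suc k) (suc u) + stirling (suc (suc k)) (suc (suc u)) ∎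
    where
    open ≡-Reasoning
    open +-*-Solver
    a b c : ℕ
    a = stirling (suc k) u
    b = stirling (suc (suc k)) (suc u)
    c = stirling k (pred u)
    middle : ∀ u → u * binom⋆ (stirling k) (pred u) ≡ u * stirling k (pred u) + u * stirling (suc k) u
    middle zero    = refl
    middle (suc u) rewrite binom⋆-stirling k u = *-distribˡ-+ (suc u) (stirling k u) _

  -- Cancelling dₖ from eˣ dₖ = dₖ + d′ₖ₊₁ leaves (eˣ - 1) dₖ = d′ₖ₊₁.
  binom⁺-stirling : ∀ k u → binom⁺ (stirling k) u ≡ stirling (suc k) (suc u)
  binom⁺-stirling k u = +-cancelˡ-≡ (stirling k u) _ _
    (trans (sym (binom⋆≡id+binom⁺ (stirling k) u)) (binom⋆-stirling k u))

  -- Set difference that fails unless `B` is contained in `U`, so one function both tests inclusion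
  -- and returns what is left to cover.
  remove : ∀ {n} → Subset n → Subset n → Maybe (Subset n)
  remove Vec.[]              Vec.[]              = just Vec.[]
  remove (outside Vec.∷ B) (u       Vec.∷ U) = Maybe.map (u Vec.∷_) (remove B U)
  remove (inside  Vec.∷ B) (inside  Vec.∷ U) = Maybe.map (outside Vec.∷_) (remove B U)
  remove (inside  Vec.∷ B) (outside Vec.∷ U) = nothing

  -- The size bound `c` is a parameter because stripping a common first element from `B` and `U`
  -- lowers it, from 2 to 1 and then to 0.
  take : ∀ {n} → ℕ → Subset n → Subset n → (Subset n → ℕ) → ℕ
  take c B U h = if c ≤ᵇ ∣ B ∣ then maybe′ h 0 (remove B U) else 0

  isEmpty : ∀ {n} → Subset n → ℕ → ℕ
  isEmpty Vec.[]              zero    = 1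
  isEmpty Vec.[]              (suc k) = 0
  isEmpty (outside Vec.∷ U) k       = isEmpty U k
  isEmpty (inside  Vec.∷ U) k       = 0

  -- The number of sublists of L that partition U into k blocks of size at least 2.
  partitions : ∀ {n} → List (Subset n) → Subset n → ℕ → ℕ
  partitions []      U k       = isEmpty U k
  partitions (B ∷ L) U zero    = partitions L U zero
  partitions (B ∷ L) U (suc k) = partitions L U (suc k) + take 2 B U (λ V → partitions L V k)

  sumTake : ∀ {n} → ℕ → List (Subset n) → Subset n → (Subset n → ℕ) → ℕ
  sumTake c []      U h = 0
  sumTake c (B ∷ L) U h = take c B U h + sumTake c L U h

  maybe′-map : ∀ {A B C : Set} (h : B → C) z (g : A → B) m →
    maybe′ h z (Maybe.map g m) ≡ maybe′ (h ∘ g) z m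
  maybe′-map h z g (just x) = refl
  maybe′-map h z g nothing  = refl

  take-outside : ∀ {n} c (B : Subset n) u U h →
    take c (outside Vec.∷ B) (u Vec.∷ U) h ≡ take c B U (h ∘ (u Vec.∷_))
  take-outside c B u U h with c ≤ᵇ ∣ B ∣
  ... | true  = maybe′-map h 0 (u Vec.∷_) (remove B U)
  ... | false = refl

  take-inside-inside : ∀ {n} c (B : Subset n) U h →
    take c (inside Vec.∷ B) (inside Vec.∷ U) h ≡ take (pred c) B U (h ∘ (outside Vec.∷_))
  take-inside-inside zero B U h = maybe′-map h 0 (outside Vec.∷_) (remove B U)
  take-inside-inside (suc zero) B U h = maybe′-map h 0 (outside Vec.∷_) (remove B U)
  take-inside-inside (suc (suc c)) B U h with suc c ≤ᵇ ∣ B ∣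
  ... | true  = maybe′-map h 0 (outside Vec.∷_) (remove B U)
  ... | false = refl

  take-inside-outside : ∀ {n} c (B : Subset n) U h →
    take c (inside Vec.∷ B) (outside Vec.∷ U) h ≡ 0
  take-inside-outside c B U h with c ≤ᵇ suc ∣ B ∣
  ... | true  = refl
  ... | false = refl

  take-cong : ∀ {n} c (B : Subset n) U {g h} → (∀ V → g V ≡ h V) → take c B U g ≡ take c B U h
  take-cong c B U eq with c ≤ᵇ ∣ B ∣ | remove B U
  ... | true  | just V  = eq V
  ... | true  | nothing = refl
  ... | false | _       = refl

  take-const0 : ∀ {n} c (B : Subset n) U → take c B U (λ _ → 0) ≡ 0
  take-const0 c B U with c ≤ᵇ ∣ B ∣ | remove B U
  ... | true  | just V  = refl
  ... | true  | nothing = refl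
  ... | false | _       = refl

  take-+ : ∀ {n} c (B : Subset n) U g h → take c B U (λ V → g V + h V) ≡ take c B U g + take c B U h
  take-+ c B U g h with c ≤ᵇ ∣ B ∣ | remove B U
  ... | true  | just V  = refl
  ... | true  | nothing = refl
  ... | false | _       = refl

  map->>= : ∀ {A B C : Set} (g : A → B) (f : B → Maybe C) m → (Maybe.map g m >>= f) ≡ (m >>= f ∘ g)
  map->>= g f (just x) = refl
  map->>= g f nothing  = refl

  >>=-map : ∀ {A B C : Set} (g : B → C) (f : A → Maybe B) m → (m >>= Maybe.map g ∘ f) ≡ Maybe.map g (m >>= f)
  >>=-map g f (just x) = refl
  >>=-map g f nothing  = refl

  >>=-nothing : ∀ {A B : Set} (m : Maybe A) → (m >>= λ _ → nothing) ≡ nothing {A = B}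
  >>=-nothing (just x) = refl
  >>=-nothing nothing  = refl

  -- Either order leaves `U` without A ∪ B when `A` and `B` are disjoint subsets of `U`, and fails
  -- otherwise.
  remove-comm : ∀ {n} (A B U : Subset n) → (remove A U >>= remove B) ≡ (remove B U >>= remove A)
  remove-comm Vec.[] Vec.[] Vec.[] = refl
  remove-comm (outside Vec.∷ A) (outside Vec.∷ B) (u Vec.∷ U) = trans
    (trans (map->>= (u Vec.∷_) (remove (outside Vec.∷ B)) (remove A U)) (>>=-map (u Vec.∷_) (remove B) (remove A U)))
    (trans (cong (Maybe.map (u Vec.∷_)) (remove-comm A B U))
    (sym (trans (map->>= (u Vec.∷_) (remove (outside Vec.∷ A)) (remove B U)) (>>=-map (u Vec.∷_) (remove A) (remove B U)))))
  remove-comm (outside Vec.∷ A) (inside Vec.∷ B) (inside Vec.∷ U) = trans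
    (trans (map->>= (inside Vec.∷_) (remove (inside Vec.∷ B)) (remove A U)) (>>=-map (outside Vec.∷_) (remove B) (remove A U)))
    (trans (cong (Maybe.map (outside Vec.∷_)) (remove-comm A B U))
    (sym (trans (map->>= (outside Vec.∷_) (remove (outside Vec.∷ A)) (remove B U)) (>>=-map (outside Vec.∷_) (remove A) (remove B U)))))
  remove-comm (inside Vec.∷ A) (outside Vec.∷ B) (inside Vec.∷ U) = trans
    (trans (map->>= (outside Vec.∷_) (remove (outside Vec.∷ B)) (remove A U)) (>>=-map (outside Vec.∷_) (remove B) (remove A U)))
    (trans (cong (Maybe.map (outside Vec.∷_)) (remove-comm A B U))
    (sym (trans (map->>= (inside Vec.∷_) (remove (inside Vec.∷ A)) (remove B U)) (>>=-map (outside Vec.∷_) (remove A) (remove B U)))))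
  remove-comm (inside Vec.∷ A) (inside Vec.∷ B) (inside Vec.∷ U) =
    trans (trans (map->>= (outside Vec.∷_) (remove (inside Vec.∷ B)) (remove A U)) (>>=-nothing (remove A U)))
    (sym (trans (map->>= (outside Vec.∷_) (remove (inside Vec.∷ A)) (remove B U)) (>>=-nothing (remove B U))))
  remove-comm (outside Vec.∷ A) (inside Vec.∷ B) (outside Vec.∷ U) =
    trans (map->>= (outside Vec.∷_) (remove (inside Vec.∷ B)) (remove A U)) (>>=-nothing (remove A U))
  remove-comm (inside Vec.∷ A) (outside Vec.∷ B) (outside Vec.∷ U) =
    sym (trans (map->>= (outside Vec.∷_) (remove (inside Vec.∷ A)) (remove B U)) (>>=-nothing (remove B U)))
  remove-comm (inside Vec.∷ A) (inside Vec.∷ B) (outside Vec.∷ U) = refl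

  maybe′-const0 : ∀ {A : Set} (m : Maybe A) → maybe′ (λ _ → 0) 0 m ≡ 0
  maybe′-const0 (just _) = refl
  maybe′-const0 nothing  = refl

  take-comm : ∀ {n} c d (A B U : Subset n) h →
    take c A U (λ V → take d B V h) ≡ take d B U (λ V → take c A V h)
  take-comm c d A B U h with c ≤ᵇ ∣ A ∣ | d ≤ᵇ ∣ B ∣
  ... | false | false = refl
  ... | false | true  = sym (maybe′-const0 (remove B U))
  ... | true  | false = maybe′-const0 (remove A U)
  ... | true  | true  = trans (fuse (remove B) (remove A U))
    (trans (cong (maybe′ h 0) (remove-comm A B U)) (sym (fuse (remove A) (remove B U))))
    where
    fuse : ∀ {X Y : Set} {h : Y → ℕ} (f : X → Maybe Y) m →
      maybe′ (λ x → maybe′ h 0 (f x)) 0 m ≡ maybe′ h 0 (m >>= f)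
    fuse f (just _) = refl
    fuse f nothing  = refl

  sumTake-cong : ∀ {n} c (L : List (Subset n)) U {g h} → (∀ V → g V ≡ h V) → sumTake c L U g ≡ sumTake c L U h
  sumTake-cong c []      U eq = refl
  sumTake-cong c (B ∷ L) U eq = cong₂ _+_ (take-cong c B U eq) (sumTake-cong c L U eq)

  sumTake-+ : ∀ {n} c (L : List (Subset n)) U g h →
    sumTake c L U (λ V → g V + h V) ≡ sumTake c L U g + sumTake c L U h
  sumTake-+ c []      U g h = refl
  sumTake-+ c (B ∷ L) U g h rewrite take-+ c B U g h | sumTake-+ c L U g h =
    solve 4 (λ a b c d → (a :+ b) :+ (c :+ d) := (a :+ c) :+ (b :+ d)) refl
      (take c B U g) (take c B U h) (sumTake c L U g) (sumTake c L U h)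
    where open +-*-Solver

  take-sumTake : ∀ {n} c d (A : Subset n) L U h →
    take c A U (λ V → sumTake d L V h) ≡ sumTake d L U (λ V → take c A V h)
  take-sumTake c d A []      U h = take-const0 c A U
  take-sumTake c d A (B ∷ L) U h = trans
    (take-+ c A U (λ V → take d B V h) (λ V → sumTake d L V h))
    (cong₂ _+_ (take-comm c d A B U h) (take-sumTake c d A L U h))

  sumTake-++ : ∀ {n} c (L M : List (Subset n)) U h → sumTake c (L ++ M) U h ≡ sumTake c L U h + sumTake c M U h
  sumTake-++ c []      M U h = refl
  sumTake-++ c (B ∷ L) M U h rewrite sumTake-++ c L M U h = sym (+-assoc (take c B U h) _ _)

  sumTake-outside : ∀ {n} c (L : List (Subset n)) u U h →
    sumTake c (map (outside Vec.∷_) L) (u Vec.∷ U) h ≡ sumTake c L U (h ∘ (u Vec.∷_))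
  sumTake-outside c []      u U h = refl
  sumTake-outside c (B ∷ L) u U h = cong₂ _+_ (take-outside c B u U h) (sumTake-outside c L u U h)

  sumTake-inside-inside : ∀ {n} c (L : List (Subset n)) U h →
    sumTake c (map (inside Vec.∷_) L) (inside Vec.∷ U) h ≡ sumTake (pred c) L U (h ∘ (outside Vec.∷_))
  sumTake-inside-inside c []      U h = refl
  sumTake-inside-inside c (B ∷ L) U h = cong₂ _+_ (take-inside-inside c B U h) (sumTake-inside-inside c L U h)

  sumTake-inside-outside : ∀ {n} c (L : List (Subset n)) U h →
    sumTake c (map (inside Vec.∷_) L) (outside Vec.∷ U) h ≡ 0
  sumTake-inside-outside c []      U h = refl
  sumTake-inside-outside c (B ∷ L) U h = cong₂ _+_ (take-inside-outside c B U h) (sumTake-inside-outside c L U h)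

  -- The sum runs over all B ⊆ U. Deciding whether the first element of `U` is removed splits it by
  -- Pascal's rule, which is the recursion of `binom⋆`.
  sumTake-binom⋆ : ∀ n (U : Subset n) f → sumTake 0 (subsets n) U (f ∘ ∣_∣) ≡ binom⋆ f ∣ U ∣
  sumTake-binom⋆ zero    Vec.[] f = +-identityʳ (f 0)
  sumTake-binom⋆ (suc n) (outside Vec.∷ U) f
    rewrite sumTake-++ 0 (map (outside Vec.∷_) (subsets n)) (map (inside Vec.∷_) (subsets n)) (outside Vec.∷ U) (f ∘ ∣_∣)
          | sumTake-outside 0 (subsets n) outside U (f ∘ ∣_∣)
          | sumTake-inside-outside 0 (subsets n) U (f ∘ ∣_∣)
          | sumTake-binom⋆ n U f = +-identityʳ _
  sumTake-binom⋆ (suc n) (inside Vec.∷ U) f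
    rewrite sumTake-++ 0 (map (outside Vec.∷_) (subsets n)) (map (inside Vec.∷_) (subsets n)) (inside Vec.∷ U) (f ∘ ∣_∣)
          | sumTake-outside 0 (subsets n) inside U (f ∘ ∣_∣)
          | sumTake-inside-inside 0 (subsets n) U (f ∘ ∣_∣)
          | sumTake-binom⋆ n U f | sumTake-binom⋆ n U (f ∘ suc) = +-comm (binom⋆ (f ∘ suc) ∣ U ∣) _

  -- The same splitting with B = ∅ left out. Once an element is removed the size bound is met, so
  -- that branch falls back to `binom⋆`.
  sumTake-binom⁺ : ∀ n (U : Subset n) f → sumTake 1 (subsets n) U (f ∘ ∣_∣) ≡ binom⁺ f ∣ U ∣
  sumTake-binom⁺ zero    Vec.[] f = refl
  sumTake-binom⁺ (suc n) (outside Vec.∷ U) f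
    rewrite sumTake-++ 1 (map (outside Vec.∷_) (subsets n)) (map (inside Vec.∷_) (subsets n)) (outside Vec.∷ U) (f ∘ ∣_∣)
          | sumTake-outside 1 (subsets n) outside U (f ∘ ∣_∣)
          | sumTake-inside-outside 1 (subsets n) U (f ∘ ∣_∣)
          | sumTake-binom⁺ n U f = +-identityʳ _
  sumTake-binom⁺ (suc n) (inside Vec.∷ U) f
    rewrite sumTake-++ 1 (map (outside Vec.∷_) (subsets n)) (map (inside Vec.∷_) (subsets n)) (inside Vec.∷ U) (f ∘ ∣_∣)
          | sumTake-outside 1 (subsets n) inside U (f ∘ ∣_∣)
          | sumTake-inside-inside 1 (subsets n) U (f ∘ ∣_∣)
          | sumTake-binom⋆ n U f | sumTake-binom⁺ n U (f ∘ suc) = +-comm (binom⁺ (f ∘ suc) ∣ U ∣) _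

  partitions-outside : ∀ {n} (L M : List (Subset n)) U k →
    partitions (map (outside Vec.∷_) L ++ map (inside Vec.∷_) M) (outside Vec.∷ U) k ≡ partitions L U k
  partitions-outside [] []      U k       = refl
  partitions-outside [] (B ∷ M) U zero    = partitions-outside [] M U zero
  partitions-outside [] (B ∷ M) U (suc k) = trans
    (cong₂ _+_ (partitions-outside [] M U (suc k)) (take-inside-outside 2 B U (λ V → partitions (map (inside Vec.∷_) M) V k))) (+-identityʳ _)
  partitions-outside (A ∷ L) M U zero    = partitions-outside L M U zero
  partitions-outside (A ∷ L) M U (suc k) = cong₂ _+_ (partitions-outside L M U (suc k))
    (trans (take-outside 2 A outside U _) (take-cong 2 A U (λ V → partitions-outside L M V k)))

  partitions-inside-zero : ∀ {n} (L M : List (Subset n)) U →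
    partitions (map (outside Vec.∷_) L ++ map (inside Vec.∷_) M) (inside Vec.∷ U) 0 ≡ 0
  partitions-inside-zero []      []      U = refl
  partitions-inside-zero []      (B ∷ M) U = partitions-inside-zero [] M U
  partitions-inside-zero (A ∷ L) M       U = partitions-inside-zero L M U

  -- Exactly one block contains the first element; it comes from `M`, and its other elements number
  -- at least 1. The remaining blocks avoid the first element, hence come from `L`. The two lists
  -- are independent so that `L` can shrink alone; a block taken from `L` is then commuted past the
  -- distinguished one.
  partitions-inside : ∀ {n} (L M : List (Subset n)) U k →
    partitions (map (outside Vec.∷_) L ++ map (inside Vec.∷_) M) (inside Vec.∷ U) (suc k)
    ≡ sumTake 1 M U (λ V → partitions L V k)
  partitions-inside [] []      U k = refl
  partitions-inside [] (B ∷ M) U k = trans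
    (cong₂ _+_ (partitions-inside [] M U k)
      (trans (take-inside-inside 2 B U _) (take-cong 1 B U (λ V → partitions-outside [] M V k))))
    (+-comm (sumTake 1 M U (λ V → isEmpty V k)) _)
  partitions-inside (A ∷ L) M U zero = trans
    (cong₂ _+_ (partitions-inside L M U zero)
      (trans (take-outside 2 A inside U _)
      (trans (take-cong 2 A U (λ V → partitions-inside-zero L M V)) (take-const0 2 A U))))
    (+-identityʳ _)
  partitions-inside (A ∷ L) M U (suc k) = trans
    (cong₂ _+_ (partitions-inside L M U (suc k))
      (trans (take-outside 2 A inside U _)
      (trans (take-cong 2 A U (λ V → partitions-inside L M V k))
             (take-sumTake 2 1 A M U (λ V → partitions L V k)))))
    (sym (sumTake-+ 1 M U (λ V → partitions L V (suc k)) (λ V → take 2 A V (λ W → partitions L W k))))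

  partitions-subsets : ∀ n (U : Subset n) k → partitions (subsets n) U k ≡ stirling k ∣ U ∣
  partitions-subsets zero    Vec.[]              zero    = refl
  partitions-subsets zero    Vec.[]              (suc k) = refl
  partitions-subsets (suc n) (outside Vec.∷ U) k       =
    trans (partitions-outside (subsets n) (subsets n) U k) (partitions-subsets n U k)
  partitions-subsets (suc n) (inside  Vec.∷ U) zero    = partitions-inside-zero (subsets n) (subsets n) U
  partitions-subsets (suc n) (inside  Vec.∷ U) (suc k) = begin
    partitions (subsets (suc n)) (inside Vec.∷ U) (suc k)
      ≡⟨ partitions-inside (subsets n) (subsets n) U k ⟩
    sumTake 1 (subsets n) U (λ V → partitions (subsets n) V k)
      ≡⟨ sumTake-cong 1 (subsets n) U (λ V → partitions-subsets n V k) ⟩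
    sumTake 1 (subsets n) U (stirling k ∘ ∣_∣)
      ≡⟨ sumTake-binom⁺ n U (stirling k) ⟩
    binom⁺ (stirling k) ∣ U ∣
      ≡⟨ binom⁺-stirling k ∣ U ∣ ⟩
    stirling (suc k) (suc ∣ U ∣) ∎
    where open ≡-Reasoning

  -- `IsCounted` relative to a subset `U`, as needed when blocks are removed one by one. `within`
  -- keeps the blocks inside the part still to be covered; nonemptiness follows from `big`.
  record Covers {n : ℕ} (U : Subset n) (k : ℕ) (P : List (Subset n)) : Set where
    constructor covers
    field
      disjoint : AllPairs (λ A B → Empty (A ∩ B)) P
      size     : length P ≡ k
      big      : All (λ B → 1 < ∣ B ∣) P
      cover    : ∀ i → i ∈ U → Any (i ∈_) P
      within   : All (_⊆ U) P

  -- Together the four clauses say that U is the disjoint union of B and V.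
  remove-just : ∀ {n} (B U : Subset n) {V} → remove B U ≡ just V → ∀ i →
    (i ∈ B → i ∈ U) × (i ∈ V → i ∈ U) × (i ∈ U → i ∈ B ⊎ i ∈ V) × (i ∈ B → ¬ i ∈ V)
  remove-just (outside Vec.∷ B) (u Vec.∷ U) eq i with remove B U in eq′
  remove-just (outside Vec.∷ B) (u Vec.∷ U) refl zero | just V = (λ ()) , (λ { here → here }) , (λ { here → inj₂ here }) , λ ()
  remove-just (outside Vec.∷ B) (u Vec.∷ U) refl (suc i) | just V with remove-just B U eq′ i
  ... | a , b , c , d =
      (λ { (there x) → there (a x) }) , (λ { (there x) → there (b x) })
    , (λ { (there x) → Sum.map there there (c x) }) , (λ { (there x) (there y) → d x y })
  remove-just (inside Vec.∷ B) (inside Vec.∷ U) eq i with remove B U in eq′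
  remove-just (inside Vec.∷ B) (inside Vec.∷ U) refl zero | just V =
    (λ _ → here) , (λ ()) , (λ _ → inj₁ here) , λ _ ()
  remove-just (inside Vec.∷ B) (inside Vec.∷ U) refl (suc i) | just V with remove-just B U eq′ i
  ... | a , b , c , d =
      (λ { (there x) → there (a x) }) , (λ { (there x) → there (b x) })
    , (λ { (there x) → Sum.map there there (c x) }) , (λ { (there x) (there y) → d x y })

  remove-nothing : ∀ {n} (B U : Subset n) → remove B U ≡ nothing → ¬ (B ⊆ U)
  remove-nothing Vec.[] Vec.[] ()
  remove-nothing (outside Vec.∷ B) (u Vec.∷ U) eq B⊆U with remove B U in eq′
  ... | nothing = remove-nothing B U eq′ (λ x → Sub.drop-there (B⊆U (there x)))
  remove-nothing (inside Vec.∷ B) (inside Vec.∷ U) eq B⊆U with remove B U in eq′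
  ... | nothing = remove-nothing B U eq′ (λ x → Sub.drop-there (B⊆U (there x)))
  remove-nothing (inside Vec.∷ B) (outside Vec.∷ U) eq B⊆U with () ← B⊆U here

  module _ {n : ℕ} {B U V : Subset n} (eq : remove B U ≡ just V) where
    private
      spec = remove-just B U eq

    covers-∷⁻ : ∀ {k P} → Covers U (suc k) (B ∷ P) → Covers V k P
    covers-∷⁻ {k} {P} (covers (B# ∷ ds) sz (_ ∷ bs) cov (_ ∷ ws)) =
      covers ds (suc-injective sz) bs cov′ (All.zipWith ⊆V (B# , ws))
      where
      cov′ : ∀ i → i ∈ V → Any (i ∈_) P
      cov′ i i∈V with cov i (proj₁ (proj₂ (spec i)) i∈V)
      ... | here i∈B = contradiction i∈V (proj₂ (proj₂ (proj₂ (spec i))) i∈B)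
      ... | there p  = p
      ⊆V : ∀ {A} → Empty (B ∩ A) × A ⊆ U → A ⊆ V
      ⊆V (emp , A⊆U) {i} i∈A with proj₁ (proj₂ (proj₂ (spec i))) (A⊆U i∈A)
      ... | inj₁ i∈B = contradiction (i , Sub.x∈p∩q⁺ (i∈B , i∈A)) emp
      ... | inj₂ i∈V = i∈V

    covers-∷⁺ : ∀ {k P} → 1 < ∣ B ∣ → Covers V k P → Covers U (suc k) (B ∷ P)
    covers-∷⁺ {k} {P} B>1 (covers ds sz bs cov ws) =
      covers (All.map disj ws ∷ ds) (cong suc sz) (B>1 ∷ bs) cov′
        ((λ {i} → proj₁ (spec i)) ∷ All.map (λ A⊆V {i} i∈A → proj₁ (proj₂ (spec i)) (A⊆V i∈A)) ws)
      where
      disj : ∀ {A} → A ⊆ V → Empty (B ∩ A)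
      disj {A} A⊆V (i , i∈) with Sub.x∈p∩q⁻ B A i∈
      ... | i∈B , i∈A = proj₂ (proj₂ (proj₂ (spec i))) i∈B (A⊆V i∈A)
      cov′ : ∀ i → i ∈ U → Any (i ∈_) (B ∷ P)
      cov′ i i∈U with proj₁ (proj₂ (proj₂ (spec i))) i∈U
      ... | inj₁ i∈B = here i∈B
      ... | inj₂ i∈V = there (cov i i∈V)

  isEmpty-covers : ∀ {n} (U : Subset n) k → Covers U k [] → isEmpty U k ≡ 1
  isEmpty-covers Vec.[]              zero    c = refl
  isEmpty-covers (outside Vec.∷ U) k       (covers _ s _ c _) =
    isEmpty-covers U k (covers [] s [] (λ i i∈ → contradiction (c (suc i) (there i∈)) λ ()) [])
  isEmpty-covers (inside  Vec.∷ U) k       c with () ← Covers.cover c zero here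

  covers-isEmpty : ∀ {n} (U : Subset n) k → ¬ Covers U k [] → isEmpty U k ≡ 0
  covers-isEmpty Vec.[]              zero    c = contradiction (covers [] refl [] (λ ()) []) c
  covers-isEmpty Vec.[]              (suc k) c = refl
  covers-isEmpty (outside Vec.∷ U) k       c = covers-isEmpty U k
    (λ { (covers _ s _ cov _) → c (covers [] s [] (λ { (suc i) (there i∈) → contradiction (cov i i∈) λ () }) []) })
  covers-isEmpty (inside  Vec.∷ U) k       c = refl

  module _ {A : Set} {P : Pred A 0ℓ} (P? : Decidable P) where

    length-filter-map : ∀ {B : Set} (f : B → A) xs →
      length (filter P? (map f xs)) ≡ length (filter (λ x → P? (f x)) xs)
    length-filter-map f [] = refl
    length-filter-map f (x ∷ xs) with does (P? (f x))
    ... | true  = cong suc (length-filter-map f xs)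
    ... | false = length-filter-map f xs

    length-filter-none : (∀ x → ¬ P x) → ∀ xs → length (filter P? xs) ≡ 0
    length-filter-none ¬P xs = cong length (List.filter-none P? (All.universal ¬P xs))

  -- The predicate is general, only equivalent to `Covers U k`, because fixing the head `B` turns it
  -- into `λ Q → P (B ∷ Q)`, which must again be an instance.
  count-partitions : ∀ {n} (L : List (Subset n)) U k {P : Pred (List (Subset n)) 0ℓ} (P? : Decidable P) →
    (∀ {Q} → P Q → Covers U k Q) → (∀ {Q} → Covers U k Q → P Q) →
    length (filter P? (sublists L)) ≡ partitions L U k
  count-partitions [] U k P? to from with P? []
  ... | yes p = sym (isEmpty-covers U k (to p))
  ... | no ¬p = sym (covers-isEmpty U k (¬p ∘ from))
  count-partitions {n} (B ∷ L) U k {P} P? to from = begin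
    length (filter P? (sublists L ++ map (B ∷_) (sublists L)))
      ≡⟨ cong length (List.filter-++ P? (sublists L) _) ⟩
    length (filter P? (sublists L) ++ filter P? (map (B ∷_) (sublists L)))
      ≡⟨ List.length-++ (filter P? (sublists L)) ⟩
    length (filter P? (sublists L)) + length (filter P? (map (B ∷_) (sublists L)))
      ≡⟨ cong₂ _+_ (count-partitions L U k P? to from) (length-filter-map P? (B ∷_) (sublists L)) ⟩
    partitions L U k + length (filter (λ Q → P? (B ∷ Q)) (sublists L))
      ≡⟨ with-B k to from ⟩
    partitions (B ∷ L) U k ∎
    where
    open ≡-Reasoning
    none : (∀ Q → ¬ P (B ∷ Q)) → length (filter (λ Q → P? (B ∷ Q)) (sublists L)) ≡ 0
    none ¬P = length-filter-none (λ Q → P? (B ∷ Q)) ¬P (sublists L)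

    with-B : ∀ k → (∀ {Q} → P Q → Covers U k Q) → (∀ {Q} → Covers U k Q → P Q) →
      partitions L U k + length (filter (λ Q → P? (B ∷ Q)) (sublists L)) ≡ partitions (B ∷ L) U k
    with-B zero    to from = trans (cong (partitions L U 0 +_)
      (none (λ Q p → contradiction (Covers.size (to p)) λ ()))) (+-identityʳ _)
    with-B (suc k) to from = cong (partitions L U (suc k) +_) taken
      where
      taken : length (filter (λ Q → P? (B ∷ Q)) (sublists L)) ≡ take 2 B U (λ V → partitions L V k)
      taken with 2 ≤ᵇ ∣ B ∣ in big | remove B U in eq
      ... | false | _       = none (λ Q p → subst T big (≤⇒≤ᵇ (All.head (Covers.big (to p)))))
      ... | true  | nothing = none (λ Q p → remove-nothing B U eq (λ {i} → All.head (Covers.within (to p)) {i}))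
      ... | true  | just V  = count-partitions L V k (λ Q → P? (B ∷ Q)) (λ p → covers-∷⁻ eq (to p))
        (λ c → from (covers-∷⁺ eq (≤ᵇ⇒≤ 2 ∣ B ∣ (subst T (sym big) _)) c))

  nonempty-of-size : ∀ {n} (B : Subset n) → 0 < ∣ B ∣ → Nonempty B
  nonempty-of-size (inside  Vec.∷ B) _ = zero , here
  nonempty-of-size (outside Vec.∷ B) p with nonempty-of-size B p
  ... | i , i∈B = suc i , there i∈B

  all-⊆⊤ : ∀ {n} (P : List (Subset n)) → All (_⊆ ⊤) P
  all-⊆⊤ []      = []
  all-⊆⊤ (B ∷ P) = (λ _ → Sub.∈⊤) ∷ all-⊆⊤ P

  D≡stirling : ∀ n k → D n k ≡ stirling k n
  D≡stirling n k = begin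
    D n k                         ≡⟨ count-partitions (subsets n) ⊤ k (isCounted? k) to from ⟩
    partitions (subsets n) ⊤ k  ≡⟨ partitions-subsets n ⊤ k ⟩
    stirling k ∣ ⊤ {n} ∣             ≡⟨ cong (stirling k) (Sub.∣⊤∣≡n n) ⟩
    stirling k n                     ∎
    where
    open ≡-Reasoning
    to : ∀ {Q} → IsCounted k Q → Covers ⊤ k Q
    to ((_ , ds , cov) , sz , bs) = covers ds sz bs (λ i _ → cov i) (all-⊆⊤ _)
    from : ∀ {Q} → Covers ⊤ k Q → IsCounted k Q
    from (covers ds sz bs cov _) =
      (All.map (λ {B} p → nonempty-of-size B (<-trans z<s p)) bs , ds , λ i → cov i Sub.∈⊤) , sz , bs

  -- Both terms of the recurrence stay on the side n < 2k of the diagonal.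
  stirling-vanishes : ∀ k n → n < k + k → stirling k n ≡ 0
  stirling-vanishes (suc k) zero    _ = refl
  stirling-vanishes (suc k) (suc n) p
    rewrite stirling-vanishes (suc k) n (<-trans (n<1+n n) p) | *-zeroʳ k = second n p
    where
    second : ∀ n → suc n < suc k + suc k → n * stirling k (pred n) ≡ 0
    second zero    _ = refl
    second (suc n) p rewrite stirling-vanishes k n (s<s⁻¹ (subst (suc n <_) (+-suc k k) (s<s⁻¹ p))) = *-zeroʳ n

  -- The second term of the recurrence alone leads from (k, 2k) to (k + 1, 2k + 2).
  stirling-diagonal : ∀ k → 0 < stirling k (k + k)
  stirling-diagonal zero    = z<s
  stirling-diagonal (suc k) rewrite +-suc k k =
    <-≤-trans (stirling-diagonal k) (≤-trans (m≤m+n _ _) (m≤n+m _ (suc k * stirling (suc k) (suc (k + k)))))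

  -- For fixed k ≥ 1 the first term of the recurrence preserves positivity as n grows.
  stirling-positive : ∀ k j → 0 < stirling (suc k) (j + (suc k + suc k))
  stirling-positive k zero    = stirling-diagonal (suc k)
  stirling-positive k (suc j) = <-≤-trans (stirling-positive k j) (≤-trans (m≤m+n _ _) (m≤m+n _ _))

  ⌊n/2⌋+⌊n/2⌋≤n : ∀ n → ⌊ n /2⌋ + ⌊ n /2⌋ ≤ n
  ⌊n/2⌋+⌊n/2⌋≤n zero          = z≤n
  ⌊n/2⌋+⌊n/2⌋≤n (suc zero)    = z≤n
  ⌊n/2⌋+⌊n/2⌋≤n (suc (suc n)) rewrite +-suc ⌊ n /2⌋ ⌊ n /2⌋ = s≤s (s≤s (⌊n/2⌋+⌊n/2⌋≤n n))

  n<k+k : ∀ n {k} → ⌊ n /2⌋ < k → n < k + k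
  n<k+k zero          {suc k} _ = z<s
  n<k+k (suc zero)    {suc k} _ rewrite +-suc k k = s<s z<s
  n<k+k (suc (suc n)) {suc k} p rewrite +-suc k k = s<s (s<s (n<k+k n (s<s⁻¹ p)))

  DCoeff-suc : ∀ n k → DCoeff n (suc k) ≡ stirling (suc k) n
  DCoeff-suc n k = D≡stirling n (suc k)

  stirling-half-positive : ∀ n → 0 < stirling ⌊ suc (suc n) /2⌋ (suc (suc n))
  stirling-half-positive n = subst (λ m → 0 < stirling (suc ⌊ n /2⌋) m)
    (m∸n+n≡m (⌊n/2⌋+⌊n/2⌋≤n (suc (suc n))))
    (stirling-positive ⌊ n /2⌋ (suc (suc n) ∸ (suc ⌊ n /2⌋ + suc ⌊ n /2⌋)))

  DCoeff-degree : ∀ n → HasDegree (DCoeff (suc (suc n))) ⌊ suc (suc n) /2⌋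
  DCoeff-degree n =
      (λ eq → >⇒≢ (stirling-half-positive n) (trans (sym (DCoeff-suc (suc (suc n)) ⌊ n /2⌋)) eq))
    , λ { (suc k) p → trans (DCoeff-suc (suc (suc n)) k)
                            (stirling-vanishes (suc k) (suc (suc n)) (n<k+k (suc (suc n)) p)) }

-- Sign changes and interlacing over an ordered ring.

module Ordered where

  open import Defs using (interleave)
  open Counting using (stirling; stirling-positive; stirling-half-positive; stirling-vanishes; n<k+k)
  open import Data.Bool.Base using (Bool; true; false; not)
  open import Data.Empty using (⊥)
  open import Data.Integer.Base using (+_)
  open import Data.List.Base using (List; []; _∷_; length; applyUpTo)
  open import Data.List.Properties using (length-applyUpTo)
  open import Data.List.Relation.Unary.All as All using (All; []; _∷_)
  open import Data.List.Relation.Unary.AllPairs as AllPairs using (AllPairs; []; _∷_)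
  open import Data.List.Relation.Unary.Linked using (Linked; []; [-]; _∷_)
  open import Data.List.Relation.Unary.Linked.Properties using (Linked⇒AllPairs; AllPairs⇒Linked)
  open import Data.Nat.Base as ℕ using (ℕ; zero; suc; pred; ⌊_/2⌋)
  import Data.Nat.Properties as ℕ
  open import Data.Product.Base using (Σ-syntax; ∃-syntax; _×_; _,_; proj₁; proj₂)
  open import Data.Sum.Base using (_⊎_; inj₁; inj₂)
  open import Function.Base using (_∘_)
  open import Relation.Binary.PropositionalEquality as ≡ using (_≡_)

  module Signed (R : CommutativeRing 0ℓ 0ℓ) where
    open CommutativeRing R

    signed : Bool → Carrier → Carrier
    signed true  x = x
    signed false x = - x

  -- What the interlacing argument uses of ℝ. Positivity is not decidable: `Pos-split` replaces
  -- comparison and `Pos-regular` replaces division. The intermediate value property is asked only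
  -- for natural coefficients, and `s` covers both directions of the sign change.
  record OrderedRing : Set₁ where
    field
      ring : CommutativeRing 0ℓ 0ℓ
    open CommutativeRing ring public hiding (ring)
    open Defs.Polynomial rawRing public using (eval)
    open Signed ring public
    infix 4 _≻_
    field
      Pos         : Carrier → Set
      Pos-resp    : ∀ {x y} → x ≈ y → Pos x → Pos y
      Pos-1       : Pos 1#
      Pos-+       : ∀ {x y} → Pos x → Pos y → Pos (x + y)
      Pos-*       : ∀ {x y} → Pos x → Pos y → Pos (x * y)
      Pos-split   : ∀ {x y} → Pos (x + y) → Pos x ⊎ Pos y
      Pos-asym    : ∀ {x} → Pos x → Pos (- x) → ⊥
      Pos-regular : ∀ {x} → Pos x → ∀ v → x * v ≈ 0# → v ≈ 0#
      ι           : ℕ → Carrier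
      ι-0         : ι 0 ≈ 0#
      ι-1         : ι 1 ≈ 1#
      ι-+         : ∀ m n → ι (m ℕ.+ n) ≈ ι m + ι n
      ι-*         : ∀ m n → ι (m ℕ.* n) ≈ ι m * ι n
      archimedean : ∀ x → ∃[ n ] Pos (x + ι n)
    _≻_ : Carrier → Carrier → Set
    x ≻ y = Pos (x - y)
    field
      ivt : ∀ (c : ℕ → ℕ) N s {lo hi} → hi ≻ lo →
        Pos (signed s (eval (applyUpTo (ι ∘ c) N) hi)) →
        Pos (signed (not s) (eval (applyUpTo (ι ∘ c) N) lo)) →
        Σ[ u ∈ Carrier ] (hi ≻ u × u ≻ lo × eval (applyUpTo (ι ∘ c) N) u ≈ 0#)

  all-interleave⁻ : ∀ {A : Set} {P : A → Set} xs ys → All P (interleave xs ys) → All P xs × All P ys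
  all-interleave⁻ []       ys ps       = [] , ps
  all-interleave⁻ (x ∷ xs) ys (p ∷ ps) with all-interleave⁻ ys xs ps
  ... | qs , rs = p ∷ rs , qs

  allPairs-interleave⁻ : ∀ {A : Set} {_~_ : A → A → Set} xs ys →
    AllPairs _~_ (interleave xs ys) → AllPairs _~_ xs × AllPairs _~_ ys
  allPairs-interleave⁻ []       ys ps       = [] , ps
  allPairs-interleave⁻ (x ∷ xs) ys (p ∷ ps) with allPairs-interleave⁻ ys xs ps
  ... | qs , rs = proj₂ (all-interleave⁻ ys xs p) ∷ rs , qs

  interleave-[]ʳ : ∀ {A : Set} (xs : List A) → interleave xs [] ≡ xs
  interleave-[]ʳ []       = ≡.refl
  interleave-[]ʳ (x ∷ xs) = ≡.refl

  notⁿ : ℕ → Bool → Bool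
  notⁿ zero    s = s
  notⁿ (suc n) s = notⁿ n (not s)

  notⁿ-not : ∀ n s → notⁿ n (not s) ≡ not (notⁿ n s)
  notⁿ-not zero    s = ≡.refl
  notⁿ-not (suc n) s = notⁿ-not n (not s)

  ⌊suc/2⌋ : ∀ m → ⌊ suc m /2⌋ ≡ ⌊ m /2⌋ ⊎ ⌊ suc m /2⌋ ≡ suc ⌊ m /2⌋
  ⌊suc/2⌋ zero          = inj₁ ≡.refl
  ⌊suc/2⌋ (suc zero)    = inj₂ ≡.refl
  ⌊suc/2⌋ (suc (suc m)) with ⌊suc/2⌋ m
  ... | inj₁ eq = inj₁ (≡.cong suc eq)
  ... | inj₂ eq = inj₂ (≡.cong suc eq)

  module Interlacing (O : OrderedRing) where
    open OrderedRing O
    open IntegerSolver ring using (solve; _:=_; _:+_; _:*_; :-_; _:-_; con)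
    open Factorisation ring public
    open import Relation.Binary.Reasoning.Setoid setoid

    ι-suc : ∀ n → ι (suc n) ≈ 1# + ι n
    ι-suc n = trans (ι-+ 1 n) (+-congʳ ι-1)

    Pos-ι : ∀ n → Pos (ι (suc n))
    Pos-ι zero    = Pos-resp (sym ι-1) Pos-1
    Pos-ι (suc n) = Pos-resp (sym (ι-suc (suc n))) (Pos-+ Pos-1 (Pos-ι n))

    Pos-ι′ : ∀ {n} → 0 ℕ.< n → Pos (ι n)
    Pos-ι′ {suc n} _ = Pos-ι n

    ≻-trans : ∀ {x y z} → x ≻ y → y ≻ z → x ≻ z
    ≻-trans {x} {y} {z} p q = Pos-resp
      (solve 3 (λ x y z → (x :- y) :+ (y :- z) := x :- z) refl x y z) (Pos-+ p q)

    ≻⇒regular : ∀ {x y} → x ≻ y → Regular (y - x)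
    ≻⇒regular {x} {y} p v h = Pos-regular p v (begin
      (x - y) * v     ≈⟨ solve 3 (λ x y v → (x :- y) :* v := :- ((y :- x) :* v)) refl x y v ⟩
      - ((y - x) * v) ≈⟨ -‿cong h ⟩
      - 0#            ≈⟨ solve 0 (:- con (+ 0) := con (+ 0)) refl ⟩
      0#              ∎)

    signed-cong : ∀ s {x y} → x ≈ y → signed s x ≈ signed s y
    signed-cong true  eq = eq
    signed-cong false eq = -‿cong eq

    signed-flip : ∀ s {x r y} → r ≻ x → Pos (signed s y) → Pos (signed (not s) ((x - r) * y))
    signed-flip true  {x} {r} {y} p q = Pos-resp
      (solve 3 (λ x r y → (r :- x) :* y := :- ((x :- r) :* y)) refl x r y) (Pos-* p q)
    signed-flip false {x} {r} {y} p q = Pos-resp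
      (solve 3 (λ x r y → (r :- x) :* (:- y) := (x :- r) :* y) refl x r y) (Pos-* p q)

    signed-+ : ∀ s {x y} → Pos (signed s x) → Pos (signed s y) → Pos (signed s (x + y))
    signed-+ true  p q = Pos-+ p q
    signed-+ false {x} {y} p q = Pos-resp
      (solve 2 (λ x y → (:- x) :+ (:- y) := :- (x :+ y)) refl x y) (Pos-+ p q)

    signed-* : ∀ s {x y} → Pos x → Pos (signed s y) → Pos (signed s (x * y))
    signed-* true  p q = Pos-* p q
    signed-* false {x} {y} p q = Pos-resp
      (solve 2 (λ x y → x :* (:- y) := :- (x :* y)) refl x y) (Pos-* p q)

    data Alternating (f : Carrier → Carrier) : Bool → List Carrier → Set where
      []  : ∀ {s} → Alternating f s []
      _∷_ : ∀ {s x xs} → Pos (signed s (f x)) → Alternating f (not s) xs → Alternating f s (x ∷ xs)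

    -- The pointwise hypothesis quantifies over the sign because the expected sign changes along the
    -- list.
    alternating-zip : ∀ {f g h s xs} → Alternating f s xs → Alternating g s xs →
      All (λ x → ∀ s → Pos (signed s (f x)) → Pos (signed s (g x)) → Pos (signed (not s) (h x))) xs →
      Alternating h (not s) xs
    alternating-zip []       []       []       = []
    alternating-zip {s = s} (p ∷ ps) (q ∷ qs) (h ∷ hs) = h s p q ∷ alternating-zip ps qs hs

    PosSplit : List Carrier → List Carrier → Set
    PosSplit = Split Pos Pos-resp

    eval-above : ∀ {p rs x} → PosSplit p rs → All (x ≻_) rs → Pos (eval p x)
    eval-above {x = x} (const {c} g) [] = Pos-resp (sym (trans (+-congˡ (zeroʳ x)) (+-identityʳ c))) g
    eval-above (step factor _ s) (p ∷ ps) = Pos-resp (sym (factor _)) (Pos-* p (eval-above s ps))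

    -- Each further point of `us` has passed one more root, so one more linear factor is negative
    -- there. The length bound excludes a second point below the last root, where the sign would no
    -- longer change.
    alternating-eval : ∀ {p rs} us → PosSplit p rs → AllPairs _≻_ (interleave us rs) →
      length us ℕ.≤ suc (length rs) → Alternating (eval p) true us
    alternating-eval [] s ps len = []
    alternating-eval {rs = []} (u ∷ []) s ps len = eval-above s [] ∷ []
    alternating-eval {rs = []} (u ∷ _ ∷ _) s ps (ℕ.s≤s ())
    alternating-eval {p} {r ∷ rs} (u ∷ us) s@(step {q = q} factor _ s′) (qs ∷ (ts ∷ ps)) (ℕ.s≤s len) =
      eval-above s (proj₁ (all-interleave⁻ (r ∷ rs) us qs))
      ∷ alternating-zip alt alt (All.map flip (proj₁ (all-interleave⁻ us rs ts)))
      where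
      alt = alternating-eval us s′ ps len
      flip : ∀ {x} → r ≻ x → ∀ s → Pos (signed s (eval q x)) → Pos (signed s (eval q x)) →
             Pos (signed (not s) (eval p x))
      flip r≻x s p _ = Pos-resp (signed-cong (not s) (sym (factor _))) (signed-flip s r≻x p)

    -- With p = (x - r) q, p′(r) = q(r) is positive since r exceeds the other roots. At another root
    -- x the term q(x) drops out, so p′(x) = (x - r) q′(x) has the sign opposite to q′(x).
    alternating-deval : ∀ {p us} → PosSplit p us → AllPairs _≻_ us → Alternating (deval p) true us
    alternating-deval (const g) [] = []
    alternating-deval {p} (step {q = q} {r = r} factor dfactor s) (qs ∷ ps) =
      Pos-resp (sym (trans (dfactor r)
        (solve 3 (λ a r b → a :+ (r :- r) :* b := a) refl (eval q r) r (deval q r))))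
        (eval-above s qs)
      ∷ alternating-zip alt alt (All.zipWith flip (qs , split-roots Pos Pos-resp s))
      where
      alt = alternating-deval s ps
      flip : ∀ {x} → r ≻ x × eval q x ≈ 0# → ∀ s → Pos (signed s (deval q x)) → Pos (signed s (deval q x)) →
             Pos (signed (not s) (deval p x))
      flip (r≻x , root) s p _ = Pos-resp (signed-cong (not s)
        (sym (trans (dfactor _) (trans (+-congʳ root) (+-identityˡ _))))) (signed-flip s r≻x p)

    module Roots (c : ℕ → ℕ) (N : ℕ) where
      f : Carrier → Carrier
      f = eval (applyUpTo (ι ∘ c) N)

      -- The roots to be found below the last known sign: none, or one when the sign at -∞ differs.
      Closing : ℕ → Bool → Set
      Closing e s = ∀ x → Pos (signed s (f x)) →
        Σ[ us ∈ List Carrier ] (length us ≡ e × All (λ u → f u ≈ 0#) us × Linked _≻_ (x ∷ us))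

      -- One root is taken from each gap between consecutive points, so the new roots are
      -- interleaved with the old points by construction.
      roots-between : ∀ e s x xs → Linked _≻_ (x ∷ xs) → Alternating f s (x ∷ xs) →
        Closing e (notⁿ (length xs) s) →
        Σ[ us ∈ List Carrier ] (length us ≡ e ℕ.+ length xs × All (λ u → f u ≈ 0#) us
                               × Linked _≻_ (x ∷ interleave us xs))
      roots-between e s x [] [-] (p ∷ []) close with close x p
      ... | us , len , roots , linked = us , ≡.trans len (≡.sym (ℕ.+-identityʳ e)) , roots
          , ≡.subst (λ l → Linked _≻_ (x ∷ l)) (≡.sym (interleave-[]ʳ us)) linked
      roots-between e s x (y ∷ ys) (x≻y ∷ linked) (p ∷ alt@(q ∷ _)) close
        with ivt c N s x≻y p q | roots-between e (not s) y ys linked alt close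
      ... | u , x≻u , u≻y , root | us , len , roots , linked′ =
        u ∷ us , ≡.trans (≡.cong suc len) (≡.sym (ℕ.+-suc e (length ys))) , root ∷ roots , x≻u ∷ u≻y ∷ linked′

      no-closing : ∀ s → Closing 0 s
      no-closing s x _ = [] , ≡.refl , [] , [-]

    2× : Carrier → Carrier
    2× x = x + x

    -- As the leading coefficient is a positive integer, ½ is a lower bound that
    -- survives the induction without any division.
    eval-at-−∞ : ∀ (c : ℕ → ℕ) m → 0 ℕ.< c m →
      ∃[ B ] (∀ x → Pos (- x - ι B) → Pos (2× (signed (notⁿ m true) (eval (applyUpTo (ι ∘ c) (suc m)) x)) - 1#))
    eval-at-−∞ c zero c0>0 with c 0
    ... | suc k = 0 , λ x _ → Pos-resp (begin
      ι (suc (k ℕ.+ k))   ≈⟨ trans (ι-suc (k ℕ.+ k)) (+-congˡ (ι-+ k k)) ⟩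
      1# + (ι k + ι k)    ≈⟨ solve 2 (λ k x → con (+ 1) :+ (k :+ k)
                             := (((con (+ 1) :+ k) :+ x :* con (+ 0)) :+ ((con (+ 1) :+ k) :+ x :* con (+ 0))) :- con (+ 1))
                             refl (ι k) x ⟩
      2× ((1# + ι k) + x * 0#) - 1#
                          ≈⟨ +-congʳ (+-cong (+-congʳ (sym (ι-suc k))) (+-congʳ (sym (ι-suc k)))) ⟩
      2× (ι (suc k) + x * 0#) - 1# ∎) (Pos-ι (k ℕ.+ k))
    eval-at-−∞ c (suc m) cm>0 with eval-at-−∞ (c ∘ suc) m cm>0
    ... | B , ih = B′ , λ x h → ≡.subst (λ s → Pos (2× (signed s (ι a + x * g x)) - 1#))
            (≡.sym (notⁿ-not m true)) (bound x h (notⁿ m true) (ih x (below x h)))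
      where
      a  = c 0
      -- -x has to exceed the inductive bound B and also 2a + 1, the loss caused by the constant
      -- term: with |g| for the signed value, 2|a + xg| - 1 is at least -x(2|g| - 1) + (-x - 2a -
      -- 1).
      B′ = suc B ℕ.+ suc (a ℕ.+ a)
      g : Carrier → Carrier
      g = eval (applyUpTo (ι ∘ c ∘ suc) (suc m))
      ι-B′ : ι B′ ≈ ι (suc B) + (1# + (ι a + ι a))
      ι-B′ = trans (ι-+ (suc B) (suc (a ℕ.+ a))) (+-congˡ (trans (ι-suc (a ℕ.+ a)) (+-congˡ (ι-+ a a))))
      below : ∀ x → Pos (- x - ι B′) → Pos (- x - ι B)
      below x h = Pos-resp (begin
        (- x - ι B′) + ι (suc (suc (a ℕ.+ a)))
          ≈⟨ +-cong (+-congˡ (-‿cong (trans ι-B′ (+-congʳ (ι-suc B)))))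
               (trans (ι-suc (suc (a ℕ.+ a))) (+-congˡ (trans (ι-suc (a ℕ.+ a)) (+-congˡ (ι-+ a a))))) ⟩
        (- x - ((1# + ι B) + (1# + (ι a + ι a)))) + (1# + (1# + (ι a + ι a)))
          ≈⟨ solve 3 (λ x b a → ((:- x) :- ((con (+ 1) :+ b) :+ (con (+ 1) :+ (a :+ a)))) :+ (con (+ 1) :+ (con (+ 1) :+ (a :+ a)))
               := (:- x) :- b) refl x (ι B) (ι a) ⟩
        - x - ι B ∎) (Pos-+ h (Pos-ι (suc (a ℕ.+ a))))
      negative : ∀ x → Pos (- x - ι B′) → Pos (- x)
      negative x h = Pos-resp (solve 2 (λ x b → ((:- x) :- b) :+ b := :- x) refl x (ι B′)) (Pos-+ h (Pos-ι (B ℕ.+ suc (a ℕ.+ a))))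
      bound : ∀ x → Pos (- x - ι B′) → ∀ s → Pos (2× (signed s (g x)) - 1#) →
              Pos (2× (signed (not s) (ι a + x * g x)) - 1#)
      bound x h true p = Pos-resp (begin
        (- x * (2× (g x) - 1#) + (- x - ι B′)) + ι (suc B)
          ≈⟨ +-congʳ (+-congˡ (+-congˡ (-‿cong ι-B′))) ⟩
        (- x * (2× (g x) - 1#) + (- x - (ι (suc B) + (1# + (ι a + ι a))))) + ι (suc B)
          ≈⟨ solve 4 (λ x g b a →
               ((:- x) :* ((g :+ g) :- con (+ 1)) :+ ((:- x) :- (b :+ (con (+ 1) :+ (a :+ a))))) :+ b
               := ((:- (a :+ x :* g)) :+ (:- (a :+ x :* g))) :- con (+ 1)) refl x (g x) (ι (suc B)) (ι a) ⟩
        2× (- (ι a + x * g x)) - 1# ∎)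
        (Pos-+ (Pos-+ (Pos-* (negative x h) p) h) (Pos-ι B))
      bound x h false p = Pos-resp (begin
        (- x * (2× (- g x) - 1#) + (- x - ι B′)) + ι (suc (B ℕ.+ ((a ℕ.+ a) ℕ.+ (a ℕ.+ a))))
          ≈⟨ +-cong (+-congˡ (+-congˡ (-‿cong ι-B′)))
               (trans (ι-+ (suc B) _) (+-congˡ (trans (ι-+ (a ℕ.+ a) (a ℕ.+ a)) (+-cong (ι-+ a a) (ι-+ a a))))) ⟩
        (- x * (2× (- g x) - 1#) + (- x - (ι (suc B) + (1# + (ι a + ι a))))) + (ι (suc B) + ((ι a + ι a) + (ι a + ι a)))
          ≈⟨ solve 4 (λ x g b a →
               ((:- x) :* (((:- g) :+ (:- g)) :- con (+ 1)) :+ ((:- x) :- (b :+ (con (+ 1) :+ (a :+ a))))) :+ (b :+ ((a :+ a) :+ (a :+ a)))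
               := ((a :+ x :* g) :+ (a :+ x :* g)) :- con (+ 1)) refl x (g x) (ι (suc B)) (ι a) ⟩
        2× (ι a + x * g x) - 1# ∎)
        (Pos-+ (Pos-+ (Pos-* (negative x h) p) h) (Pos-ι _))

    -- Adding 1 gives `x + x` positive, and splitting that sum gives x positive in either case, so
    -- nothing is halved.
    Pos-half : ∀ {x} → Pos (2× x - 1#) → Pos x
    Pos-half {x} p with Pos-split (Pos-resp (solve 1 (λ x → ((x :+ x) :- con (+ 1)) :+ con (+ 1) := x :+ x) refl x) (Pos-+ p Pos-1))
    ... | inj₁ q = q
    ... | inj₂ q = q

    -- For degree m + 1 the sign at -∞ is that of (-1)ᵐ⁺¹, opposite to the sign (-1)ᵐ at the last
    -- known point, which yields one more root.
    closing-at-−∞ : ∀ (c : ℕ → ℕ) m → 0 ℕ.< c (suc m) → Roots.Closing c (suc (suc m)) 1 (notⁿ m true)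
    closing-at-−∞ c m cm>0 x fx with eval-at-−∞ c (suc m) cm>0 | archimedean x
    ... | B , h | n , x+n = close (ivt c (suc (suc m)) (notⁿ m true) {q} {x} x≻q fx
            (≡.subst (λ s → Pos (signed s (eval (applyUpTo (ι ∘ c) (suc (suc m))) q))) (notⁿ-not m true) (Pos-half (h q q≺))))
      where
      -- As x + n > 0, this point lies below both x and -B.
      q = - (ι n + ι (suc B))
      x≻q : x ≻ q
      x≻q = Pos-resp (solve 3 (λ x n b → (x :+ n) :+ b := x :- (:- (n :+ b))) refl x (ι n) (ι (suc B)))
              (Pos-+ x+n (Pos-ι B))
      q≺ : Pos (- q - ι B)
      q≺ = Pos-resp (begin
        ι (suc n)                    ≈⟨ ι-suc n ⟩
        1# + ι n                     ≈⟨ solve 2 (λ n b → con (+ 1) :+ n := (:- (:- (n :+ (con (+ 1) :+ b)))) :- b) refl (ι n) (ι B) ⟩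
        - (- (ι n + (1# + ι B))) - ι B ≈⟨ +-congʳ (-‿cong (-‿cong (+-congˡ (sym (ι-suc B))))) ⟩
        - q - ι B                    ∎) (Pos-ι n)
      close : _ → _
      close (u , x≻u , _ , root) = u ∷ [] , ≡.refl , root ∷ [] , x≻u ∷ [-]

    coefficient : ℕ → ℕ → ℕ
    coefficient n k = stirling (suc k) n

    -- The polynomial Dₙ(x) / x, without trailing zero coefficients.
    quotient : ℕ → List Carrier
    quotient n = applyUpTo (ι ∘ coefficient n) ⌊ n /2⌋

    coefficient-vanishes : ∀ n k → ⌊ n /2⌋ ℕ.≤ k → ι (coefficient n k) ≈ 0#
    coefficient-vanishes n k p = trans (reflexive (≡.cong ι (stirling-vanishes (suc k) n (n<k+k n (ℕ.s≤s p))))) ι-0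

    eval-quotient : ∀ n N x → ⌊ n /2⌋ ℕ.≤ N → eval (applyUpTo (ι ∘ coefficient n) N) x ≈ eval (quotient n) x
    eval-quotient n N x p = eval-pad p (coefficient-vanishes n) x

    quotient-recurrence : ∀ m x → let n = suc (suc m) in
      eval (quotient (suc n)) x ≈ (eval (quotient n) x + x * deval (quotient n) x) + ι n * (x * eval (quotient (pred n)) x)
    quotient-recurrence m x = begin
      eval (quotient (suc n)) x
        -- The three quotients may differ in length, so all are padded to a common length before the
        -- recurrence is applied coefficientwise.
        ≈⟨ sym (eval-quotient (suc n) (suc N) x (ℕ.≤-trans (ℕ.⌊n/2⌋≤n (suc n)) (ℕ.n≤1+n N))) ⟩
      eval (applyUpTo (ι ∘ coefficient (suc n)) (suc N)) x
        ≈⟨ eval-applyUpTo-cong (λ k → trans (ι-+ (suc k ℕ.* a k) (n ℕ.* b k)) (+-cong (ι-* (suc k) (a k)) (ι-* n (b k)))) (suc N) x ⟩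
      eval (applyUpTo (λ k → ι (suc k) * ι (a k) + ι n * ι (b k)) (suc N)) x
        ≈⟨ eval-applyUpTo-+ (λ k → ι (suc k) * ι (a k)) (λ k → ι n * ι (b k)) (suc N) x ⟩
      eval (applyUpTo (λ k → ι (suc k) * ι (a k)) (suc N)) x + eval (applyUpTo (λ k → ι n * ι (b k)) (suc N)) x
        ≈⟨ +-cong (trans (eval-pad half≤ weighted-vanishes x)
                         (eval-weighted (ι ∘ suc) (λ k → ι-suc (suc k)) (ι ∘ a) ⌊ n /2⌋ x))
                  (eval-applyUpTo-* (ι n) (ι ∘ b) (suc N) x) ⟩
      (ι 1 * eval (quotient n) x + x * deval (quotient n) x) + ι n * (ι 0 + x * eval (applyUpTo (ι ∘ coefficient (suc m)) N) x)
        ≈⟨ +-cong (+-congʳ (trans (*-congʳ ι-1) (*-identityˡ _)))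
             (*-congˡ (trans (+-congʳ ι-0) (trans (+-identityˡ _) (*-congˡ (eval-quotient (suc m) N x half≤′))))) ⟩
      (eval (quotient n) x + x * deval (quotient n) x) + ι n * (x * eval (quotient (suc m)) x) ∎
      where
      n = suc (suc m)
      N = suc n
      a b : ℕ → ℕ
      a = coefficient n
      -- The coefficients of Dₙ₋₁(x) rather than of its quotient: `b 0` is 0 and the tail is
      -- `coefficient (suc m)`, which produces the factor x.
      b k = stirling k (suc m)
      half≤ : ⌊ n /2⌋ ℕ.≤ suc N
      half≤ = ℕ.≤-trans (ℕ.⌊n/2⌋≤n n) (ℕ.≤-trans (ℕ.n≤1+n n) (ℕ.n≤1+n N))
      half≤′ : ⌊ suc m /2⌋ ℕ.≤ N
      half≤′ = ℕ.≤-trans (ℕ.⌊n/2⌋≤n (suc m)) (ℕ.≤-trans (ℕ.n≤1+n (suc m)) (ℕ.n≤1+n n))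
      weighted-vanishes : ∀ k → ⌊ n /2⌋ ℕ.≤ k → ι (suc k) * ι (a k) ≈ 0#
      weighted-vanishes k p = trans (*-congˡ (coefficient-vanishes n k p)) (zeroʳ _)

    -- xs and ys are the nonzero roots of Dₘ₊₃ and Dₘ₊₂.
    record Interlaced (m : ℕ) : Set where
      field
        xs ys  : List Carrier
        len-xs : length xs ≡ ⌊ suc m /2⌋
        len-ys : length ys ≡ ⌊ m /2⌋
        splitx : PosSplit (quotient (suc (suc (suc m)))) xs
        splity : PosSplit (quotient (suc (suc m))) ys
        sorted : Linked _≻_ (0# ∷ interleave xs ys)

    private
      -- The leading coefficient is a positive integer, so finding as many separated roots as the
      -- degree factors the quotient completely.
      quotient-split : ∀ m xs → length xs ≡ ⌊ m /2⌋ → AllPairs _≻_ xs →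
        All (λ x → eval (quotient (suc (suc m))) x ≈ 0#) xs → PosSplit (quotient (suc (suc m))) xs
      quotient-split m xs len ps roots = split Pos Pos-resp (quotient (suc (suc m))) xs
        (≡.trans (length-applyUpTo (ι ∘ coefficient (suc (suc m))) (suc ⌊ m /2⌋)) (≡.cong suc (≡.sym len)))
        (Lead-applyUpTo Pos Pos-resp (ι ∘ coefficient (suc (suc m))) ⌊ m /2⌋ (Pos-ι′ (stirling-half-positive m)))
        roots (AllPairs.map ≻⇒regular ps)

    interlaced-step : ∀ m → Interlaced m → Interlaced (suc m)
    interlaced-step m I = go (⌊suc/2⌋ (suc m))
      where
      open Interlaced I
      n = suc (suc (suc m))
      pairs : AllPairs _≻_ (0# ∷ interleave xs ys)
      pairs = Linked⇒AllPairs (λ {x} {y} {z} → ≻-trans {x} {y} {z}) sorted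
      pairs-xs : AllPairs _≻_ (0# ∷ xs)
      pairs-xs = proj₁ (all-interleave⁻ xs ys (AllPairs.head pairs)) ∷ proj₁ (allPairs-interleave⁻ xs ys (AllPairs.tail pairs))
      f : Carrier → Carrier
      f = eval (quotient (suc n))
      len≤ : length xs ℕ.≤ suc (length ys)
      len≤ rewrite len-xs | len-ys with ⌊suc/2⌋ m
      ... | inj₁ eq rewrite eq = ℕ.n≤1+n _
      ... | inj₂ eq rewrite eq = ℕ.≤-refl
      next : ∀ {x} → 0# ≻ x × eval (quotient n) x ≈ 0# → ∀ s → Pos (signed s (deval (quotient n) x)) →
             Pos (signed s (eval (quotient (pred n)) x)) → Pos (signed (not s) (f x))
      next {x} (0≻x , root) s p q = Pos-resp (signed-cong (not s) (begin
        (x - 0#) * (d + ι n * e)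
          ≈⟨ solve 4 (λ x d n e → (x :- con (+ 0)) :* (d :+ n :* e) := (con (+ 0) :+ x :* d) :+ n :* (x :* e)) refl x d (ι n) e ⟩
        (0# + x * d) + ι n * (x * e)
          ≈⟨ +-congʳ (+-congʳ (sym root)) ⟩
        (eval (quotient n) x + x * d) + ι n * (x * e)
          ≈⟨ sym (quotient-recurrence (suc m) x) ⟩
        f x ∎)) (signed-flip s 0≻x (signed-+ s p (signed-* s (Pos-ι (suc (suc m))) q)))
        where
        d = deval (quotient n) x
        e = eval (quotient (pred n)) x
      -- The constant term of the new quotient counts partitions into a single block.
      f0 : Pos (f 0#)
      f0 = Pos-resp (sym (trans (+-congˡ (zeroˡ _)) (+-identityʳ _)))
        (Pos-ι′ (≡.subst (λ j → 0 ℕ.< stirling 1 j) (ℕ.+-comm (suc (suc m)) 2) (stirling-positive 0 (suc (suc m)))))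
      alternating : Alternating f true (0# ∷ xs)
      alternating = f0 ∷ alternating-zip (alternating-deval splitx (AllPairs.tail pairs-xs))
        (alternating-eval xs splity (AllPairs.tail pairs) len≤)
        (All.zipWith next (AllPairs.head pairs-xs , split-roots Pos Pos-resp splitx))
      -- `e` is the number of roots gained below the last old one: 0 if the degree stays, 1 if it
      -- grows.
      extend : ∀ e → e ℕ.+ ⌊ suc m /2⌋ ≡ ⌊ suc (suc m) /2⌋ →
        Roots.Closing (coefficient (suc n)) ⌊ suc n /2⌋ e (notⁿ (length xs) true) → Interlaced (suc m)
      extend e eq close with Roots.roots-between (coefficient (suc n)) ⌊ suc n /2⌋ e true 0# xs (AllPairs⇒Linked pairs-xs) alternating close
      ... | us , len , roots , linked = record
        { xs = us ; ys = xs ; len-xs = len′ ; len-ys = len-xs ; splitx = quotient-split (suc (suc m)) us len′ pairs-us roots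
        ; splity = splitx ; sorted = linked }
        where
        len′ = ≡.trans len (≡.trans (≡.cong (e ℕ.+_) len-xs) eq)
        pairs-us = proj₁ (allPairs-interleave⁻ us xs
          (AllPairs.tail (Linked⇒AllPairs (λ {x} {y} {z} → ≻-trans {x} {y} {z}) linked)))
      go : ⌊ suc (suc m) /2⌋ ≡ ⌊ suc m /2⌋ ⊎ ⌊ suc (suc m) /2⌋ ≡ suc ⌊ suc m /2⌋ → Interlaced (suc m)
      go (inj₁ eq) = extend 0 (≡.sym eq) (Roots.no-closing (coefficient (suc n)) ⌊ suc n /2⌋ (notⁿ (length xs) true))
      go (inj₂ eq) = extend 1 (≡.sym eq) (≡.subst₂ (λ h l → Roots.Closing (coefficient (suc n)) (suc h) 1 (notⁿ l true))
        (≡.sym eq) (≡.sym len-xs)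
        (closing-at-−∞ (coefficient (suc n)) ⌊ suc m /2⌋
          (≡.subst (λ h → 0 ℕ.< stirling (suc h) (suc n)) eq (stirling-half-positive (suc (suc m))))))

    interlaced : ∀ m → Interlaced m
    -- D₂(x) = D₃(x) = x, so both quotients are the constant 1.
    interlaced zero    = record
      { xs = [] ; ys = [] ; len-xs = ≡.refl ; len-ys = ≡.refl
      ; splitx = const (Pos-ι 0) ; splity = const (Pos-ι 0) ; sorted = [-] }
    interlaced (suc m) = interlaced-step m (interlaced m)

-- Rational inequalities and the embedding of the naturals.

module Rationals where

  open import Data.Integer.Base as ℤ using (+_; -[1+_])
  import Data.Integer.Properties as ℤ
  open import Data.Nat.Base as ℕ using (ℕ; zero; suc)
  import Data.Nat.Properties as ℕ
  open import Data.Product.Base using (∃-syntax; _,_)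
  open import Data.Rational.Base as ℚ using (ℚ; 0ℚ; 1ℚ; mkℚ)
  import Data.Rational.Properties as ℚ
  open import Data.Rational.Unnormalised.Base as ℚᵘ using (mkℚᵘ)
  import Data.Rational.Unnormalised.Properties as ℚᵘ
  open import Data.Sum.Base using (inj₁; inj₂)
  open import Relation.Binary.PropositionalEquality using (_≡_; refl; sym; trans; cong; cong₂; subst; subst₂)

  open DifferenceIdentities ℚ.+-*-commutativeRing public

  -- Inequalities are proved by exhibiting the difference of the two sides as a visibly positive
  -- `e`.
  0<diff⇒< : ∀ {a b e} → 0ℚ ℚ.< e → e ≡ b ℚ.- a → a ℚ.< b
  0<diff⇒< {a} {b} p refl = subst₂ ℚ._<_ (ℚ.+-identityˡ a)
    (diff-+ a b) (ℚ.+-monoˡ-< a p)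

  0≤diff⇒≤ : ∀ {a b e} → 0ℚ ℚ.≤ e → e ≡ b ℚ.- a → a ℚ.≤ b
  0≤diff⇒≤ {a} {b} p refl = subst₂ ℚ._≤_ (ℚ.+-identityˡ a)
    (diff-+ a b) (ℚ.+-monoˡ-≤ a p)

  <⇒0<diff : ∀ {a b} → a ℚ.< b → 0ℚ ℚ.< b ℚ.- a
  <⇒0<diff {a} {b} p = subst (ℚ._< b ℚ.- a) (ℚ.+-inverseʳ a) (ℚ.+-monoˡ-< (ℚ.- a) p)

  ≤⇒0≤diff : ∀ {a b} → a ℚ.≤ b → 0ℚ ℚ.≤ b ℚ.- a
  ≤⇒0≤diff {a} {b} p = subst (ℚ._≤ b ℚ.- a) (ℚ.+-inverseʳ a) (ℚ.+-monoˡ-≤ (ℚ.- a) p)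

  0<+ : ∀ {a b} → 0ℚ ℚ.< a → 0ℚ ℚ.< b → 0ℚ ℚ.< a ℚ.+ b
  0<+ p q = ℚ.+-mono-< p q

  0≤+ : ∀ {a b} → 0ℚ ℚ.≤ a → 0ℚ ℚ.≤ b → 0ℚ ℚ.≤ a ℚ.+ b
  0≤+ p q = ℚ.+-mono-≤ p q

  0<+≤ : ∀ {a b} → 0ℚ ℚ.< a → 0ℚ ℚ.≤ b → 0ℚ ℚ.< a ℚ.+ b
  0<+≤ p q = ℚ.+-mono-<-≤ p q

  0≤+< : ∀ {a b} → 0ℚ ℚ.≤ a → 0ℚ ℚ.< b → 0ℚ ℚ.< a ℚ.+ b
  0≤+< p q = ℚ.+-mono-≤-< p q

  0≤* : ∀ {a b} → 0ℚ ℚ.≤ a → 0ℚ ℚ.≤ b → 0ℚ ℚ.≤ a ℚ.* b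
  0≤* {a} {b} p q = subst (ℚ._≤ a ℚ.* b) (ℚ.*-zeroʳ a) (ℚ.*-monoˡ-≤-nonNeg a {{ℚ.nonNegative p}} q)

  0<* : ∀ {a b} → 0ℚ ℚ.< a → 0ℚ ℚ.< b → 0ℚ ℚ.< a ℚ.* b
  0<* {a} {b} p q = subst (ℚ._< a ℚ.* b) (ℚ.*-zeroʳ a) (ℚ.*-monoʳ-<-pos a {{ℚ.positive p}} q)

  p≤∣p∣ : ∀ p → p ℚ.≤ ℚ.∣ p ∣
  p≤∣p∣ p with ℚ.≤-total 0ℚ p
  ... | inj₁ 0≤p = ℚ.≤-reflexive (sym (ℚ.0≤p⇒∣p∣≡p 0≤p))
  ... | inj₂ p≤0 = ℚ.≤-trans p≤0 (ℚ.0≤∣p∣ p)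

  -p≤∣p∣ : ∀ p → ℚ.- p ℚ.≤ ℚ.∣ p ∣
  -p≤∣p∣ p = subst (ℚ.- p ℚ.≤_) (ℚ.∣-p∣≡∣p∣ p) (p≤∣p∣ (ℚ.- p))

  ∣∣<⁺ : ∀ {p ε} → p ℚ.< ε → ℚ.- p ℚ.< ε → ℚ.∣ p ∣ ℚ.< ε
  ∣∣<⁺ {p} a b with ℚ.∣p∣≡p∨∣p∣≡-p p
  ... | inj₁ eq = subst (ℚ._< _) (sym eq) a
  ... | inj₂ eq = subst (ℚ._< _) (sym eq) b

  ∣∣≤⁺ : ∀ {p ε} → p ℚ.≤ ε → ℚ.- p ℚ.≤ ε → ℚ.∣ p ∣ ℚ.≤ ε
  ∣∣≤⁺ {p} a b with ℚ.∣p∣≡p∨∣p∣≡-p p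
  ... | inj₁ eq = subst (ℚ._≤ _) (sym eq) a
  ... | inj₂ eq = subst (ℚ._≤ _) (sym eq) b

  ∣-∣-sym : ∀ p q → ℚ.∣ p ℚ.- q ∣ ≡ ℚ.∣ q ℚ.- p ∣
  ∣-∣-sym p q = trans (cong ℚ.∣_∣ (diff-swap p q)) (ℚ.∣-p∣≡∣p∣ (q ℚ.- p))

  ι : ℕ → ℚ
  ι n = + n ℚ./ 1

  toℚᵘ-ι : ∀ n → ℚ.toℚᵘ (ι n) ℚᵘ.≃ mkℚᵘ (+ n) 0
  toℚᵘ-ι n = ℚ.toℚᵘ-fromℚᵘ (mkℚᵘ (+ n) 0)

  -- Normalised fractions do not reduce on variables, so the equation is checked on unnormalised
  -- ones.
  ι-+ : ∀ m n → ι (m ℕ.+ n) ≡ ι m ℚ.+ ι n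
  ι-+ m n = ℚ.toℚᵘ-injective (begin
    ℚ.toℚᵘ (ι (m ℕ.+ n))              ≈⟨ toℚᵘ-ι (m ℕ.+ n) ⟩
    mkℚᵘ (+ (m ℕ.+ n)) 0              ≈⟨ ℚᵘ.*≡* (cong (ℤ._* + 1) (cong₂ ℤ._+_ (sym (ℤ.*-identityʳ (+ m))) (sym (ℤ.*-identityʳ (+ n))))) ⟩
    mkℚᵘ (+ m) 0 ℚᵘ.+ mkℚᵘ (+ n) 0    ≈⟨ ℚᵘ.+-cong (ℚᵘ.≃-sym (toℚᵘ-ι m)) (ℚᵘ.≃-sym (toℚᵘ-ι n)) ⟩
    ℚ.toℚᵘ (ι m) ℚᵘ.+ ℚ.toℚᵘ (ι n)    ≈⟨ ℚᵘ.≃-sym (ℚ.toℚᵘ-homo-+ (ι m) (ι n)) ⟩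
    ℚ.toℚᵘ (ι m ℚ.+ ι n)              ∎)
    where open ℚᵘ.≃-Reasoning

  ι-* : ∀ m n → ι (m ℕ.* n) ≡ ι m ℚ.* ι n
  ι-* m n = ℚ.toℚᵘ-injective (begin
    ℚ.toℚᵘ (ι (m ℕ.* n))              ≈⟨ toℚᵘ-ι (m ℕ.* n) ⟩
    mkℚᵘ (+ (m ℕ.* n)) 0              ≈⟨ ℚᵘ.*≡* (cong (ℤ._* + 1) (ℤ.pos-* m n)) ⟩
    mkℚᵘ (+ m) 0 ℚᵘ.* mkℚᵘ (+ n) 0    ≈⟨ ℚᵘ.*-cong (ℚᵘ.≃-sym (toℚᵘ-ι m)) (ℚᵘ.≃-sym (toℚᵘ-ι n)) ⟩
    ℚ.toℚᵘ (ι m) ℚᵘ.* ℚ.toℚᵘ (ι n)    ≈⟨ ℚᵘ.≃-sym (ℚ.toℚᵘ-homo-* (ι m) (ι n)) ⟩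
    ℚ.toℚᵘ (ι m ℚ.* ι n)              ∎)
    where open ℚᵘ.≃-Reasoning

  ι-suc : ∀ n → ι (suc n) ≡ 1ℚ ℚ.+ ι n
  ι-suc n = ι-+ 1 n

  0≤ι : ∀ n → 0ℚ ℚ.≤ ι n
  0≤ι zero    = ℚ.≤-refl
  0≤ι (suc n) = subst (0ℚ ℚ.≤_) (sym (ι-suc n)) (0≤+ (ℚ.<⇒≤ (ℚ.positive⁻¹ 1ℚ)) (0≤ι n))

  ℚ-archimedean : ∀ q → ∃[ n ] q ℚ.< ι n
  ℚ-archimedean q@(mkℚ i d _) = suc ℤ.∣ i ∣ , ℚ.toℚᵘ-cancel-<
    (ℚᵘ.<-respʳ-≃ (ℚᵘ.≃-sym (toℚᵘ-ι (suc ℤ.∣ i ∣))) (ℚᵘ.*<* lemma))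
    where
    lemma : i ℤ.* + 1 ℤ.< + suc ℤ.∣ i ∣ ℤ.* + suc d
    lemma = subst₂ ℤ._<_ (sym (ℤ.*-identityʳ i)) (ℤ.pos-* (suc ℤ.∣ i ∣) (suc d))
      (ℤ.≤-<-trans (i≤∣i∣ i) (ℤ.+<+ (ℕ.<-≤-trans (ℕ.n<1+n ℤ.∣ i ∣) (ℕ.m≤m*n (suc ℤ.∣ i ∣) (suc d)))))
      where
      i≤∣i∣ : ∀ i → i ℤ.≤ + ℤ.∣ i ∣
      i≤∣i∣ (+ n)    = ℤ.≤-refl
      i≤∣i∣ -[1+ n ] = ℤ.-≤+

-- The reals as a commutative ring with a positivity predicate.

module Reals where

  open import Defs
  open Rationals
  open import Data.Empty using (⊥)
  open import Data.Nat.Base as ℕ using (ℕ)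
  import Data.Nat.Properties as ℕ
  open import Data.Product.Base using (Σ-syntax; ∃-syntax; _×_; _,_)
  open import Data.Rational.Base as ℚ using (ℚ; 0ℚ; 1ℚ; ½)
  import Data.Rational.Properties as ℚ
  open import Data.Sum.Base using (_⊎_; inj₁; inj₂)
  open import Relation.Binary.PropositionalEquality using (_≡_; refl; sym; trans; cong; subst)
  open import Relation.Nullary using (yes; no)

  Eventually : (ℕ → Set) → Set
  Eventually P = ∃[ N ] (∀ n → N ℕ.≤ n → P n)

  eventually-map : ∀ {P Q : ℕ → Set} → (∀ n → P n → Q n) → Eventually P → Eventually Q
  eventually-map f (N , p) = N , λ n h → f n (p n h)

  eventually-zip : ∀ {P Q R : ℕ → Set} → (∀ n → P n → Q n → R n) → Eventually P → Eventually Q → Eventually R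
  eventually-zip f (M , p) (N , q) = M ℕ.⊔ N , λ n h →
    f n (p n (ℕ.m⊔n≤o⇒m≤o M N h)) (q n (ℕ.m⊔n≤o⇒n≤o M N h))

  eventually-witness : ∀ {P : ℕ → Set} → Eventually P → ∃[ n ] P n
  eventually-witness (N , p) = N , p N ℕ.≤-refl

  -- Wrapped so that the two sides can be inferred.
  infix 4 _≃_
  record _≃_ (x y : ℝ) : Set where
    constructor mk≃
    field un≃ : x ≈ y
  open _≃_ public

  record Pos (x : ℝ) : Set where
    constructor mkPos
    field
      ε   : ℚ
      ε>0 : 0ℚ ℚ.< ε
      ε<  : Eventually (λ n → ε ℚ.< seq x n)

  -- Reduces each ring law of ℝ to the same law of ℚ, term by term.
  pointwise : ∀ {x y} → (∀ n → seq x n ≡ seq y n) → x ≃ y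
  pointwise {x} {y} eq = mk≃ λ ε ε>0 → 0 , λ n _ → subst (λ q → ℚ.∣ seq x n ℚ.- q ∣ ℚ.< ε) (eq n) (∣p-p∣<ε (seq x n) ε>0)

  ≃-refl : ∀ {x} → x ≃ x
  ≃-refl = pointwise (λ _ → refl)

  ≃-sym : ∀ {x y} → x ≃ y → y ≃ x
  ≃-sym {x} {y} (mk≃ p) = mk≃ λ ε ε>0 → eventually-map (λ n → subst (ℚ._< ε) (∣-∣-sym (seq x n) (seq y n))) (p ε ε>0)

  sum-bound : ∀ {a b c ε} → 0ℚ ℚ.< ε → c ≡ a ℚ.+ b → ℚ.∣ a ∣ ℚ.< ½ ℚ.* ε → ℚ.∣ b ∣ ℚ.< ½ ℚ.* ε → ℚ.∣ c ∣ ℚ.< ε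
  sum-bound {a} {b} {ε = ε} _ refl p q = ℚ.≤-<-trans (ℚ.∣p+q∣≤∣p∣+∣q∣ a b)
    (subst (ℚ.∣ a ∣ ℚ.+ ℚ.∣ b ∣ ℚ.<_) (½+½ ε) (ℚ.+-mono-< p q))

  ≃-trans : ∀ {x y z} → x ≃ y → y ≃ z → x ≃ z
  ≃-trans {x} {y} {z} (mk≃ p) (mk≃ q) = mk≃ λ ε ε>0 → eventually-zip
    (λ n → sum-bound ε>0 (telescope (seq x n) (seq y n) (seq z n)))
    (p (½ ℚ.* ε) (½>0 ε>0)) (q (½ ℚ.* ε) (½>0 ε>0))

  +-cong : ∀ {x y u v} → x ≃ y → u ≃ v → x + u ≃ y + v
  +-cong {x} {y} {u} {v} (mk≃ p) (mk≃ q) = mk≃ λ ε ε>0 → eventually-zip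
    (λ n → sum-bound ε>0 (+-interchange (seq x n) (seq y n) (seq u n) (seq v n)))
    (p (½ ℚ.* ε) (½>0 ε>0)) (q (½ ℚ.* ε) (½>0 ε>0))

  -‿cong : ∀ {x y} → x ≃ y → - x ≃ - y
  -‿cong {x} {y} (mk≃ p) = mk≃ λ ε ε>0 → eventually-map (λ n → subst (ℚ._< ε)
    (trans (∣-∣-sym (seq x n) (seq y n)) (cong ℚ.∣_∣ (neg-diff (seq x n) (seq y n))))) (p ε ε>0)

  *-cong : ∀ {x y u v} → x ≃ y → u ≃ v → x * u ≃ y * v
  *-cong {x} {y} {u} {v} (mk≃ p) (mk≃ q) = mk≃ λ ε ε>0 →
    let A , A>0 , bx = eventuallyBounded {seq x} (cauchy x)
        B , B>0 , bv = eventuallyBounded {seq v} (cauchy v)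
        δ , δ>0 , eq = divide {A ℚ.+ B} {ε} (0<+ A>0 B>0) ε>0
    in eventually-zip {λ n → ℚ.∣ seq x n ∣ ℚ.≤ A × ℚ.∣ seq v n ∣ ℚ.≤ B} {λ n → ℚ.∣ seq x n ℚ.- seq y n ∣ ℚ.< δ × ℚ.∣ seq u n ℚ.- seq v n ∣ ℚ.< δ}
      (λ n (hx , hv) (hp , hq) → subst (ℚ.∣ seq x n ℚ.* seq u n ℚ.- seq y n ℚ.* seq v n ∣ ℚ.<_) eq
        (∣diff-*∣-bound (seq x n) (seq u n) (seq y n) (seq v n) A>0 B>0 hx hv hq hp))
      (eventually-zip (λ _ → _,_) bx bv) (eventually-zip (λ _ → _,_) (p δ δ>0) (q δ δ>0))

  -- Opaque copies of the operations: with the transparent ones, conversion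
  -- checking keeps unfolding the Cauchy proofs.
  infixl 6 _⊕_
  infixl 7 _⊗_
  infix  8 ⊖_
  opaque
    _⊕_ _⊗_ : ℝ → ℝ → ℝ
    x ⊕ y = x + y
    x ⊗ y = x * y

    ⊖_ : ℝ → ℝ
    ⊖ x = - x

    seq-⊕ : ∀ x y n → seq (x ⊕ y) n ≡ seq x n ℚ.+ seq y n
    seq-⊕ x y n = refl

    seq-⊗ : ∀ x y n → seq (x ⊗ y) n ≡ seq x n ℚ.* seq y n
    seq-⊗ x y n = refl

    seq-⊖ : ∀ x n → seq (⊖ x) n ≡ ℚ.- seq x n
    seq-⊖ x n = refl

    ⊕-cong : ∀ {x y u v} → x ≃ y → u ≃ v → x ⊕ u ≃ y ⊕ v
    ⊕-cong = +-cong

    ⊗-cong : ∀ {x y u v} → x ≃ y → u ≃ v → x ⊗ u ≃ y ⊗ v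
    ⊗-cong = *-cong

    ⊖-cong : ∀ {x y} → x ≃ y → ⊖ x ≃ ⊖ y
    ⊖-cong = -‿cong

    ⊕-assoc : ∀ x y z → (x ⊕ y) ⊕ z ≃ x ⊕ (y ⊕ z)
    ⊕-assoc x y z = pointwise {(x ⊕ y) ⊕ z} {x ⊕ (y ⊕ z)} (λ n → ℚ.+-assoc (seq x n) (seq y n) (seq z n))

    ⊕-comm : ∀ x y → x ⊕ y ≃ y ⊕ x
    ⊕-comm x y = pointwise {x ⊕ y} {y ⊕ x} (λ n → ℚ.+-comm (seq x n) (seq y n))

    ⊕-identityˡ : ∀ x → 0ℝ ⊕ x ≃ x
    ⊕-identityˡ x = pointwise {0ℝ ⊕ x} {x} (λ n → ℚ.+-identityˡ (seq x n))

    ⊕-inverseˡ : ∀ x → ⊖ x ⊕ x ≃ 0ℝ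
    ⊕-inverseˡ x = pointwise {⊖ x ⊕ x} {0ℝ} (λ n → ℚ.+-inverseˡ (seq x n))

    ⊗-assoc : ∀ x y z → (x ⊗ y) ⊗ z ≃ x ⊗ (y ⊗ z)
    ⊗-assoc x y z = pointwise {(x ⊗ y) ⊗ z} {x ⊗ (y ⊗ z)} (λ n → ℚ.*-assoc (seq x n) (seq y n) (seq z n))

    ⊗-comm : ∀ x y → x ⊗ y ≃ y ⊗ x
    ⊗-comm x y = pointwise {x ⊗ y} {y ⊗ x} (λ n → ℚ.*-comm (seq x n) (seq y n))

    ⊗-identityˡ : ∀ x → 1ℝ ⊗ x ≃ x
    ⊗-identityˡ x = pointwise {1ℝ ⊗ x} {x} (λ n → ℚ.*-identityˡ (seq x n))

    ⊗-distribˡ-⊕ : ∀ x y z → x ⊗ (y ⊕ z) ≃ x ⊗ y ⊕ x ⊗ z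
    ⊗-distribˡ-⊕ x y z = pointwise {x ⊗ (y ⊕ z)} {x ⊗ y ⊕ x ⊗ z} (λ n → ℚ.*-distribˡ-+ (seq x n) (seq y n) (seq z n))

  ℝ-ring : CommutativeRing 0ℓ 0ℓ
  ℝ-ring = record
    { Carrier = ℝ ; _≈_ = _≃_ ; _+_ = _⊕_ ; _*_ = _⊗_ ; -_ = ⊖_ ; 0# = 0ℝ ; 1# = 1ℝ
    ; isCommutativeRing = record
      { isRing = record
        { +-isAbelianGroup = record
          { isGroup = record
            { isMonoid = record
              { isSemigroup = record
                { isMagma = record
                  { isEquivalence = record { refl = ≃-refl ; sym = ≃-sym ; trans = ≃-trans }
                  ; ∙-cong = ⊕-cong }
                ; assoc = ⊕-assoc }
              ; identity = ⊕-identityˡ , λ x → ≃-trans (⊕-comm x 0ℝ) (⊕-identityˡ x) }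
            ; inverse = ⊕-inverseˡ , λ x → ≃-trans (⊕-comm x (⊖ x)) (⊕-inverseˡ x)
            ; ⁻¹-cong = ⊖-cong }
          ; comm = ⊕-comm }
        ; *-cong = ⊗-cong
        ; *-assoc = ⊗-assoc
        ; *-identity = ⊗-identityˡ , λ x → ≃-trans (⊗-comm x 1ℝ) (⊗-identityˡ x)
        ; distrib = ⊗-distribˡ-⊕
                  , λ x y z → ≃-trans (⊗-comm (y ⊕ z) x) (≃-trans (⊗-distribˡ-⊕ x y z) (⊕-cong (⊗-comm x y) (⊗-comm x z))) }
      ; *-comm = ⊗-comm } }

  Pos-resp : ∀ {x y} → x ≃ y → Pos x → Pos y
  Pos-resp {x} {y} (mk≃ eq) (mkPos ε ε>0 p) = mkPos h h>0 (eventually-zip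
    (λ n ε<x d → 0<diff⇒< (0<+ (<⇒0<diff (subst (ℚ._< seq x n) (sym (½+½ ε)) ε<x))
                                (<⇒0<diff (ℚ.≤-<-trans (p≤∣p∣ (seq x n ℚ.- seq y n)) d)))
       (shift-bound (seq x n) (seq y n) h))
    p (eq h h>0))
    where
    h = ½ ℚ.* ε
    h>0 = ½>0 ε>0

  -- Past the modulus for h/2, a single term above h keeps all later terms above h/2. This turns one
  -- decidable rational comparison into positivity of the real.
  Pos-at : ∀ z {h} → 0ℚ ℚ.< h → Eventually (λ M → h ℚ.< seq z M → Pos z)
  Pos-at z {h} h>0 = go (cauchy z k (½>0 h>0))
    where
    k : ℚ
    k = ½ ℚ.* h
    go : ∃[ N ] (∀ m n → N ℕ.≤ m → N ℕ.≤ n → ℚ.∣ seq z m ℚ.- seq z n ∣ ℚ.< k) → Eventually (λ M → h ℚ.< seq z M → Pos z)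
    go (N , c) = N , λ M N≤M h<z → mkPos k (½>0 h>0) (M , λ n M≤n → 0<diff⇒<
      (0<+ (<⇒0<diff (subst (ℚ._< seq z M) (sym (½+½ h)) h<z))
           (<⇒0<diff (ℚ.≤-<-trans (p≤∣p∣ (seq z M ℚ.- seq z n)) (c M n N≤M (ℕ.≤-trans N≤M M≤n)))))
      (shift-bound (seq z M) (seq z n) k))

  opaque
    unfolding _⊕_ _⊗_ ⊖_

    Pos-+ : ∀ {x y} → Pos x → Pos y → Pos (x ⊕ y)
    Pos-+ (mkPos ε ε>0 p) (mkPos δ δ>0 q) = mkPos (ε ℚ.+ δ) (0<+ ε>0 δ>0) (eventually-zip (λ _ → ℚ.+-mono-<) p q)

    Pos-* : ∀ {x y} → Pos x → Pos y → Pos (x ⊗ y)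
    Pos-* {x} {y} (mkPos ε ε>0 p) (mkPos δ δ>0 q) = mkPos (ε ℚ.* δ) (0<* ε>0 δ>0) (eventually-zip
      (λ n a b → ℚ.<-trans (ℚ.*-monoˡ-<-pos δ {{ℚ.positive δ>0}} a)
                           (ℚ.*-monoʳ-<-pos (seq x n) {{ℚ.positive (ℚ.<-trans ε>0 a)}} b)) p q)

    Pos-asym : ∀ {x} → Pos x → Pos (⊖ x) → ⊥
    Pos-asym {x} (mkPos ε ε>0 p) (mkPos δ δ>0 q) with eventually-witness (eventually-zip (λ _ → _,_) p q)
    ... | n , ε<x , δ<-x = ℚ.<-irrefl (sym (ℚ.+-inverseʳ (seq x n))) (0<+ (ℚ.<-trans ε>0 ε<x) (ℚ.<-trans δ>0 δ<-x))

    -- At one late index M, x_M + y_M > ε, so x_M > ε/2 or y_M > ε/2; this is decided in ℚ and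
    -- passed on by `Pos-at`.
    Pos-split : ∀ {x y} → Pos (x ⊕ y) → Pos x ⊎ Pos y
    Pos-split {x} {y} (mkPos ε ε>0 p) = choose (eventually-witness
      (eventually-zip (λ _ → _,_) p (eventually-zip (λ _ → _,_) (Pos-at x (½>0 ε>0)) (Pos-at y (½>0 ε>0)))))
      where
      h : ℚ
      h = ½ ℚ.* ε
      choose : ∃[ M ] (ε ℚ.< seq x M ℚ.+ seq y M × (h ℚ.< seq x M → Pos x) × (h ℚ.< seq y M → Pos y)) → Pos x ⊎ Pos y
      choose (M , ε<x+y , Px , Py) with h ℚ.<? seq x M
      ... | yes h<x = inj₁ (Px h<x)
      ... | no  h≮x = inj₂ (Py (0<diff⇒<
        (0<+≤ (<⇒0<diff (subst (ℚ._< seq x M ℚ.+ seq y M) (sym (½+½ ε)) ε<x+y)) (≤⇒0≤diff (ℚ.≮⇒≥ h≮x)))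
        (split-bound (seq x M) (seq y M) h)))

    -- Eventually ε|v| ≤ |xv| < εη, and the rational ε is cancelled; no inverse of x is formed.
    Pos-regular : ∀ {x} → Pos x → ∀ v → x ⊗ v ≃ 0ℝ → v ≃ 0ℝ
    Pos-regular {x} (mkPos ε ε>0 p) v (mk≃ eq) = mk≃ λ η η>0 → eventually-zip
      (λ n ε<x xv<εη → small n η ε<x xv<εη) p (eq (ε ℚ.* η) (0<* ε>0 η>0))
      where
      small : ∀ n η → ε ℚ.< seq x n → ℚ.∣ seq x n ℚ.* seq v n ℚ.- 0ℚ ∣ ℚ.< ε ℚ.* η → ℚ.∣ seq v n ℚ.- 0ℚ ∣ ℚ.< η
      small n η ε<x h = ℚ.*-cancelˡ-<-nonNeg ε {{ℚ.nonNegative (ℚ.<⇒≤ ε>0)}} (ℚ.≤-<-trans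
        (subst (ε ℚ.* ℚ.∣ seq v n ℚ.- 0ℚ ∣ ℚ.≤_) (sym eq′)
          (ℚ.*-monoʳ-≤-nonNeg ℚ.∣ seq v n ℚ.- 0ℚ ∣ {{ℚ.nonNegative (ℚ.0≤∣p∣ (seq v n ℚ.- 0ℚ))}} (ℚ.<⇒≤ ε<x))) h)
        where
        eq′ : ℚ.∣ seq x n ℚ.* seq v n ℚ.- 0ℚ ∣ ≡ seq x n ℚ.* ℚ.∣ seq v n ℚ.- 0ℚ ∣
        eq′ = trans (cong ℚ.∣_∣ (*-minus-0 (seq x n) (seq v n)))
          (trans (ℚ.∣p*q∣≡∣p∣*∣q∣ (seq x n) (seq v n ℚ.- 0ℚ))
                 (cong (ℚ._* ℚ.∣ seq v n ℚ.- 0ℚ ∣) (ℚ.0≤p⇒∣p∣≡p (ℚ.<⇒≤ (ℚ.<-trans ε>0 ε<x)))))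

    archimedean : ∀ x → ∃[ n ] Pos (x ⊕ fromℕ n)
    archimedean x = bounded (eventuallyBounded {seq x} (cauchy x))
      where
      above : ∀ B → Eventually (λ k → ℚ.∣ seq x k ∣ ℚ.≤ B) → ∃[ n ] B ℚ.+ 1ℚ ℚ.< ι n → ∃[ n ] Pos (x ⊕ fromℕ n)
      above B bx (n , B+1<n) = n , mkPos 1ℚ (ℚ.positive⁻¹ 1ℚ) (eventually-map
        (λ k x≤B → 0<diff⇒< (0<+≤ (<⇒0<diff B+1<n) (≤⇒0≤diff (ℚ.≤-trans (-p≤∣p∣ (seq x k)) x≤B)))
          (arch-bound B (ι n) (seq x k))) bx)
      bounded : Σ[ B ∈ ℚ ] (0ℚ ℚ.< B × Eventually (λ k → ℚ.∣ seq x k ∣ ℚ.≤ B)) → ∃[ n ] Pos (x ⊕ fromℕ n)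
      bounded (B , _ , bx) = above B bx (ℚ-archimedean (B ℚ.+ 1ℚ))

-- The intermediate value theorem by bisection over ℚ.

module IntermediateValue where

  open import Defs using (ℝ; mkℝ; seq; cauchy; IsCauchy; ½>0; ½+½; divide; eventuallyBounded)
  open Rationals
  open Reals using (Eventually; eventually-map; eventually-zip; eventually-witness)
  open import Data.List.Base using (List; []; _∷_)
  open import Data.Nat.Base as ℕ using (ℕ; zero; suc)
  import Data.Nat.Properties as ℕ
  open import Data.Product.Base using (Σ-syntax; ∃-syntax; _×_; _,_)
  open import Data.Rational.Base using (ℚ; 0ℚ; 1ℚ; ½; _+_; _*_; _-_; -_; _<_; _≤_; ∣_∣; nonNegative; positive)
  open import Data.Rational.Properties
  open import Data.Sum.Base using (inj₁; inj₂)
  open import Relation.Binary.PropositionalEquality using (_≡_; sym; trans; cong; cong₂; subst; subst₂)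
  open import Relation.Nullary using (Dec; yes; no)

  ∣p*q∣≤ : ∀ {p q A B} → 0ℚ ≤ A → ∣ p ∣ ≤ A → ∣ q ∣ ≤ B → ∣ p * q ∣ ≤ A * B
  ∣p*q∣≤ {p} {q} {A} {B} 0≤A hp hq = subst (_≤ A * B) (sym (∣p*q∣≡∣p∣*∣q∣ p q)) (≤-trans
    (*-monoʳ-≤-nonNeg ∣ q ∣ {{nonNegative (0≤∣p∣ q)}} hp) (*-monoˡ-≤-nonNeg A {{nonNegative 0≤A}} hq))

  module Bisection (g : ℚ → ℚ) where

    -- The sign conditions are weak, so either outcome of the test `g (mid s) ≤ 0ℚ` leaves a valid
    -- half.
    record State : Set where
      field
        lo hi : ℚ
        lo<hi : lo < hi
        lo≤0  : g lo ≤ 0ℚ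
        0≤hi  : 0ℚ ≤ g hi
      width : ℚ
      width = hi - lo
      half : ℚ
      half = ½ * width
      mid : ℚ
      mid = lo + half
      half>0 : 0ℚ < half
      half>0 = ½>0 (<⇒0<diff lo<hi)
      hi-mid≡half : hi - mid ≡ half
      hi-mid≡half = trans (sym (hi-mid lo hi half)) (trans (cong (_- half) (sym (½+½ width))) (cancelʳ half half))

    open State

    choose : (s : State) → Dec (g (mid s) ≤ 0ℚ) → State
    choose s (yes p) = record
      { lo = mid s ; hi = hi s ; lo<hi = 0<diff⇒< (half>0 s) (sym (hi-mid≡half s)) ; lo≤0 = p ; 0≤hi = 0≤hi s }
    choose s (no ¬p) = record
      { lo = lo s ; hi = mid s ; lo<hi = 0<diff⇒< (half>0 s) (mid-lo (lo s) (half s)) ; lo≤0 = lo≤0 s ; 0≤hi = <⇒≤ (≰⇒> ¬p) }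

    choose-lo : ∀ s d → lo s ≤ lo (choose s d)
    choose-lo s (yes p) = <⇒≤ (0<diff⇒< (half>0 s) (mid-lo (lo s) (half s)))
    choose-lo s (no ¬p) = ≤-refl

    choose-hi : ∀ s d → hi (choose s d) ≤ hi s
    choose-hi s (yes p) = ≤-refl
    choose-hi s (no ¬p) = <⇒≤ (0<diff⇒< (half>0 s) (sym (hi-mid≡half s)))

    choose-width : ∀ s d → width (choose s d) ≡ half s
    choose-width s (yes p) = hi-mid≡half s
    choose-width s (no ¬p) = sym (mid-lo (lo s) (half s))

    next : State → State
    next s = choose s (g (mid s) ≤? 0ℚ)

    iterate : State → ℕ → State
    iterate s zero    = s
    iterate s (suc n) = next (iterate s n)

    module _ (s : State) where
      private
        l h w : ℕ → ℚ
        l n = lo (iterate s n)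
        h n = hi (iterate s n)
        w n = width (iterate s n)

      width-halves : ∀ n → w (suc n) + w (suc n) ≡ w n
      width-halves n = trans (cong₂ _+_ eq eq) (½+½ (w n))
        where
        eq : w (suc n) ≡ half (iterate s n)
        eq = choose-width (iterate s n) (g (mid (iterate s n)) ≤? 0ℚ)

      width>0 : ∀ n → 0ℚ < w n
      width>0 n = <⇒0<diff (lo<hi (iterate s n))

      -- Weaker than halving, but enough for the Archimedean property, and it avoids powers of 2.
      width-bound : ∀ n → ι (suc n) * w n ≤ w 0
      width-bound zero    = ≤-reflexive (*-identityˡ (w 0))
      width-bound (suc n) = ≤-trans (0≤diff⇒≤ (0≤* (0≤ι n) (<⇒≤ (width>0 (suc n)))) eq) (width-bound n)
        where
        eq : ι n * w (suc n) ≡ ι (suc n) * w n - ι (suc (suc n)) * w (suc n)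
        eq = trans (width-step (ι n) (w (suc n))) (cong₂ _-_
          (cong₂ _*_ (sym (ι-suc n)) (width-halves n))
          (cong (_* w (suc n)) (sym (trans (ι-suc (suc n)) (cong (λ m → 1ℚ + m) (ι-suc n))))))

      lo-mono : ∀ k N → l N ≤ l (k ℕ.+ N)
      lo-mono zero    N = ≤-refl
      lo-mono (suc k) N = ≤-trans (lo-mono k N) (choose-lo (iterate s (k ℕ.+ N)) (g (mid (iterate s (k ℕ.+ N))) ≤? 0ℚ))

      hi-mono : ∀ k N → h (k ℕ.+ N) ≤ h N
      hi-mono zero    N = ≤-refl
      hi-mono (suc k) N = ≤-trans (choose-hi (iterate s (k ℕ.+ N)) (g (mid (iterate s (k ℕ.+ N))) ≤? 0ℚ)) (hi-mono k N)

      lo-mono′ : ∀ {N n} → N ℕ.≤ n → l N ≤ l n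
      lo-mono′ {N} {n} N≤n = subst (λ m → l N ≤ l m) (ℕ.m∸n+n≡m N≤n) (lo-mono (n ℕ.∸ N) N)

      hi-mono′ : ∀ {N n} → N ℕ.≤ n → h n ≤ h N
      hi-mono′ {N} {n} N≤n = subst (λ m → h m ≤ h N) (ℕ.m∸n+n≡m N≤n) (hi-mono (n ℕ.∸ N) N)

      -- With δ = w₀/ε and N > δ, (N + 1) w_N ≤ w₀ = εδ < ε(N + 1).
      width-small : ∀ ε → 0ℚ < ε → Eventually (λ n → w n < ε)
      width-small ε ε>0 = go (divide ε>0 (width>0 0))
        where
        at : ∀ {δ} → ε * δ ≡ w 0 → ∃[ N ] δ < ι N → Eventually (λ n → w n < ε)
        at {δ} eq (N , δ<N) = N , λ n N≤n → ≤-<-trans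
          (0≤diff⇒≤ (0≤+ (≤⇒0≤diff (hi-mono′ N≤n)) (≤⇒0≤diff (lo-mono′ N≤n))) (nested-width (l N) (h N) (l n) (h n)))
          (*-cancelˡ-<-nonNeg (ι (suc N)) {{nonNegative (0≤ι (suc N))}}
            (≤-<-trans (width-bound N) (subst₂ _<_ eq (*-comm ε (ι (suc N)))
              (<-trans (*-monoʳ-<-pos ε {{positive ε>0}} δ<N)
                (0<diff⇒< ε>0 (trans (slack ε (ι N)) (cong (λ m → ε * m - ε * ι N) (sym (ι-suc N)))))))))
        go : Σ[ δ ∈ ℚ ] (0ℚ < δ × ε * δ ≡ w 0) → Eventually (λ n → w n < ε)
        go (δ , _ , eq) = at eq (ℚ-archimedean δ)

      lo-diff : ∀ {N m n} → N ℕ.≤ m → N ℕ.≤ n → l m - l n ≤ w N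
      lo-diff {N} {m} {n} N≤m N≤n = 0≤diff⇒≤
        (0≤+ (0≤+ (<⇒≤ (width>0 m)) (≤⇒0≤diff (hi-mono′ N≤m))) (≤⇒0≤diff (lo-mono′ N≤n)))
        (nested-diff (l N) (h N) (l m) (h m) (l n))

      lo-cauchy : IsCauchy l
      lo-cauchy ε ε>0 = go (width-small ε ε>0)
        where
        go : Eventually (λ n → w n < ε) → ∃[ N ] (∀ m n → N ℕ.≤ m → N ℕ.≤ n → ∣ l m - l n ∣ < ε)
        go (N , small) = N , λ m n N≤m N≤n → ∣∣<⁺
          (≤-<-trans (lo-diff N≤m N≤n) (small N ℕ.≤-refl))
          (≤-<-trans (subst (_≤ w N) (diff-swap (l n) (l m)) (lo-diff N≤n N≤m)) (small N ℕ.≤-refl))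

      limit : ℝ
      limit = mkℝ l lo-cauchy

      limit-lower : ∀ n → lo s ≤ l n
      limit-lower n = lo-mono′ {0} {n} ℕ.z≤n

      limit-upper : ∀ n → h n ≤ hi s
      limit-upper n = hi-mono′ {0} {n} ℕ.z≤n

      -- The signs at the two ends bound |g(l n)| by g(h n) - g(l n), hence by L times the width.
      g-limit : ∀ {L} → 0ℚ < L →
        (∀ u v → lo s ≤ u → u ≤ hi s → lo s ≤ v → v ≤ hi s → ∣ g u - g v ∣ ≤ L * ∣ u - v ∣) →
        ∀ ε → 0ℚ < ε → Eventually (λ n → ∣ g (l n) ∣ < ε)
      g-limit {L} L>0 lip ε ε>0 = go (divide L>0 ε>0)
        where
        bound : ∀ n → ∣ g (l n) ∣ ≤ g (h n) - g (l n)
        bound n = ∣∣≤⁺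
          (0≤diff⇒≤ (0≤+ (≤⇒0≤diff (0≤hi (iterate s n))) (0≤+ (≤⇒0≤diff (lo≤0 (iterate s n))) (≤⇒0≤diff (lo≤0 (iterate s n)))))
            (pos-bound (g (h n)) (g (l n))))
          (0≤diff⇒≤ (≤⇒0≤diff (0≤hi (iterate s n))) (neg-bound (g (h n)) (g (l n))))
        bound′ : ∀ n → ∣ g (l n) ∣ ≤ L * w n
        bound′ n = ≤-trans (bound n) (≤-trans (p≤∣p∣ _) (subst (λ d → ∣ g (h n) - g (l n) ∣ ≤ L * d)
          (0≤p⇒∣p∣≡p (<⇒≤ (width>0 n)))
          (lip (h n) (l n) (≤-trans (limit-lower n) (<⇒≤ (lo<hi (iterate s n)))) (limit-upper n)
            (limit-lower n) (≤-trans (<⇒≤ (lo<hi (iterate s n))) (limit-upper n)))))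
        go : Σ[ δ ∈ ℚ ] (0ℚ < δ × L * δ ≡ ε) → Eventually (λ n → ∣ g (l n) ∣ < ε)
        go (δ , δ>0 , eq) = eventually-map
          (λ n w<δ → ≤-<-trans (bound′ n) (subst (L * w n <_) eq (*-monoʳ-<-pos L {{positive L>0}} w<δ)))
          (width-small δ δ>0)

  LocallyLipschitz : (ℚ → ℚ) → Set
  LocallyLipschitz g = ∀ B → 0ℚ ≤ B →
    Σ[ L ∈ ℚ ] (0ℚ ≤ L × (∀ u v → ∣ u ∣ ≤ B → ∣ v ∣ ≤ B → ∣ g u - g v ∣ ≤ L * ∣ u - v ∣))

  smaller : ∀ {a b} → 0ℚ < a → 0ℚ < b → Σ[ e ∈ ℚ ] (0ℚ < e × e ≤ a × e ≤ b)
  smaller {a} {b} a>0 b>0 with ≤-total a b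
  ... | inj₁ a≤b = a , a>0 , ≤-refl , a≤b
  ... | inj₂ b≤a = b , b>0 , b≤a , ≤-refl

  cauchy-tail : ∀ (x : ℝ) η → 0ℚ < η → Eventually (λ M → ∀ n → M ℕ.≤ n → ∣ seq x M - seq x n ∣ < η)
  cauchy-tail x η η>0 = go (cauchy x η η>0)
    where
    go : ∃[ N ] (∀ m n → N ℕ.≤ m → N ℕ.≤ n → ∣ seq x m - seq x n ∣ < η) →
         Eventually (λ M → ∀ n → M ℕ.≤ n → ∣ seq x M - seq x n ∣ < η)
    go (N , c) = N , λ M N≤M n M≤n → c M n N≤M (ℕ.≤-trans N≤M M≤n)

  -- `gap` is one rational margin on both sides of the point, as strict order on ℝ demands a uniform
  -- bound.
  record Crossing (g : ℚ → ℚ) (x y : ℝ) : Set where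
    field
      point : ℝ
      gap   : ℚ
      gap>0 : 0ℚ < gap
      lower : Eventually (λ n → gap < seq point n - seq x n)
      upper : Eventually (λ n → gap < seq y n - seq point n)
      tends : ∀ ε → 0ℚ < ε → Eventually (λ n → ∣ g (seq point n) ∣ < ε)

  module _ (g : ℚ → ℚ) (lipschitz : LocallyLipschitz g) (x y : ℝ) where

    private
      -- The ends x and y are real, but bisection needs rational ones, taken near the terms at index
      -- M. The equation (2L + 4)η = e makes 4η ≤ e, so the shrunken interval is still proper, and
      -- 2Lη ≤ e, so moving an end by 2η keeps its sign.
      crossing-at : ∀ {A B e η L M} → 0ℚ ≤ A → 0ℚ ≤ B → e ≤ 1ℚ → 0ℚ < η → 0ℚ ≤ L →
        ((L + L) + ((1ℚ + 1ℚ) + (1ℚ + 1ℚ))) * η ≡ e →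
        (∀ u v → ∣ u ∣ ≤ (A + B) + 1ℚ → ∣ v ∣ ≤ (A + B) + 1ℚ → ∣ g u - g v ∣ ≤ L * ∣ u - v ∣) →
        ∣ seq x M ∣ ≤ A → ∣ seq y M ∣ ≤ B →
        e < seq y M - seq x M → e < g (seq y M) → e < - g (seq x M) →
        (∀ n → M ℕ.≤ n → ∣ seq x M - seq x n ∣ < η) → (∀ n → M ℕ.≤ n → ∣ seq y M - seq y n ∣ < η) →
        Crossing g x y
      crossing-at {A} {B} {e} {η} {L} {M} 0≤A 0≤B e≤1 η>0 0≤L Kη≡e lip xM≤A yM≤B e<y-x e<gy e<-gx tailx taily = record
        { point = limit s
        ; gap = η
        ; gap>0 = η>0
        ; lower = M , λ n M≤n → 0<diff⇒<
            (0≤+< (≤⇒0≤diff (limit-lower s n))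
                  (<⇒0<diff (≤-<-trans (p≤∣p∣ (seq x n - xM)) (subst (_< η) (∣-∣-sym xM (seq x n)) (tailx n M≤n)))))
            (lower-gap (seq (limit s) n) xM (seq x n) η)
        ; upper = M , λ n M≤n → 0<diff⇒<
            (0≤+< (≤⇒0≤diff (≤-trans (<⇒≤ (State.lo<hi (iterate s n))) (limit-upper s n)))
                  (<⇒0<diff (≤-<-trans (p≤∣p∣ (yM - seq y n)) (taily n M≤n))))
            (upper-gap (seq (limit s) n) yM (seq y n) η)
        -- `L` may be 0, while `g-limit` divides by its constant; hence `L + 1ℚ`.
        ; tends = g-limit s {L + 1ℚ} (0≤+< 0≤L (positive⁻¹ 1ℚ))
            (λ u v a≤u u≤b a≤v v≤b → ≤-trans (lip u v (in-range a≤u u≤b) (in-range a≤v v≤b))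
              (*-monoʳ-≤-nonNeg ∣ u - v ∣ {{nonNegative (0≤∣p∣ (u - v))}}
                {L} {L + 1ℚ} (0≤diff⇒≤ (<⇒≤ (positive⁻¹ 1ℚ)) (sym (add-sub L 1ℚ)))))
        }
        where
        open Bisection g
        xM yM 2η 4η a b : ℚ
        xM = seq x M
        yM = seq y M
        2η = η + η
        4η = 2η + 2η
        -- Later terms of x and y move by less than η, so an inset of 2η leaves a margin of η to
        -- both reals.
        a = xM + 2η
        b = yM - 2η
        0≤2η : 0ℚ ≤ 2η
        0≤2η = <⇒≤ (0<+ η>0 η>0)
        ∣2η∣ : ∣ 2η ∣ ≡ 2η
        ∣2η∣ = 0≤p⇒∣p∣≡p 0≤2η
        4η≤e : 4η ≤ e
        4η≤e = 0≤diff⇒≤ (0≤* (0≤+ 0≤L 0≤L) (<⇒≤ η>0)) (trans (margin L η) (cong (_- 4η) Kη≡e))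
        2η≤1 : 2η ≤ 1ℚ
        2η≤1 = ≤-trans (0≤diff⇒≤ 0≤2η (sym (add-sub 2η 2η))) (≤-trans 4η≤e e≤1)
        L2η≤e : L * 2η ≤ e
        L2η≤e = 0≤diff⇒≤ (0≤+ 0≤2η 0≤2η) (trans (margin′ L η) (cong (_- L * 2η) Kη≡e))
        A≤ : A ≤ A + B
        A≤ = 0≤diff⇒≤ 0≤B (sym (add-sub A B))
        B≤ : B ≤ A + B
        B≤ = 0≤diff⇒≤ 0≤A (sym (trans (cong (_- B) (+-comm A B)) (add-sub B A)))
        ≤+1 : ∀ {c} → c ≤ A + B → c ≤ (A + B) + 1ℚ
        ≤+1 p = ≤-trans p (0≤diff⇒≤ (<⇒≤ (positive⁻¹ 1ℚ)) (sym (add-sub (A + B) 1ℚ)))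
        ∣a∣≤ : ∣ a ∣ ≤ (A + B) + 1ℚ
        ∣a∣≤ = ≤-trans (∣p+q∣≤∣p∣+∣q∣ xM 2η) (+-mono-≤ (≤-trans xM≤A A≤) (subst (_≤ 1ℚ) (sym ∣2η∣) 2η≤1))
        ∣b∣≤ : ∣ b ∣ ≤ (A + B) + 1ℚ
        ∣b∣≤ = ≤-trans (∣p-q∣≤∣p∣+∣q∣ yM 2η) (+-mono-≤ (≤-trans yM≤B B≤) (subst (_≤ 1ℚ) (sym ∣2η∣) 2η≤1))
        in-range : ∀ {u} → a ≤ u → u ≤ b → ∣ u ∣ ≤ (A + B) + 1ℚ
        in-range a≤u u≤b = ∣∣≤⁺ (≤-trans u≤b (≤-trans (p≤∣p∣ b) ∣b∣≤))
          (≤-trans (neg-antimono-≤ a≤u) (≤-trans (-p≤∣p∣ a) ∣a∣≤))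
        s : State
        s = record
          { lo = a ; hi = b
          ; lo<hi = 0<diff⇒< (0<+≤ (<⇒0<diff e<y-x) (≤⇒0≤diff 4η≤e)) (ends-apart xM yM e η)
          ; lo≤0 = 0≤diff⇒≤ (0≤+ (0≤+ (≤⇒0≤diff (<⇒≤ e<-gx)) (≤⇒0≤diff L2η≤e))
              (≤⇒0≤diff (≤-trans (p≤∣p∣ (g a - g xM)) (subst (λ d → ∣ g a - g xM ∣ ≤ L * d) (trans (cong ∣_∣ (add-sub xM 2η)) ∣2η∣)
                (lip a xM ∣a∣≤ (≤+1 (≤-trans xM≤A A≤)))))))
              (left-sign (g xM) (g a) e (L * 2η))
          ; 0≤hi = 0≤diff⇒≤ (0≤+ (0≤+ (≤⇒0≤diff (<⇒≤ e<gy)) (≤⇒0≤diff L2η≤e))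
              (≤⇒0≤diff (≤-trans (p≤∣p∣ (g yM - g b)) (subst (λ d → ∣ g yM - g b ∣ ≤ L * d) (trans (cong ∣_∣ (sub-sub yM 2η)) ∣2η∣)
                (lip yM b (≤+1 (≤-trans yM≤B B≤)) ∣b∣≤)))))
              (right-sign (g yM) (g b) e (L * 2η))
          }

    crossing : ∀ {ε₁ ε₂ ε₃} → 0ℚ < ε₁ → 0ℚ < ε₂ → 0ℚ < ε₃ →
      Eventually (λ n → ε₁ < seq y n - seq x n) →
      Eventually (λ n → ε₂ < g (seq y n)) → Eventually (λ n → ε₃ < - g (seq x n)) →
      Crossing g x y
    crossing {ε₁} {ε₂} {ε₃} ε₁>0 ε₂>0 ε₃>0 gap gy gx =
      start (eventuallyBounded {seq x} (cauchy x)) (eventuallyBounded {seq y} (cauchy y))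
            (smaller ε₁>0 ε₂>0) (smaller ε₃>0 (positive⁻¹ 1ℚ))
      where
      Bounded : ℝ → Set
      Bounded z = Σ[ B ∈ ℚ ] (0ℚ < B × Eventually (λ n → ∣ seq z n ∣ ≤ B))
      start : Bounded x → Bounded y →
        Σ[ e ∈ ℚ ] (0ℚ < e × e ≤ ε₁ × e ≤ ε₂) → Σ[ e ∈ ℚ ] (0ℚ < e × e ≤ ε₃ × e ≤ 1ℚ) → Crossing g x y
      start (A , A>0 , bx) (B , B>0 , by) (e₁ , e₁>0 , e₁≤ε₁ , e₁≤ε₂) (e₂ , e₂>0 , e₂≤ε₃ , e₂≤1) =
        go (smaller e₁>0 e₂>0) (lipschitz ((A + B) + 1ℚ) (<⇒≤ (0<+ (0<+ A>0 B>0) (positive⁻¹ 1ℚ))))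
        where
        go : Σ[ e ∈ ℚ ] (0ℚ < e × e ≤ e₁ × e ≤ e₂) →
          Σ[ L ∈ ℚ ] (0ℚ ≤ L × (∀ u v → ∣ u ∣ ≤ (A + B) + 1ℚ → ∣ v ∣ ≤ (A + B) + 1ℚ → ∣ g u - g v ∣ ≤ L * ∣ u - v ∣)) →
          Crossing g x y
        go (e , e>0 , e≤e₁ , e≤e₂) (L , 0≤L , lip) =
          finish (divide {(L + L) + ((1ℚ + 1ℚ) + (1ℚ + 1ℚ))} (0≤+< (0≤+ 0≤L 0≤L) (positive⁻¹ ((1ℚ + 1ℚ) + (1ℚ + 1ℚ)))) e>0)
          where
          finish : Σ[ η ∈ ℚ ] (0ℚ < η × ((L + L) + ((1ℚ + 1ℚ) + (1ℚ + 1ℚ))) * η ≡ e) → Crossing g x y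
          finish (η , η>0 , Kη≡e) = use (eventually-witness (eventually-zip (λ _ → _,_)
            (eventually-zip (λ _ → _,_) (eventually-zip (λ _ → _,_) bx by) (eventually-zip (λ _ → _,_) gap (eventually-zip (λ _ → _,_) gy gx)))
            (eventually-zip (λ _ → _,_) (cauchy-tail x η η>0) (cauchy-tail y η η>0))))
            where
            use : ∃[ M ] (((∣ seq x M ∣ ≤ A × ∣ seq y M ∣ ≤ B) × (ε₁ < seq y M - seq x M × (ε₂ < g (seq y M) × ε₃ < - g (seq x M))))
              × ((∀ n → M ℕ.≤ n → ∣ seq x M - seq x n ∣ < η) × (∀ n → M ℕ.≤ n → ∣ seq y M - seq y n ∣ < η))) → Crossing g x y
            use (M , ((xb , yb) , (gp , (p , q))) , (tx , ty)) = crossing-at {M = M} (<⇒≤ A>0) (<⇒≤ B>0) (≤-trans e≤e₂ e₂≤1) η>0 0≤L Kη≡e lip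
              xb yb (≤-<-trans (≤-trans e≤e₁ e₁≤ε₁) gp) (≤-<-trans (≤-trans e≤e₁ e₁≤ε₂) p) (≤-<-trans (≤-trans e≤e₂ e₂≤ε₃) q) tx ty

  open Defs.Polynomial (CommutativeRing.rawRing +-*-commutativeRing) public using () renaming (eval to evalℚ)

  -- The bound M on values is carried along because uP(u) - vP(v) = u(P(u) - P(v)) + P(v)(u - v)
  -- needs it for the next Lipschitz constant BL + M.
  polynomial-bounds : ∀ (p : List ℚ) B → 0ℚ ≤ B →
    Σ[ L ∈ ℚ ] Σ[ M ∈ ℚ ] (0ℚ ≤ L × 0ℚ ≤ M × (∀ u → ∣ u ∣ ≤ B → ∣ evalℚ p u ∣ ≤ M)
      × (∀ u v → ∣ u ∣ ≤ B → ∣ v ∣ ≤ B → ∣ evalℚ p u - evalℚ p v ∣ ≤ L * ∣ u - v ∣))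
  polynomial-bounds [] B 0≤B = 0ℚ , 0ℚ , ≤-refl , ≤-refl , (λ u _ → ≤-refl)
    , λ u v _ _ → ≤-reflexive (sym (*-zeroˡ ∣ u - v ∣))
  polynomial-bounds (a ∷ p) B 0≤B = extend (polynomial-bounds p B 0≤B)
    where
    extend : Σ[ L ∈ ℚ ] Σ[ M ∈ ℚ ] (0ℚ ≤ L × 0ℚ ≤ M × (∀ u → ∣ u ∣ ≤ B → ∣ evalℚ p u ∣ ≤ M)
        × (∀ u v → ∣ u ∣ ≤ B → ∣ v ∣ ≤ B → ∣ evalℚ p u - evalℚ p v ∣ ≤ L * ∣ u - v ∣)) →
      Σ[ L ∈ ℚ ] Σ[ M ∈ ℚ ] (0ℚ ≤ L × 0ℚ ≤ M × (∀ u → ∣ u ∣ ≤ B → ∣ evalℚ (a ∷ p) u ∣ ≤ M)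
        × (∀ u v → ∣ u ∣ ≤ B → ∣ v ∣ ≤ B → ∣ evalℚ (a ∷ p) u - evalℚ (a ∷ p) v ∣ ≤ L * ∣ u - v ∣))
    extend (L , M , 0≤L , 0≤M , bound , lip) =
      B * L + M , ∣ a ∣ + B * M , 0≤+ (0≤* 0≤B 0≤L) 0≤M , 0≤+ (0≤∣p∣ a) (0≤* 0≤B 0≤M)
      , (λ u u≤B → ≤-trans (∣p+q∣≤∣p∣+∣q∣ a (u * evalℚ p u))
          (+-monoʳ-≤ ∣ a ∣ (∣p*q∣≤ {u} {evalℚ p u} 0≤B u≤B (bound u u≤B))))
      , λ u v u≤B v≤B → subst₂ _≤_ (cong ∣_∣ (poly-diff a u v (evalℚ p u) (evalℚ p v))) (factor-out B L M ∣ u - v ∣)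
          (≤-trans (∣p+q∣≤∣p∣+∣q∣ (u * (evalℚ p u - evalℚ p v)) (evalℚ p v * (u - v)))
            (+-mono-≤ (∣p*q∣≤ {u} {evalℚ p u - evalℚ p v} 0≤B u≤B (lip u v u≤B v≤B))
                      (∣p*q∣≤ {evalℚ p v} {u - v} 0≤M (bound v v≤B) ≤-refl)))

  evalℚ-lipschitz : ∀ p → LocallyLipschitz (evalℚ p)
  evalℚ-lipschitz p B 0≤B = project (polynomial-bounds p B 0≤B)
    where
    project : Σ[ L ∈ ℚ ] Σ[ M ∈ ℚ ] (0ℚ ≤ L × 0ℚ ≤ M × (∀ u → ∣ u ∣ ≤ B → ∣ evalℚ p u ∣ ≤ M)
        × (∀ u v → ∣ u ∣ ≤ B → ∣ v ∣ ≤ B → ∣ evalℚ p u - evalℚ p v ∣ ≤ L * ∣ u - v ∣)) →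
      Σ[ L ∈ ℚ ] (0ℚ ≤ L × (∀ u v → ∣ u ∣ ≤ B → ∣ v ∣ ≤ B → ∣ evalℚ p u - evalℚ p v ∣ ≤ L * ∣ u - v ∣))
    project (L , _ , 0≤L , _ , _ , lip) = L , 0≤L , lip

  neg-lipschitz : ∀ {g} → LocallyLipschitz g → LocallyLipschitz (λ u → - g u)
  neg-lipschitz {g} lip B 0≤B = project (lip B 0≤B)
    where
    project : Σ[ L ∈ ℚ ] (0ℚ ≤ L × (∀ u v → ∣ u ∣ ≤ B → ∣ v ∣ ≤ B → ∣ g u - g v ∣ ≤ L * ∣ u - v ∣)) →
              Σ[ L ∈ ℚ ] (0ℚ ≤ L × (∀ u v → ∣ u ∣ ≤ B → ∣ v ∣ ≤ B → ∣ (- g u) - (- g v) ∣ ≤ L * ∣ u - v ∣))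
    project (L , 0≤L , h) = L , 0≤L , λ u v u≤B v≤B → subst (_≤ L * ∣ u - v ∣)
      (trans (∣-∣-sym (g u) (g v)) (cong ∣_∣ (neg-diff (g u) (g v)))) (h u v u≤B v≤B)

-- The reals as an ordered ring.

module RealOrder where

  open import Defs using (ℝ; seq; 0ℝ; fromℕ)
  open Ordered
  open Rationals
  open Reals
  open IntermediateValue
  open import Data.Bool.Base using (true; false; not)
  open import Data.Integer.Base using (+<+)
  open import Data.List.Base using (applyUpTo)
  open import Data.Nat.Base as ℕ using (ℕ; zero; suc)
  open import Data.Product.Base using (Σ-syntax; _×_; _,_)
  open import Data.Rational.Base as ℚ using (ℚ; 0ℚ; 1ℚ; ½)
  import Data.Rational.Properties as ℚ
  open import Function.Base using (_∘_)
  open import Relation.Binary.PropositionalEquality using (_≡_; refl; sym; trans; cong; subst)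

  open Defs.Polynomial (CommutativeRing.rawRing ℝ-ring) public using () renaming (eval to evalℝ)
  open Signed ℝ-ring

  seq-⊕⊖ : ∀ x y n → seq (x ⊕ ⊖ y) n ≡ seq x n ℚ.- seq y n
  seq-⊕⊖ x y n = trans (seq-⊕ x (⊖ y) n) (cong (seq x n ℚ.+_) (seq-⊖ y n))

  -- Coefficients are constant sequences, so evaluating at a real is evaluating a rational
  -- polynomial at each term.
  seq-evalℝ : ∀ c N x n → seq (evalℝ (applyUpTo (fromℕ ∘ c) N) x) n ≡ evalℚ (applyUpTo (ι ∘ c) N) (seq x n)
  seq-evalℝ c zero    x n = refl
  seq-evalℝ c (suc N) x n = trans (seq-⊕ _ _ n) (cong (ι (c 0) ℚ.+_)
    (trans (seq-⊗ x _ n) (cong (seq x n ℚ.*_) (seq-evalℝ (c ∘ suc) N x n))))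

  module _ (c : ℕ → ℕ) (N : ℕ) where
    private
      f : ℝ → ℝ
      f = evalℝ (applyUpTo (fromℕ ∘ c) N)
      g : ℚ → ℚ
      g = evalℚ (applyUpTo (ι ∘ c) N)

      seq-f : ∀ x n → seq (f x) n ≡ g (seq x n)
      seq-f = seq-evalℝ c N

      Pos-seq : ∀ {x} (s : ℕ → ℚ) → (∀ n → seq x n ≡ s n) → Pos x →
        Σ[ ε ∈ ℚ ] (0ℚ ℚ.< ε × Eventually (λ n → ε ℚ.< s n))
      Pos-seq s eq (mkPos ε ε>0 p) = ε , ε>0 , eventually-map (λ n → subst (ε ℚ.<_) (eq n)) p

      Root : ℝ → ℝ → Set
      Root lo hi = Σ[ u ∈ ℝ ] (Pos (hi ⊕ ⊖ u) × Pos (u ⊕ ⊖ lo) × f u ≃ 0ℝ)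

      -- `g′` is `g` or its negative, according to the direction of the sign change; for being a
      -- root only the absolute value matters.
      toRoot : ∀ {lo hi} g′ → (∀ q → ℚ.∣ g′ q ∣ ≡ ℚ.∣ g q ∣) → Crossing g′ lo hi → Root lo hi
      toRoot {lo} {hi} g′ same C = point
        , mkPos gap gap>0 (eventually-map (λ n → subst (gap ℚ.<_) (sym (seq-⊕⊖ hi point n))) upper)
        , mkPos gap gap>0 (eventually-map (λ n → subst (gap ℚ.<_) (sym (seq-⊕⊖ point lo n))) lower)
        , mk≃ (λ ε ε>0 → eventually-map (λ n → subst (ℚ._< ε)
            (trans (same (seq point n)) (cong ℚ.∣_∣ (trans (sym (seq-f point n)) (minus-0 (seq (f point) n)))))) (tends ε ε>0))
        where open Crossing C

      crossing′ : ∀ {lo hi} g′ → LocallyLipschitz g′ → (∀ q → ℚ.∣ g′ q ∣ ≡ ℚ.∣ g q ∣) →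
        Σ[ ε ∈ ℚ ] (0ℚ ℚ.< ε × Eventually (λ n → ε ℚ.< seq hi n ℚ.- seq lo n)) →
        Σ[ ε ∈ ℚ ] (0ℚ ℚ.< ε × Eventually (λ n → ε ℚ.< g′ (seq hi n))) →
        Σ[ ε ∈ ℚ ] (0ℚ ℚ.< ε × Eventually (λ n → ε ℚ.< ℚ.- g′ (seq lo n))) → Root lo hi
      crossing′ {lo} {hi} g′ lip same (_ , p₁ , e₁) (_ , p₂ , e₂) (_ , p₃ , e₃) =
        toRoot g′ same (crossing g′ lip lo hi p₁ p₂ p₃ e₁ e₂ e₃)

      neg-neg : ∀ q → q ≡ ℚ.- (ℚ.- q)
      neg-neg q = sym (⁻¹-involutive q)
        where open import Algebra.Properties.Group ℚ.+-0-group using (⁻¹-involutive)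

    intermediate-value : ∀ s {lo hi} → Pos (hi ⊕ ⊖ lo) → Pos (signed s (f hi)) → Pos (signed (not s) (f lo)) → Root lo hi
    intermediate-value true  {lo} {hi} gap p q = crossing′ g (evalℚ-lipschitz (applyUpTo (ι ∘ c) N)) (λ _ → refl)
      (Pos-seq _ (seq-⊕⊖ hi lo) gap)
      (Pos-seq _ (seq-f hi) p)
      (Pos-seq _ (λ n → trans (seq-⊖ (f lo) n) (cong ℚ.-_ (seq-f lo n))) q)
    intermediate-value false {lo} {hi} gap p q = crossing′ (λ u → ℚ.- g u)
      (neg-lipschitz {g} (evalℚ-lipschitz (applyUpTo (ι ∘ c) N))) (λ u → ℚ.∣-p∣≡∣p∣ (g u))
      (Pos-seq _ (seq-⊕⊖ hi lo) gap)
      (Pos-seq _ (λ n → trans (seq-⊖ (f hi) n) (cong ℚ.-_ (seq-f hi n))) p)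
      (Pos-seq _ (λ n → trans (seq-f lo n) (neg-neg (g (seq lo n)))) q)

  fromℕ-+ : ∀ m n → fromℕ (m ℕ.+ n) ≃ fromℕ m ⊕ fromℕ n
  fromℕ-+ m n = pointwise (λ k → trans (ι-+ m n) (sym (seq-⊕ (fromℕ m) (fromℕ n) k)))

  fromℕ-* : ∀ m n → fromℕ (m ℕ.* n) ≃ fromℕ m ⊗ fromℕ n
  fromℕ-* m n = pointwise (λ k → trans (ι-* m n) (sym (seq-⊗ (fromℕ m) (fromℕ n) k)))

  ½<1 : ½ ℚ.< 1ℚ
  ½<1 = ℚ.*<* (+<+ (ℕ.s≤s (ℕ.s≤s ℕ.z≤n)))

  ℝ-ordered : OrderedRing
  ℝ-ordered = record
    { ring        = ℝ-ring
    ; Pos         = Pos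
    ; Pos-resp    = Pos-resp
    ; Pos-1       = mkPos ½ (ℚ.positive⁻¹ ½) (0 , λ _ _ → ½<1)
    ; Pos-+       = Pos-+
    ; Pos-*       = Pos-*
    ; Pos-split   = Pos-split
    ; Pos-asym    = Pos-asym
    ; Pos-regular = Pos-regular
    ; ι           = fromℕ
    ; ι-0         = ≃-refl
    ; ι-1         = ≃-refl
    ; ι-+         = fromℕ-+
    ; ι-*         = fromℕ-*
    ; archimedean = archimedean
    ; ivt         = intermediate-value
    }

-- The complex numbers as a commutative ring.

module Complexes where

  open import Defs using (ℝ; seq; 0ℝ; 1ℝ; ℂ; _+i_; re; im; ofReal; 0ℂ; ℂ-rawRing)
  open Rationals
  open Reals
  open RealOrder
  open import Data.Integer.Base using (+_)
  open import Data.List.Base using (applyUpTo)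
  open import Data.Nat.Base using (ℕ; zero; suc)
  open import Data.Product.Base using (_,_)
  open import Data.Rational.Base as ℚ using (ℚ; 0ℚ)
  import Data.Rational.Properties as ℚ
  open import Data.Sum.Base using (_⊎_; inj₁; inj₂)
  open import Function.Base using (_∘_)
  open import Relation.Binary.PropositionalEquality using (refl; sym; trans; cong₂)

  open IntegerSolver ℝ-ring using (solve; _:=_; _:+_; _:*_; :-_; _:-_; con)

  infix 4 _≃ᶜ_
  record _≃ᶜ_ (z w : ℂ) : Set where
    constructor mk≃ᶜ
    field
      re≃ : re z ≃ re w
      im≃ : im z ≃ im w
  open _≃ᶜ_ public

  infixl 6 _⊞_
  infixl 7 _⊠_
  _⊞_ _⊠_ : ℂ → ℂ → ℂ
  z ⊞ w = (re z ⊕ re w) +i (im z ⊕ im w)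
  z ⊠ w = (re z ⊗ re w ⊕ ⊖ (im z ⊗ im w)) +i (re z ⊗ im w ⊕ im z ⊗ re w)

  ⊟_ : ℂ → ℂ
  ⊟ z = (⊖ re z) +i (⊖ im z)

  private
    module R = CommutativeRing ℝ-ring

  ≃ᶜ-refl : ∀ {z} → z ≃ᶜ z
  ≃ᶜ-refl = mk≃ᶜ ≃-refl ≃-refl

  ≃ᶜ-sym : ∀ {z w} → z ≃ᶜ w → w ≃ᶜ z
  ≃ᶜ-sym (mk≃ᶜ p q) = mk≃ᶜ (≃-sym p) (≃-sym q)

  ≃ᶜ-trans : ∀ {z w v} → z ≃ᶜ w → w ≃ᶜ v → z ≃ᶜ v
  ≃ᶜ-trans (mk≃ᶜ p q) (mk≃ᶜ r s) = mk≃ᶜ (≃-trans p r) (≃-trans q s)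

  ⊠-comm : ∀ z w → z ⊠ w ≃ᶜ w ⊠ z
  ⊠-comm (a +i b) (c +i d) = mk≃ᶜ
    (solve 4 (λ a b c d → a :* c :- b :* d := c :* a :- d :* b) ≃-refl a b c d)
    (solve 4 (λ a b c d → a :* d :+ b :* c := c :* b :+ d :* a) ≃-refl a b c d)

  ⊠-distribˡ : ∀ z w v → z ⊠ (w ⊞ v) ≃ᶜ z ⊠ w ⊞ z ⊠ v
  ⊠-distribˡ (a +i b) (c +i d) (e +i f) = mk≃ᶜ
    (solve 6 (λ a b c d e f → a :* (c :+ e) :- b :* (d :+ f) := (a :* c :- b :* d) :+ (a :* e :- b :* f)) ≃-refl a b c d e f)
    (solve 6 (λ a b c d e f → a :* (d :+ f) :+ b :* (c :+ e) := (a :* d :+ b :* c) :+ (a :* f :+ b :* e)) ≃-refl a b c d e f)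

  ⊠-assoc : ∀ z w v → (z ⊠ w) ⊠ v ≃ᶜ z ⊠ (w ⊠ v)
  ⊠-assoc (a +i b) (c +i d) (e +i f) = mk≃ᶜ
    (solve 6 (λ a b c d e f → (a :* c :- b :* d) :* e :- (a :* d :+ b :* c) :* f
      := a :* (c :* e :- d :* f) :- b :* (c :* f :+ d :* e)) ≃-refl a b c d e f)
    (solve 6 (λ a b c d e f → (a :* c :- b :* d) :* f :+ (a :* d :+ b :* c) :* e
      := a :* (c :* f :+ d :* e) :+ b :* (c :* e :- d :* f)) ≃-refl a b c d e f)

  ⊠-identityˡ : ∀ z → ofReal 1ℝ ⊠ z ≃ᶜ z
  ⊠-identityˡ (a +i b) = mk≃ᶜ
    (solve 2 (λ a b → con (+ 1) :* a :- con (+ 0) :* b := a) ≃-refl a b)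
    (solve 2 (λ a b → con (+ 1) :* b :+ con (+ 0) :* a := b) ≃-refl a b)

  ⊞-comm : ∀ z w → z ⊞ w ≃ᶜ w ⊞ z
  ⊞-comm z w = mk≃ᶜ (⊕-comm (re z) (re w)) (⊕-comm (im z) (im w))

  ⊞-identityˡ : ∀ z → 0ℂ ⊞ z ≃ᶜ z
  ⊞-identityˡ z = mk≃ᶜ (⊕-identityˡ (re z)) (⊕-identityˡ (im z))

  ⊞-inverseˡ : ∀ z → (⊟ z) ⊞ z ≃ᶜ 0ℂ
  ⊞-inverseˡ z = mk≃ᶜ (⊕-inverseˡ (re z)) (⊕-inverseˡ (im z))

  ⊞-cong : ∀ {z w u v} → z ≃ᶜ w → u ≃ᶜ v → z ⊞ u ≃ᶜ w ⊞ v
  ⊞-cong (mk≃ᶜ p q) (mk≃ᶜ r s) = mk≃ᶜ (⊕-cong p r) (⊕-cong q s)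

  ⊠-cong : ∀ {z w u v} → z ≃ᶜ w → u ≃ᶜ v → z ⊠ u ≃ᶜ w ⊠ v
  ⊠-cong (mk≃ᶜ p q) (mk≃ᶜ r s) = mk≃ᶜ (⊕-cong (⊗-cong p r) (⊖-cong (⊗-cong q s))) (⊕-cong (⊗-cong p s) (⊗-cong q r))

  ℂ-ring : CommutativeRing 0ℓ 0ℓ
  ℂ-ring = record
    { Carrier = ℂ ; _≈_ = _≃ᶜ_ ; _+_ = _⊞_ ; _*_ = _⊠_ ; -_ = ⊟_ ; 0# = 0ℂ ; 1# = ofReal 1ℝ
    ; isCommutativeRing = record
      { isRing = record
        { +-isAbelianGroup = record
          { isGroup = record
            { isMonoid = record
              { isSemigroup = record
                { isMagma = record
                  { isEquivalence = record { refl = ≃ᶜ-refl ; sym = ≃ᶜ-sym ; trans = ≃ᶜ-trans }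
                  ; ∙-cong = ⊞-cong }
                ; assoc = λ z w v → mk≃ᶜ (⊕-assoc (re z) (re w) (re v)) (⊕-assoc (im z) (im w) (im v)) }
              ; identity = ⊞-identityˡ , λ z → ≃ᶜ-trans (⊞-comm z 0ℂ) (⊞-identityˡ z) }
            ; inverse = ⊞-inverseˡ , λ z → ≃ᶜ-trans (⊞-comm z (⊟ z)) (⊞-inverseˡ z)
            ; ⁻¹-cong = λ (mk≃ᶜ p q) → mk≃ᶜ (⊖-cong p) (⊖-cong q) }
          ; comm = ⊞-comm }
        ; *-cong = ⊠-cong
        ; *-assoc = ⊠-assoc
        ; *-identity = ⊠-identityˡ , λ z → ≃ᶜ-trans (⊠-comm z (ofReal 1ℝ)) (⊠-identityˡ z)
        ; distrib = ⊠-distribˡ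
                  , λ z w v → ≃ᶜ-trans (⊠-comm (w ⊞ v) z) (≃ᶜ-trans (⊠-distribˡ z w v) (⊞-cong (⊠-comm z w) (⊠-comm z v))) }
      ; *-comm = ⊠-comm } }

  opaque
    unfolding _⊕_ _⊗_

    -- Squares are nonnegative term by term, so the sign of the real y need not be known.
    Pos-+square : ∀ {x} y → Pos x → Pos (x ⊕ y ⊗ y)
    Pos-+square {x} y (mkPos ε ε>0 p) = mkPos ε ε>0 (eventually-map
      (λ n ε<x → ℚ.<-≤-trans ε<x (0≤diff⇒≤ (square≥0 (seq y n)) (sym (add-sub (seq x n) (seq y n ℚ.* seq y n))))) p)
      where
      square≥0 : ∀ q → 0ℚ ℚ.≤ q ℚ.* q
      square≥0 q with ℚ.≤-total 0ℚ q
      ... | inj₁ 0≤q = 0≤* 0≤q 0≤q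
      ... | inj₂ q≤0 = ℚ.nonNegative⁻¹ (q ℚ.* q) {{ℚ.nonPos*nonPos⇒nonPos q {{ℚ.nonPositive q≤0}} q {{ℚ.nonPositive q≤0}}}}

  private
    module C where
      open CommutativeRing ℂ-ring public
      open Factorisation ℂ-ring public
      open Defs.Polynomial rawRing public

  -- Multiplying by the conjugate turns wv = 0 into |w|² v = 0 in each coordinate, and |w|² is
  -- positive.
  Pos⇒regular : ∀ w → Pos (re w) ⊎ Pos (⊖ re w) → C.Regular w
  Pos⇒regular (a +i b) p (c +i d) (mk≃ᶜ h k) = mk≃ᶜ
    (Pos-regular norm>0 c (begin
      (a ⊗ a ⊕ b ⊗ b) ⊗ c
        ≈⟨ solve 4 (λ a b c d → (a :* a :+ b :* b) :* c := a :* (a :* c :- b :* d) :+ b :* (a :* d :+ b :* c)) ≃-refl a b c d ⟩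
      a ⊗ (a ⊗ c ⊕ ⊖ (b ⊗ d)) ⊕ b ⊗ (a ⊗ d ⊕ b ⊗ c)
        ≈⟨ ⊕-cong (⊗-cong ≃-refl h) (⊗-cong ≃-refl k) ⟩
      a ⊗ 0ℝ ⊕ b ⊗ 0ℝ
        ≈⟨ solve 2 (λ a b → a :* con (+ 0) :+ b :* con (+ 0) := con (+ 0)) ≃-refl a b ⟩
      0ℝ ∎))
    (Pos-regular norm>0 d (begin
      (a ⊗ a ⊕ b ⊗ b) ⊗ d
        ≈⟨ solve 4 (λ a b c d → (a :* a :+ b :* b) :* d := a :* (a :* d :+ b :* c) :- b :* (a :* c :- b :* d)) ≃-refl a b c d ⟩
      a ⊗ (a ⊗ d ⊕ b ⊗ c) ⊕ ⊖ (b ⊗ (a ⊗ c ⊕ ⊖ (b ⊗ d)))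
        ≈⟨ ⊕-cong (⊗-cong ≃-refl k) (⊖-cong (⊗-cong ≃-refl h)) ⟩
      a ⊗ 0ℝ ⊕ ⊖ (b ⊗ 0ℝ)
        ≈⟨ solve 2 (λ a b → a :* con (+ 0) :- b :* con (+ 0) := con (+ 0)) ≃-refl a b ⟩
      0ℝ ∎))
    where
    open import Relation.Binary.Reasoning.Setoid R.setoid
    square>0 : Pos a ⊎ Pos (⊖ a) → Pos (a ⊗ a)
    square>0 (inj₁ q) = Pos-* q q
    square>0 (inj₂ q) = Pos-resp (solve 1 (λ a → (:- a) :* (:- a) := a :* a) ≃-refl a) (Pos-* q q)
    norm>0 : Pos (a ⊗ a ⊕ b ⊗ b)
    norm>0 = Pos-+square b (square>0 p)

  ofReal-⊞ : ∀ x y → ofReal x ⊞ ofReal y ≃ᶜ ofReal (x ⊕ y)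
  ofReal-⊞ x y = mk≃ᶜ ≃-refl (⊕-identityˡ 0ℝ)

  ofReal-⊠ : ∀ x y → ofReal x ⊠ ofReal y ≃ᶜ ofReal (x ⊗ y)
  ofReal-⊠ x y = mk≃ᶜ (solve 2 (λ x y → x :* y :- con (+ 0) :* con (+ 0) := x :* y) ≃-refl x y)
    (solve 2 (λ x y → x :* con (+ 0) :+ con (+ 0) :* y := con (+ 0)) ≃-refl x y)

  open Factorisation ℝ-ring using () renaming (deval to devalℝ)

  private
    ofReal-horner : ∀ z x e w y → z ≃ᶜ ofReal x → e ≃ᶜ ofReal y → z ⊞ ofReal w ⊠ e ≃ᶜ ofReal (x ⊕ w ⊗ y)
    ofReal-horner z x e w y p q = ≃ᶜ-trans {z ⊞ ofReal w ⊠ e} {ofReal x ⊞ ofReal (w ⊗ y)} {ofReal (x ⊕ w ⊗ y)}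
      (⊞-cong {z} {ofReal x} {ofReal w ⊠ e} {ofReal (w ⊗ y)} p
        (≃ᶜ-trans {ofReal w ⊠ e} {ofReal w ⊠ ofReal y} {ofReal (w ⊗ y)}
          (⊠-cong {ofReal w} {ofReal w} {e} {ofReal y} (≃ᶜ-refl {ofReal w}) q) (ofReal-⊠ w y)))
      (ofReal-⊞ x (w ⊗ y))

  evalC-ofReal : ∀ (f : ℕ → ℝ) N x → C.eval (applyUpTo (ofReal ∘ f) N) (ofReal x) ≃ᶜ ofReal (evalℝ (applyUpTo f N) x)
  evalC-ofReal f zero    x = ≃ᶜ-refl
  evalC-ofReal f (suc N) x = ofReal-horner (ofReal (f 0)) (f 0) (C.eval (applyUpTo (ofReal ∘ f ∘ suc) N) (ofReal x)) x
    (evalℝ (applyUpTo (f ∘ suc) N) x) ≃ᶜ-refl (evalC-ofReal (f ∘ suc) N x)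

  devalC-ofReal : ∀ (f : ℕ → ℝ) N x → C.deval (applyUpTo (ofReal ∘ f) N) (ofReal x) ≃ᶜ ofReal (devalℝ (applyUpTo f N) x)
  devalC-ofReal f zero    x = ≃ᶜ-refl
  devalC-ofReal f (suc N) x = ofReal-horner (C.eval (applyUpTo (ofReal ∘ f ∘ suc) N) (ofReal x)) (evalℝ (applyUpTo (f ∘ suc) N) x)
    (C.deval (applyUpTo (ofReal ∘ f ∘ suc) N) (ofReal x)) x (devalℝ (applyUpTo (f ∘ suc) N) x)
    (evalC-ofReal (f ∘ suc) N x) (devalC-ofReal (f ∘ suc) N x)

  +ᶜ≃⊞ : ∀ z w → RawRing._+_ ℂ-rawRing z w ≃ᶜ z ⊞ w
  +ᶜ≃⊞ (a +i b) (c +i d) = mk≃ᶜ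
    (pointwise {a Defs.+ c} {a ⊕ c} (λ n → sym (seq-⊕ a c n)))
    (pointwise {b Defs.+ d} {b ⊕ d} (λ n → sym (seq-⊕ b d n)))

  *ᶜ≃⊠ : ∀ z w → RawRing._*_ ℂ-rawRing z w ≃ᶜ z ⊠ w
  *ᶜ≃⊠ (a +i b) (c +i d) = mk≃ᶜ
    (pointwise {a Defs.* c Defs.- b Defs.* d} {a ⊗ c ⊕ ⊖ (b ⊗ d)}
      (λ n → sym (trans (seq-⊕⊖ (a ⊗ c) (b ⊗ d) n) (cong₂ ℚ._-_ (seq-⊗ a c n) (seq-⊗ b d n)))))
    (pointwise {a Defs.* d Defs.+ b Defs.* c} {a ⊗ d ⊕ b ⊗ c}
      (λ n → sym (trans (seq-⊕ (a ⊗ d) (b ⊗ c) n) (cong₂ ℚ._+_ (seq-⊗ a d n) (seq-⊗ b c n)))))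

  -ᶜ≃⊟ : ∀ z → RawRing.-_ ℂ-rawRing z ≃ᶜ ⊟ z
  -ᶜ≃⊟ (a +i b) = mk≃ᶜ
    (pointwise {Defs.- a} {⊖ a} (λ n → sym (seq-⊖ a n)))
    (pointwise {Defs.- b} {⊖ b} (λ n → sym (seq-⊖ b n)))

-- The complex roots of Dₙ and their interlacing.

open import Defs
open import Data.List.Base using (List; []; _∷_; length; map; applyUpTo)
open import Data.List.Relation.Unary.Linked as Linked using (Linked; []; [-]; _∷_)
open import Data.Nat.Base as ℕ using (ℕ; zero; suc; ⌊_/2⌋; pred)
open import Data.Product.Base using (Σ-syntax; _×_; _,_; proj₁; proj₂)
open import Relation.Binary.PropositionalEquality as ≡ using (_≡_)

open import Data.Bool.Base using (true; false)
open import Data.Empty using (⊥-elim)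
import Data.List.Properties as List
open import Data.List.Relation.Binary.Pointwise as Pointwise using (Pointwise; []; _∷_)
open import Data.List.Relation.Unary.All as All using (All; []; _∷_)
import Data.List.Relation.Unary.All.Properties as All
open import Data.List.Relation.Unary.AllPairs as AllPairs using (AllPairs; []; _∷_)
import Data.List.Relation.Unary.AllPairs.Properties as AllPairs
open import Data.List.Relation.Unary.Any as Any using (Any; here; there)
import Data.List.Relation.Unary.Any.Properties as Any
open import Data.List.Relation.Unary.Linked.Properties using (Linked⇒AllPairs; AllPairs⇒Linked)
open import Data.Integer.Base using (+_)
import Data.Nat.Properties as ℕ
import Data.Rational.Base as ℚ
open import Data.Sum.Base using (_⊎_; inj₁; inj₂)
open import Function.Base using (_∘_)
open import Relation.Nullary using (¬_)

open Counting
open Ordered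
open Rationals using (0<diff⇒<; <⇒0<diff; hi-mid)
open Reals
open RealOrder
open Complexes

open OrderedRing ℝ-ordered using (_≻_; signed)
open Interlacing ℝ-ordered
open IntegerSolver ℝ-ring using (solve; _:=_; _:+_; _:*_; :-_; _:-_; con)

private
  module C where
    open CommutativeRing ℂ-ring public
    open Factorisation ℂ-ring public
    open Defs.Polynomial rawRing public using () renaming (eval to evalᶜ)
  open Transfer ℂ-rawRing _≃ᶜ_ _⊞_ _⊠_ ⊟_ (CommutativeRing.isCommutativeRing ℂ-ring) +ᶜ≃⊞ *ᶜ≃⊠ -ᶜ≃⊟

≻⇒> : ∀ {x y} → x ≻ y → x > y
≻⇒> {x} {y} (mkPos ε ε>0 p) = ε , ε>0 , eventually-map (λ n ε<d → 0<diff⇒<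
  (<⇒0<diff (≡.subst (ε ℚ.<_) (seq-⊕⊖ x y n) ε<d)) (hi-mid (seq y n) (seq x n) ε)) p

>⇒≻ : ∀ {x y} → x > y → x ≻ y
>⇒≻ {x} {y} (ε , ε>0 , p) = mkPos ε ε>0 (eventually-map (λ n h → ≡.subst (ε ℚ.<_) (≡.sym (seq-⊕⊖ x y n))
  (0<diff⇒< (<⇒0<diff h) (≡.sym (hi-mid (seq y n) (seq x n) ε)))) p)

toC : ∀ {z w} → z ≈ᶜ w → z ≃ᶜ w
toC (p , q) = mk≃ᶜ (mk≃ p) (mk≃ q)

fromC : ∀ {z w} → z ≃ᶜ w → z ≈ᶜ w
fromC e = un≃ (re≃ e) , un≃ (im≃ e)

≻-irrefl : ∀ {x y} → x ≃ y → ¬ (x ≻ y)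
≻-irrefl {x} {y} x≃y p = Pos-asym p (Pos-resp (≃-trans (⊕-cong x≃y (⊖-cong (≃-sym x≃y)))
  (solve 2 (λ x y → y :- x := :- (x :- y)) ≃-refl x y)) p)

≻-asym : ∀ {x y} → x ≻ y → ¬ (y ≻ x)
≻-asym {x} {y} p q = Pos-asym p (Pos-resp (solve 2 (λ x y → y :- x := :- (x :- y)) ≃-refl x y) q)

≻-resp : ∀ {x x′ y y′} → x ≃ x′ → y ≃ y′ → x ≻ y → x′ ≻ y′
≻-resp p q = Pos-resp (⊕-cong p (⊖-cong q))

-- If neither head matched the other, each would lie in the other list's tail and so be smaller than
-- the other. Once the heads agree, strict order keeps later entries from matching the head.
sorted-unique : ∀ {as bs} → AllPairs _≻_ as → AllPairs _≻_ bs →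
  All (λ a → Any (a ≃_) bs) as → All (λ b → Any (b ≃_) as) bs → Pointwise _≃_ as bs
sorted-unique []         []         []         []         = []
sorted-unique []         (_ ∷ _)    []         (() ∷ _)
sorted-unique (_ ∷ _)    []         (() ∷ _)   []
sorted-unique {a ∷ as} {b ∷ bs} (a≻ ∷ as≻) (b≻ ∷ bs≻) (a∈ ∷ as∈) (b∈ ∷ bs∈) =
  a≃b ∷ sorted-unique as≻ bs≻ (All.zipWith (λ (a≻a′ , i) → in-tail (≃-sym a≃b) a≻a′ i) (a≻ , as∈))
                              (All.zipWith (λ (b≻b′ , i) → in-tail a≃b b≻b′ i) (b≻ , bs∈))
  where
  below : ∀ {x y ys} → All (y ≻_) ys → Any (x ≃_) ys → y ≻ x
  below {x} {y} y≻ i with All.lookupAny y≻ i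
  ... | y≻z , x≃z = ≻-resp {y} {y} ≃-refl (≃-sym x≃z) y≻z
  heads : Any (a ≃_) (b ∷ bs) → Any (b ≃_) (a ∷ as) → a ≃ b
  heads (here e)  _         = e
  heads (there i) (here e)  = ≃-sym e
  heads (there i) (there j) = ⊥-elim (≻-asym {b} {a} (below b≻ i) (below a≻ j))
  a≃b : a ≃ b
  a≃b = heads a∈ b∈
  in-tail : ∀ {x y y′ ys} → y ≃ x → x ≻ y′ → Any (y′ ≃_) (y ∷ ys) → Any (y′ ≃_) ys
  in-tail y≃x x≻y′ (here e)  = ⊥-elim (≻-irrefl (≃-sym (≃-trans e y≃x)) x≻y′)
  in-tail y≃x x≻y′ (there i) = i

interleave-pointwise : ∀ {as bs as′ bs′} → Pointwise _≃_ as as′ → Pointwise _≃_ bs bs′ →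
  Pointwise _≃_ (interleave as bs) (interleave as′ bs′)
interleave-pointwise []       fs = fs
interleave-pointwise (e ∷ es) fs = e ∷ interleave-pointwise fs es

linked-resp : ∀ {as bs} → Pointwise _≃_ as bs → Linked _≻_ as → Linked _≻_ bs
linked-resp []           []       = []
linked-resp (e ∷ [])     [-]      = [-]
linked-resp (e ∷ f ∷ es) (p ∷ ps) = ≻-resp e f p ∷ linked-resp (f ∷ es) ps

sorted⇒pairs : ∀ {xs} → Linked _>_ xs → AllPairs _≻_ xs
sorted⇒pairs l = Linked⇒AllPairs (λ {x} {y} {z} → ≻-trans {x} {y} {z}) (Linked.map >⇒≻ l)

alternating-nonzero : ∀ {f s xs} → Alternating f s xs → All (λ x → Pos (f x) ⊎ Pos (⊖ f x)) xs
alternating-nonzero []       = []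
alternating-nonzero {s = s} (p ∷ ps) = sign s p ∷ alternating-nonzero ps
  where
  sign : ∀ s {x} → Pos (signed s x) → Pos x ⊎ Pos (⊖ x)
  sign true  p = inj₁ p
  sign false p = inj₂ p


coefficients : ℕ → ℕ → ℕ
coefficients n zero    = 0
coefficients n (suc k) = stirling (suc k) n

DCoeff≡coefficients : ∀ n k → DCoeff n k ≡ coefficients n k
DCoeff≡coefficients n zero    = ≡.refl
DCoeff≡coefficients n (suc k) = DCoeff-suc n k

applyUpTo-cong : ∀ {A : Set} {f g : ℕ → A} → (∀ k → f k ≡ g k) → ∀ N → applyUpTo f N ≡ applyUpTo g N
applyUpTo-cong eq zero    = ≡.refl
applyUpTo-cong eq (suc N) = ≡.cong₂ _∷_ (eq 0) (applyUpTo-cong (eq ∘ suc) N)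

DPoly≡ : ∀ n → DPoly n ≡ applyUpTo (ofReal ∘ fromℕ ∘ coefficients n) (suc n)
DPoly≡ n = ≡.trans (List.map-upTo (λ k → ofReal (fromℕ (DCoeff n k))) (suc n))
  (applyUpTo-cong (λ k → ≡.cong (ofReal ∘ fromℕ) (DCoeff≡coefficients n k)) (suc n))

≻⇒regularᶜ : ∀ z s → re z ≻ s → C.Regular (z C.- ofReal s)
≻⇒regularᶜ z s p = Pos⇒regular (z C.- ofReal s) (inj₁ p)

≺⇒regularᶜ : ∀ z s → s ≻ re z → C.Regular (z C.- ofReal s)
≺⇒regularᶜ z s p = Pos⇒regular (z C.- ofReal s) (inj₂ (Pos-resp
  (solve 2 (λ s z → s :- z := :- (z :- s)) ≃-refl s (re z)) p))

-- Since r - s = (r - re z) + (re z - s), one summand is positive. Above s, z is off every remaining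
-- root; the last root calls for no choice.
separated : ∀ z r rs → AllPairs _≻_ (r ∷ rs) → C.Separated z (map ofReal (r ∷ rs))
separated z r []       _ = C.off-tail []
separated z r (s ∷ rs) ((r≻s ∷ _) ∷ ps@(s≻ ∷ _)) = decide (Pos-split (Pos-resp
    (solve 3 (λ r s z → r :- s := (r :- z) :+ (z :- s)) ≃-refl r s (re z)) r≻s))
  where
  decide : r ≻ re z ⊎ re z ≻ s → C.Separated z (map ofReal (r ∷ s ∷ rs))
  decide (inj₁ r≻z) = C.off-head (≺⇒regularᶜ z r r≻z) (separated z s rs ps)
  decide (inj₂ z≻s) = C.off-tail (≻⇒regularᶜ z s z≻s ∷
    All.map⁺ (All.map (λ {t} s≻t → ≻⇒regularᶜ z t (≻-trans {re z} {s} {t} z≻s s≻t)) s≻))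

module RootsOf (m : ℕ) (rs : List ℝ) (len : length rs ≡ ⌊ m /2⌋)
  (factors : PosSplit (quotient (suc (suc m))) rs) (sorted : AllPairs _≻_ (0ℝ ∷ rs)) where

  private
    n h : ℕ
    n = suc (suc m)
    h = suc ⌊ m /2⌋
    c : ℕ → ℝ
    c = fromℕ ∘ coefficients n
    real : List ℝ
    real = applyUpTo c (suc h)
    -- `padded` is `DPoly n` with its trailing zeros; `trimmed` stops at the leading coefficient, as
    -- factoring requires.
    trimmed padded : List ℂ
    trimmed = applyUpTo (ofReal ∘ c) (suc h)
    padded  = applyUpTo (ofReal ∘ c) (suc n)

    -- Dₙ(x) = x Eₙ(x): the root 0 is put in front of those of the quotient.
    real-split : PosSplit real (0ℝ ∷ rs)
    real-split = step
      (λ x → solve 2 (λ x e → con (+ 0) :+ x :* e := (x :- con (+ 0)) :* e) ≃-refl x (evalℝ (quotient n) x))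
      (λ x → solve 3 (λ x e d → e :+ x :* d := e :+ (x :- con (+ 0)) :* d) ≃-refl x (evalℝ (quotient n) x) (deval (quotient n) x))
      factors

    real-roots : All (λ r → evalℝ real r ≃ 0ℝ) (0ℝ ∷ rs)
    real-roots = split-roots Pos Pos-resp real-split

    -- An alternating derivative has a strict sign at every root; simplicity of the roots rests on
    -- this.
    derivative-nonzero : All (λ r → Pos (deval real r) ⊎ Pos (⊖ deval real r)) (0ℝ ∷ rs)
    derivative-nonzero = alternating-nonzero (alternating-deval real-split sorted)

    vanishes : ∀ k → suc h ℕ.≤ k → ofReal (c k) ≃ᶜ 0ℂ
    vanishes (suc k) (ℕ.s≤s p) = mk≃ᶜ (coefficient-vanishes n k p) ≃-refl

    h≤n : suc h ℕ.≤ suc n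
    h≤n = ℕ.s≤s (ℕ.⌊n/2⌋≤n n)

    trimmed-roots : All (λ r → C.evalᶜ trimmed (ofReal r) ≃ᶜ 0ℂ) (0ℝ ∷ rs)
    trimmed-roots = All.map (λ {r} root → ≃ᶜ-trans (evalC-ofReal c (suc h) r) (mk≃ᶜ root ≃-refl)) real-roots

    trimmed-split : C.Split C.Regular C.Regular-resp trimmed (map ofReal (0ℝ ∷ rs))
    trimmed-split = C.split C.Regular C.Regular-resp trimmed (map ofReal (0ℝ ∷ rs))
      (≡.trans (List.length-applyUpTo (ofReal ∘ c) (suc h))
        (≡.cong suc (≡.trans (≡.cong suc (≡.sym len)) (≡.sym (List.length-map ofReal (0ℝ ∷ rs))))))
      (C.Lead-applyUpTo C.Regular C.Regular-resp (ofReal ∘ c) h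
        (Pos⇒regular (ofReal (c h)) (inj₁ (Pos-ι′ (stirling-half-positive m)))))
      (All.map⁺ trimmed-roots)
      (AllPairs.map⁺ (AllPairs.map (λ {r} {s} r≻s → ≺⇒regularᶜ (ofReal s) r r≻s) sorted))

    IsRoot⇒ : ∀ z → IsRoot (DPoly n) z → C.evalᶜ padded z ≃ᶜ 0ℂ
    IsRoot⇒ z root = ≃ᶜ-trans (≃ᶜ-sym (eval-transfer padded z))
      (toC (≡.subst (λ p → IsRoot p z) (DPoly≡ n) root))

    ⇒IsRoot : ∀ z → C.evalᶜ padded z ≃ᶜ 0ℂ → IsRoot (DPoly n) z
    ⇒IsRoot z root = ≡.subst (λ p → IsRoot p z) (≡.sym (DPoly≡ n))
      (fromC (≃ᶜ-trans (eval-transfer padded z) root))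

    complete : ∀ z → IsRoot (DPoly n) z → Any (λ r → z ≃ᶜ ofReal r) (0ℝ ∷ rs)
    complete z root = Any.map⁻ (C.split-complete trimmed-split (separated z 0ℝ rs sorted)
      (≃ᶜ-trans (≃ᶜ-sym (C.eval-pad h≤n vanishes z)) (IsRoot⇒ z root)))

    nonpositive : All (λ r → ¬ Pos r) (0ℝ ∷ rs)
    nonpositive = (λ p → Pos-asym p (Pos-resp (solve 0 (con (+ 0) := :- con (+ 0)) ≃-refl) p))
      ∷ All.map (λ {r} 0≻r p → Pos-asym p (Pos-resp (⊕-identityˡ (⊖ r)) 0≻r)) (AllPairs.head sorted)

  areRoots : AreRootsOf (0ℝ ∷ rs) (DPoly n)
  areRoots = Linked.map ≻⇒> (AllPairs⇒Linked sorted)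
    , All.map (λ {r} root → ⇒IsRoot (ofReal r) (≃ᶜ-trans (C.eval-pad h≤n vanishes (ofReal r)) root)) trimmed-roots
    , λ z root → Any.map fromC (complete z root)

  private
    tail : List ℂ
    tail = applyUpTo (ofReal ∘ c ∘ suc) n

    divisible : ∀ z → IsRoot (DPoly n) z → DPoly n ≈ₚ (X- z) *ₚ C.horner tail z
    divisible z root = ≡.subst (λ p → p ≈ₚ (X- z) *ₚ C.horner tail z) (≡.sym (DPoly≡ n))
      (λ k → fromC {coeff padded k} {coeff ((X- z) *ₚ C.horner tail z) k} (divisible-transfer padded z (C.horner tail z)
        (C.root⇒divisible (ofReal (c 0)) tail z (IsRoot⇒ z root)) k))

    -- The cofactor is divided out at z itself, as `IsSimpleRoot` demands. Its value there is the
    -- derivative at z, which is then carried over to the real root r.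
    value : ∀ z r → z ≃ᶜ ofReal r → eval (C.horner tail z) z ≃ᶜ ofReal (deval real r)
    value z r z≃r = ≃ᶜ-trans (eval-transfer (C.horner tail z) z)
      (≃ᶜ-trans (C.eval-horner-self (ofReal (c 0)) tail z)
      (≃ᶜ-trans (C.deval-cong padded z≃r)
      (≃ᶜ-trans (C.deval-pad h≤n vanishes (ofReal r)) (devalC-ofReal c (suc h) r))))

    nonzero : ∀ {x d} → x ≃ d → Pos d ⊎ Pos (⊖ d) → x # 0ℝ
    nonzero {x} {d} x≃d (inj₁ p) = inj₂ (≻⇒> {x} {0ℝ} (Pos-resp
      (≃-trans (solve 1 (λ d → d := d :- con (+ 0)) ≃-refl d) (⊕-cong (≃-sym x≃d) ≃-refl)) p))
    nonzero {x} {d} x≃d (inj₂ p) = inj₁ (≻⇒> {0ℝ} {x} (Pos-resp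
      (≃-trans (solve 1 (λ d → :- d := con (+ 0) :- d) ≃-refl d) (⊕-cong ≃-refl (⊖-cong (≃-sym x≃d)))) p))

    re≤0 : ∀ {x r} → x ≃ r → ¬ Pos r → x ≤ 0ℝ
    re≤0 {x} {r} x≃r ¬r>0 0<x = ¬r>0 (Pos-resp (≃-trans (⊕-cong x≃r ≃-refl)
      (solve 1 (λ r → r :- con (+ 0) := r) ≃-refl r)) (>⇒≻ {x} {0ℝ} 0<x))

    simple-at : ∀ z r → IsRoot (DPoly n) z → ¬ Pos r → Pos (deval real r) ⊎ Pos (⊖ deval real r) → z ≃ᶜ ofReal r →
      im z ≈ 0ℝ × re z ≤ 0ℝ × IsSimpleRoot (DPoly n) z
    simple-at z r root ¬r>0 d≠0 z≃r = un≃ (im≃ z≃r) , re≤0 (re≃ z≃r) ¬r>0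
      , C.horner tail z , divisible z root , inj₁ (nonzero (re≃ (value z r z≃r)) d≠0)

  realSimple : ∀ z → IsRoot (DPoly n) z → im z ≈ 0ℝ × re z ≤ 0ℝ × IsSimpleRoot (DPoly n) z
  realSimple z root = at (complete z root) (All.lookupAny (All.zip (nonpositive , derivative-nonzero)) (complete z root))
    where
    at : (i : Any (λ r → z ≃ᶜ ofReal r) (0ℝ ∷ rs)) →
      (¬ Pos (Any.lookup i) × (Pos (deval real (Any.lookup i)) ⊎ Pos (⊖ deval real (Any.lookup i)))) × z ≃ᶜ ofReal (Any.lookup i) →
      im z ≈ 0ℝ × re z ≤ 0ℝ × IsSimpleRoot (DPoly n) z
    at i ((¬r>0 , d≠0) , z≃r) = simple-at z (Any.lookup i) root ¬r>0 d≠0 z≃r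

-- Each list is complete, so it contains the entries of the other up to equality, and both are
-- sorted.
roots-unique : ∀ {as bs} p → AreRootsOf as p → AreRootsOf bs p → Pointwise _≃_ as bs
roots-unique p (la , ra , ca) (lb , rb , cb) = sorted-unique (sorted⇒pairs la) (sorted⇒pairs lb)
  (All.map (λ {a} root → Any.map (mk≃ ∘ proj₁) (cb (ofReal a) root)) ra)
  (All.map (λ {b} root → Any.map (mk≃ ∘ proj₁) (ca (ofReal b) root)) rb)

module _ (m : ℕ) where
  open Interlaced (interlaced m)

  private
    pairs : AllPairs _≻_ (0ℝ ∷ interleave xs ys)
    pairs = Linked⇒AllPairs (λ {x} {y} {z} → ≻-trans {x} {y} {z}) sorted

  module UpperRoots = RootsOf (suc m) xs len-xs splitx
    (proj₁ (all-interleave⁻ xs ys (AllPairs.head pairs)) ∷ proj₁ (allPairs-interleave⁻ xs ys (AllPairs.tail pairs)))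

  module LowerRoots = RootsOf m ys len-ys splity
    (proj₂ (all-interleave⁻ xs ys (AllPairs.head pairs)) ∷ proj₂ (allPairs-interleave⁻ xs ys (AllPairs.tail pairs)))

  roots-interlace : ∀ us vs → AreRootsOf (0ℝ ∷ us) (DPoly (suc (suc (suc m)))) →
    AreRootsOf (0ℝ ∷ vs) (DPoly (suc (suc m))) → Linked _>_ (0ℝ ∷ interleave us vs)
  roots-interlace us vs rus rvs = Linked.map ≻⇒> (linked-resp
    (≃-refl ∷ interleave-pointwise
      (Pointwise.tail (roots-unique (DPoly (suc (suc (suc m)))) UpperRoots.areRoots rus))
      (Pointwise.tail (roots-unique (DPoly (suc (suc m))) LowerRoots.areRoots rvs)))
    sorted)

theorem1 : (n : ℕ) → 2 ℕ.≤ n →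
    HasDegree (DCoeff n) ⌊ n /2⌋
    × (∀ z → IsRoot (DPoly n) z → im z ≈ 0ℝ × re z ≤ 0ℝ × IsSimpleRoot (DPoly n) z)
    × (Σ[ xs ∈ List ℝ ] (length (0ℝ ∷ xs) ≡ ⌊ n /2⌋ × AreRootsOf (0ℝ ∷ xs) (DPoly n)))
    × (3 ℕ.≤ n → (d : ℕ) (xs ys : List ℝ) →
    AreRootsOf (0ℝ ∷ xs) (DPoly n) → AreRootsOf (0ℝ ∷ ys) (DPoly (pred n)) →
    (HasDegree (DCoeff n) d → HasDegree (DCoeff (pred n)) d →
    length (0ℝ ∷ xs) ≡ d → length (0ℝ ∷ ys) ≡ d →
    Linked _>_ (0ℝ ∷ interleave xs ys))
    × (HasDegree (DCoeff n) (suc d) → HasDegree (DCoeff (pred n)) d →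
    length (0ℝ ∷ xs) ≡ suc d → length (0ℝ ∷ ys) ≡ d →
    Linked _>_ (0ℝ ∷ interleave xs ys)))
theorem1 (suc (suc m)) (ℕ.s≤s (ℕ.s≤s ℕ.z≤n)) =
    DCoeff-degree m
  -- `n` is taken as the lower index of `interlaced m`, so that n = 2 is included; for the
  -- interlacing it is the upper index of the pair before.
  , LowerRoots.realSimple m
  , (ys , ≡.cong suc len-ys , LowerRoots.areRoots m)
  -- One statement about `interleave` serves both degree patterns: whether it ends with an x or a y
  -- is settled by the lengths of the lists.
  , λ 3≤n d us vs rus rvs → let l = interlace m 3≤n us vs rus rvs in (λ _ _ _ _ → l) , (λ _ _ _ _ → l)
  where
  open Interlaced (interlaced m) using (ys; len-ys)

  interlace : ∀ m → 3 ℕ.≤ suc (suc m) → ∀ us vs → AreRootsOf (0ℝ ∷ us) (DPoly (suc (suc m))) →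
    AreRootsOf (0ℝ ∷ vs) (DPoly (suc m)) → Linked _>_ (0ℝ ∷ interleave us vs)
  interlace zero    (ℕ.s≤s (ℕ.s≤s ()))
  interlace (suc m) _ = roots-interlace m
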